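{- For every $t>0$, $b\ge0$ and $p\in\mathbb Z_{\ge0}$, as $N\to\infty$, $$Z_{1+b,N}(t)=\bigl[\mathcal Z_{b,t}\bigr]_{\le p}\Bigl(\frac1{N+b}\Bigr)+O_{t,b,p}\bigl((N+b)^{ -p-1}\bigr),$$ and the remainder is locally uniform for $(t,b)\in(0,\infty)\times[0,\infty)$: for every compact $K\subset(0,\infty)\times[0,\infty)$ and every $p\in\mathbb Z_{\ge0}$ there exist $C_{K,p}<\infty$ and $N_{K,p}\ge1$ such that for all $N\ge N_{K,p}$ $$\sup_{(t,b)\in K}(N+b)^{p+1}\Bigl|Z_{1+b,N}(t)-\bigl[\mathcal Z_{b,t}\bigr]_{\le p}\Bigl(\frac1{N+b}\Bigr)\Bigr|\le C_{K,p}.$$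
   Context: For $N\ge1$ and $\alpha>0$ let $\widehat{\mathrm U(N)}=\{\lambda\in\mathbb Z^N:\lambda_1\ge\dots\ge\lambda_N\}$ and $$\kappa_{\alpha,N}(\lambda)=\frac1{N+\alpha-1}\Bigl(\alpha\sum_{i=1}^N\lambda_i^2+\sum_{i=1}^N(N+1-2i)\lambda_i\Bigr).$$ The Jack heat trace is $Z_{\alpha,N}(t)=\sum_{\lambda\in\widehat{\mathrm U(N)}}e^{ -\frac t2\kappa_{\alpha,N}(\lambda)}$. (It is the trace of $e^{\frac t2\mathscr L_{\alpha,N}}$ on the symmetric functions in $L^2(\mathbb T^N,\prod_{i<j}|e^{\mathrm i\theta_i}-e^{\mathrm i\theta_j}|^{2/\alpha}d\theta)$, where $\mathscr L_{\alpha,N}$ is the self-adjoint closure, from symmetric Laurent polynomials, of $\frac{\alpha}{N+\alpha-1}\sum_i\partial_{\theta_i}^2+\frac1{N+\alpha-1}\sum_{i<j}\cot\frac{\theta_i-\theta_j}2(\partial_{\theta_i}-\partial_{\theta_j})$.) For a partition $\lambda$, $\mathsf C_\alpha(\lambda)=\sum_{(i,j)\in\lambda}(\alpha(j-1)-(i-1))$. The elliptic $b$-Hurwitz numbers are $\mathsf H_{1,b}(d,r)=\sum_{\lambda\vdash d}\mathsf C_{1+b}(\lambda)^r$ (with $\mathsf H_{1,b}(0,0)=1$, $\mathsf H_{1,b}(0,r)=0$ for $r>0$), and $\mathscr H_b(q;\hbar)=\sum_{d,r\ge0}\mathsf H_{1,b}(d,r)q^d\frac{\hbar^r}{r!}$.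 Shifted arguments are formal: $\mathscr H_b(qe^u;\hbar):=e^{u\,q\frac{d}{dq}}\mathscr H_b(q;\hbar)$, i.e. the degree-$d$ term acquires the factor $e^{ud}$, expanded as a power series in $u$. Put $q_t=e^{ -t/2}$, $\Theta_{1+b}(t)=\sum_{m\in\mathbb Z}e^{ -\frac t2(1+b)m^2}$, and let $M$ be a random integer with $\mathbb P(M=m)=e^{ -\frac t2(1+b)m^2}/\Theta_{1+b}(t)$. The formal chiral–antichiral generating series is the formal power series in $x$ $$\mathcal Z_{b,t}(x)=\Theta_{1+b}(t)\,\mathbb E_M\Bigl[e^{\frac12b(1+b)txM^2}\,\mathscr H_b\bigl(q_te^{ -(1+b)tMx};-tx\bigr)\,\mathscr H_b\bigl(q_te^{(1+b)tMx};-tx\bigr)\Bigr],$$ where everything is expanded in powers of $x$ and the expectation (and the sum over degrees, evaluated at $q=q_t$) is taken coefficientwise; all coefficients are given by absolutely convergent sums. For a formal series $A(x)=\sum_r a_rx^r$, $[A]_{\le p}(x)=\sum_{r=0}^pa_rx^r$. -}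

module Defs where

open import Algebra.Bundles using (CommutativeRing; Semiring)
open import Axiom.ExcludedMiddle using (ExcludedMiddle)
open import Data.Fin.Base using (toℕ)
open import Data.Integer.Base as ℤ using (ℤ; +_; -[1+_])
open import Data.List.Base as List using (List)
open import Data.List.Relation.Binary.Subset.Propositional using (_⊆_)
open import Data.List.Relation.Unary.All using (All)
open import Data.List.Relation.Unary.Any using (Any)
open import Data.List.Relation.Unary.Linked using (Linked)
open import Data.List.Relation.Unary.Unique.Propositional using (Unique)
open import Data.Nat.Base as ℕ using (ℕ; suc; _∸_; _!)
open import Data.Product.Base using (∃; ∃-syntax; _×_; _,_)
open import Data.Sum.Base using ([_,_])
open import Data.Vec.Base as Vec using (Vec)
import Data.Vec.Relation.Unary.Linked as VecLinked
open import Function.Base using (const)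
open import Level using (0ℓ)
open import Relation.Binary.Core using (Rel)
open import Relation.Binary.PropositionalEquality.Core using (_≡_)
open import Relation.Binary.Structures using (IsTotalOrder)
open import Relation.Nullary.Decidable.Core using (yes; no)
open import Relation.Unary using (Pred; U)
import Algebra.Definitions.RawSemiring as RawSemiringDefs
import Algebra.Properties.Monoid.Sum as MonoidSum
import Relation.Binary.Construct.NonStrictToStrict as ToStrict

-- The real numbers: classically, a (Dedekind-)complete ordered field is
-- unique up to isomorphism.  Equality is the setoid equality _≈_, and the
-- inverse is total, with an irrelevant value at 0#.

record CompleteOrderedField : Set₁ where
  infix 4 _≤_
  infix 9 _⁻¹
  field
    commutativeRing : CommutativeRing 0ℓ 0ℓ

  open CommutativeRing commutativeRing public

  field
    _≤_          : Rel Carrier 0ℓ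
    _⁻¹          : Carrier → Carrier
    1≉0          : 1# ≉ 0#
    ⁻¹-cong      : ∀ {x y} → x ≈ y → x ⁻¹ ≈ y ⁻¹
    ⁻¹-inverseʳ  : ∀ {x} → x ≉ 0# → x * x ⁻¹ ≈ 1#
    isTotalOrder : IsTotalOrder _≈_ _≤_
    +-monoʳ-≤    : ∀ z {x y} → x ≤ y → z + x ≤ z + y
    *-nonNeg     : ∀ {x y} → 0# ≤ x → 0# ≤ y → 0# ≤ x * y

  IsUpperBound : Pred Carrier 0ℓ → Pred Carrier 0ℓ
  IsUpperBound P u = ∀ x → P x → x ≤ u

  field
    complete : (P : Pred Carrier 0ℓ) → ∃ P → ∃ (IsUpperBound P) →
               ∃[ s ] IsUpperBound P s × (∀ u → IsUpperBound P u → s ≤ u)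

module Real (R : CompleteOrderedField) where
  open CompleteOrderedField R public
  open ToStrict _≈_ _≤_ public using (_<_)
  open RawSemiringDefs (Semiring.rawSemiring semiring) public using (_^_) renaming (_×_ to _·_)
  open MonoidSum +-monoid public using (sum-syntax; sum⁺-syntax)

  ∣_∣ : Carrier → Carrier
  ∣ x ∣ = [ const x , const (- x) ] (IsTotalOrder.total isTotalOrder 0# x)

  fromℕ : ℕ → Carrier
  fromℕ n = n · 1#

  fromℤ : ℤ → Carrier
  fromℤ (+ n)    = fromℕ n
  fromℤ -[1+ n ] = - fromℕ (suc n)

  ½ : Carrier
  ½ = fromℕ 2 ⁻¹

  -- A finite subset of S is a duplicate-free list of elements of S.
  FiniteSubset : {I : Set} → Pred I 0ℓ → Pred (List I) 0ℓ
  FiniteSubset S F = Unique F × All S F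

  finiteSum : {I : Set} → (I → Carrier) → List I → Carrier
  finiteSum f F = List.foldr _+_ 0# (List.map f F)

  -- Unconditional (equivalently, absolute) convergence of ∑_{i ∈ S} f i to s.
  HasSum : {I : Set} → Pred I 0ℓ → (I → Carrier) → Carrier → Set
  HasSum {I} S f s =
    ∀ ε → 0# < ε → ∃[ F₀ ] FiniteSubset S F₀ ×
      (∀ F → FiniteSubset S F → F₀ ⊆ F → ∣ finiteSum f F - s ∣ < ε)

  Plane : Set
  Plane = Carrier × Carrier

  Open : Pred (Pred Plane 0ℓ) 0ℓ
  Open V = ∀ t b → V (t , b) → ∃[ ε ] (0# < ε) ×
    (∀ t′ b′ → ∣ t′ - t ∣ < ε → ∣ b′ - b ∣ < ε → V (t′ , b′))

  Compact : Pred Plane 0ℓ → Set₁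
  Compact K = {I : Set} (V : I → Pred Plane 0ℓ) → (∀ i → Open (V i)) →
    (∀ x → K x → ∃[ i ] V i x) →
    ∃[ is ] (∀ x → K x → Any (λ i → V i x) is)

module Jack (em : ExcludedMiddle 0ℓ) (R : CompleteOrderedField) where
  open Real R public

  -- The sum of the family if it converges; the junk value 0# otherwise.
  sumOver : {I : Set} → Pred I 0ℓ → (I → Carrier) → Carrier
  sumOver S f with em {∃ (HasSum S f)}
  ... | yes (s , _) = s
  ... | no  _       = 0#

  sumAll : {I : Set} → (I → Carrier) → Carrier
  sumAll = sumOver U

  exp : Carrier → Carrier
  exp x = sumAll (λ n → x ^ n * fromℕ (n !) ⁻¹)

  Signature : (N : ℕ) → Pred (Vec ℤ N) 0ℓ
  Signature N = VecLinked.Linked ℤ._≥_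

  -- The index i : Fin N is zero-based, so the one-based index is suc (toℕ i).
  κ : Carrier → (N : ℕ) → Vec ℤ N → Carrier
  κ α N λs = (fromℕ N + α - 1#) ⁻¹ *
    ( α * (∑[ i < N ] (fromℤ (Vec.lookup λs i) ^ 2))
    + (∑[ i < N ] ((fromℕ N + 1# - fromℕ 2 * fromℕ (suc (toℕ i)))
                   * fromℤ (Vec.lookup λs i))) )

  heatTrace : Carrier → ℕ → Carrier → Carrier
  heatTrace α N t = sumOver (Signature N) (λ λs → exp (- (t * ½ * κ α N λs)))

  IsPartitionOf : ℕ → Pred (List ℕ) 0ℓ
  IsPartitionOf d μ = Linked ℕ._≥_ μ × All (0 ℕ.<_) μ × List.sum μ ≡ d

  -- Boxes are indexed from zero, absorbing the shifts in α(j-1) - (i-1).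
  content : Carrier → List ℕ → Carrier
  content α μ = ∑[ i < List.length μ ] (∑[ j < List.lookup μ i ]
    (α * fromℕ (toℕ j) - fromℕ (toℕ i)))

  ellipticHurwitz : Carrier → ℕ → ℕ → Carrier
  ellipticHurwitz b d r =
    sumOver (IsPartitionOf d) (λ μ → content (1# + b) μ ^ r)

  -- The coefficient of q^d ħ^r in ℋ_b(q;ħ).
  ℋ : Carrier → ℕ → ℕ → Carrier
  ℋ b d r = ellipticHurwitz b d r * fromℕ (r !) ⁻¹

  -- The coefficient of q^d ħ^r u^j in ℋ_b(q e^u;ħ) = e^{u q d/dq} ℋ_b(q;ħ).
  ℋ-shifted : Carrier → ℕ → ℕ → ℕ → Carrier
  ℋ-shifted b d r j = (fromℕ d ^ j * fromℕ (j !) ⁻¹) * ℋ b d r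

  -- Formal power series in x, given by their coefficients.
  Series : Set
  Series = ℕ → Carrier

  infixl 7 _⊛_
  _⊛_ : Series → Series → Series
  (A ⊛ B) n = ∑[ j ≤ n ] (A (toℕ j) * B (n ∸ toℕ j))

  -- e^{cx}
  expSeries : Carrier → Series
  expSeries c n = c ^ n * fromℕ (n !) ⁻¹

  -- ℋ_b(q e^{vx}; hx) as a series in x: u = vx and ħ = hx are substituted in
  -- each degree d, and each coefficient is then summed over d at the number q.
  ℋ-series : (b q v h : Carrier) → Series
  ℋ-series b q v h n = sumAll (λ d → q ^ d *
    (∑[ j ≤ n ] (ℋ-shifted b d (n ∸ toℕ j) (toℕ j)
                 * v ^ toℕ j * h ^ (n ∸ toℕ j))))

  gaussian : Carrier → Carrier → ℤ → Carrier
  gaussian α t m = exp (- (t * ½ * α * fromℤ m ^ 2))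

  Θ : Carrier → Carrier → Carrier
  Θ α t = sumAll (gaussian α t)

  -- 𝔼_M [g(M)], where ℙ(M = m) = gaussian (1# + b) t m / Θ (1# + b) t.
  𝔼 : (b t : Carrier) → (ℤ → Carrier) → Carrier
  𝔼 b t g = sumAll (λ m → (gaussian (1# + b) t m * Θ (1# + b) t ⁻¹) * g m)

  𝒵 : (b t : Carrier) → Series
  𝒵 b t n = Θ (1# + b) t * 𝔼 b t (λ m →
    ( expSeries (½ * b * (1# + b) * t * fromℤ m ^ 2)
    ⊛ ℋ-series b q (- ((1# + b) * t * fromℤ m)) (- t)
    ⊛ ℋ-series b q ((1# + b) * t * fromℤ m) (- t) ) n)
    where
    q : Carrier
    q = exp (- (t * ½))

  truncate : ℕ → Series → Carrier → Carrier
  truncate p A x = ∑[ r ≤ p ] (A (toℕ r) * x ^ toℕ r)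

{-# OPTIONS --safe #-}
-- A signature λ of length N = a + 1 + c is encoded by a triple (m , μ , ν) through
-- λ_i = m + μ_i − ν_{N+1−i}, where m = λ_{a+1} and the partitions μ and ν have at most a and c parts.
-- With x = 1/(N+b), α = 1 + b and S = m² + |μ| + |ν|, a term of the heat trace becomes w e^{xE}, where
--   w = exp (−t/2 (α m² + |μ| + |ν|)),
--   E = tαb m²/2 − tαm (|μ| − |ν|) − t C_α(μ) − t C_α(ν)
-- do not depend on N, and the coefficient of x^r in the formal series is ∑ w E^r/r! over all triples.
-- For a and c close to N/2, Chebyshev's sum inequality makes κ at least a multiple of S, so that
-- w e^{xE} ≤ e^{−tS/8}.  Taylor's formula then bounds the error of each term by
-- x^{p+1} poly(S) e^{−tS/8}.  The triples missing from the heat trace have S ≥ N/2, so a factor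
-- (4xS)^{p+1} ≥ 1 can be inserted in their terms.  The resulting bound is summable because
-- ∏ 1/(1−ρ^k) < ∞ for ρ < 1.  Uniformity holds on every region t₀ ≤ t ≤ t₁, 0 ≤ b ≤ b₁, hence on compacts.

module Submission where

open import Defs

open import Axiom.ExcludedMiddle using (ExcludedMiddle)
open import Data.Empty using (⊥-elim)
open import Data.Fin.Base as Fin using (Fin; toℕ)
import Data.Fin.Properties as Fin
open import Data.Integer.Base as ℤ using (ℤ; +_; -[1+_])
import Data.Integer.Properties as ℤ
open import Data.List.Base as List using
  (List; []; _∷_; _++_; map; filter; deduplicate; cartesianProduct; downFrom; allFin)
open import Data.List.Membership.Propositional using (_∈_)
open import Data.List.Membership.Propositional.Properties using
  ( ∈-map⁺; ∈-map⁻; ∈-filter⁺; ∈-filter⁻; ∈-++⁺ˡ; ∈-++⁺ʳ; ∈-++⁻; ∈-∃++; ∈-deduplicate⁺; ∈-deduplicate⁻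
  ; ∈-downFrom⁺; ∈-downFrom⁻; ∈-cartesianProduct⁺; ∈-allFin )
open import Data.List.Relation.Binary.Subset.Propositional using (_⊆_)
open import Data.List.Relation.Unary.All as All using (All; []; _∷_)
import Data.List.Relation.Unary.All.Properties as All
open import Data.List.Relation.Unary.AllPairs using ([]; _∷_)
open import Data.List.Relation.Unary.Any using (Any; here; there)
open import Data.List.Relation.Unary.Linked as Linked using (Linked; []; [-]; _∷_)
open import Data.List.Relation.Unary.Linked.Properties using (Linked⇒AllPairs)
open import Data.List.Relation.Unary.Unique.DecPropositional.Properties using (deduplicate-!)
open import Data.List.Relation.Unary.Unique.Propositional using (Unique)
import Data.List.Relation.Unary.Unique.Propositional.Properties as Unique
open import Data.Maybe.Base using (just; nothing)
open import Data.Nat.Base as ℕ using (ℕ; zero; suc; _∸_; _!; ⌊_/2⌋; ⌈_/2⌉)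
open import Data.Nat.Combinatorics using (nCk≡n!/k![n-k]!) renaming (_C_ to _choose_)
open import Data.Nat.Combinatorics.Specification using ([n∸k]!k!∣n!)
import Data.Nat.Divisibility as ℕ
open import Data.Nat.DivMod using (m/n*n≡m)
import Data.Nat.ListAction as ℕ
import Data.Nat.Properties as ℕ
open import Data.Product.Base using (∃; ∃-syntax; _×_; _,_; proj₁; proj₂)
open import Data.Sum.Base using (_⊎_; inj₁; inj₂)
open import Data.Unit.Base using (tt)
open import Data.Vec.Base as Vec using (Vec; []; _∷_)
import Data.Vec.Properties as Vec
import Data.Vec.Relation.Unary.Linked as VecLinked
import Data.Vec.Relation.Unary.Linked.Properties as VecLinked
open import Function.Base using (_∘_; id)
open import Level using (0ℓ)
open import Relation.Binary.Bundles using (Poset)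
open import Relation.Binary.Definitions using (WeaklyDecidable)
open import Relation.Binary.PropositionalEquality.Core as ≡ using (_≡_)
open import Relation.Binary.Structures using (IsTotalOrder)
open import Relation.Nullary using (¬_; Dec; yes; no)
open import Relation.Unary using (Pred; U)
open import Algebra.Solver.Ring.AlmostCommutativeRing
  using (fromCommutativeRing; _-Raw-AlmostCommutative⟶_; Induced-equivalence)
import Algebra.Properties.AbelianGroup as AbelianGroupProperties
import Algebra.Properties.CommutativeSemiring.Binomial as Binomial
import Algebra.Properties.CommutativeSemiring.Exp as ExpProperties
import Algebra.Properties.Ring as RingProperties
import Algebra.Properties.Semiring.Mult as MultProperties
import Algebra.Properties.Semiring.Sum as SumProperties
import Algebra.Solver.Ring as RingSolver
import Relation.Binary.Construct.NonStrictToStrict as ToStrict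
import Relation.Binary.Reasoning.PartialOrder as PosetReasoning

-- The heat trace is never expanded in N. The obstacle is that E grows like S². For one column of
-- height far above N, x E outgrows the decay of w, so w e^{xE} is not even summable over all
-- triples, although every coefficient of the formal series is. The cut near N/2 serves that bound
-- twice: on at most about half of the rows the linear term of κ keeps half of N (|μ| + |ν|), and
-- completing squares in the cross term 2 α m (|μ| - |ν|) costs at most half of α N m². All infinite
-- sums are limits over finite subsets. A majorant gives existence, `HasSum-fibration` rearranges,
-- and uniqueness identifies the limit with the value chosen by `sumOver`.

module JackHeatTrace (em : ExcludedMiddle 0ℓ) (R : CompleteOrderedField) where
  open Jack em R hiding (zero)
  open IsTotalOrder isTotalOrder using (total; antisym; isPartialOrder)
    renaming (refl to ≤-refl; trans to ≤-trans; reflexive to ≤-reflexive)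
  open RingProperties ring using (-0#≈0#; -‿distribˡ-*; -‿distribʳ-*; -‿involutive)
  open AbelianGroupProperties +-abelianGroup using (⁻¹-∙-comm)
  open MultProperties semiring using (×-homo-+; ×1-homo-*; ×-assoc-*; ×-congʳ)
  open ExpProperties commutativeSemiring
    using (^-congˡ; ^-homo-*; ^-distrib-*; ^-assocʳ)

  poset : Poset 0ℓ 0ℓ 0ℓ
  poset = record { isPartialOrder = isPartialOrder }

  module ≤-Reasoning = PosetReasoning poset
  open ≤-Reasoning

  -- Integers in the field and the ring solver

  fromℕ-+ : ∀ m n → fromℕ (m ℕ.+ n) ≈ fromℕ m + fromℕ n
  fromℕ-+ = ×-homo-+ 1#

  fromℕ-* : ∀ m n → fromℕ (m ℕ.* n) ≈ fromℕ m * fromℕ n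
  fromℕ-* = ×1-homo-*

  fromℤ-⊖ : ∀ m n → fromℤ (m ℤ.⊖ n) ≈ fromℕ m - fromℕ n
  fromℤ-⊖ m zero = sym (trans (+-congˡ -0#≈0#) (+-identityʳ _))
  fromℤ-⊖ zero (suc n) = sym (+-identityˡ _)
  fromℤ-⊖ (suc m) (suc n) = begin-equality
    fromℤ (suc m ℤ.⊖ suc n)                     ≡⟨ ≡.cong fromℤ (ℤ.[1+m]⊖[1+n]≡m⊖n m n) ⟩
    fromℤ (m ℤ.⊖ n)                             ≈⟨ fromℤ-⊖ m n ⟩
    fromℕ m - fromℕ n                           ≈⟨ +-congʳ (+-identityˡ _) ⟨
    0# + fromℕ m - fromℕ n                      ≈⟨ +-congʳ (+-congʳ (-‿inverseʳ 1#)) ⟨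
    1# - 1# + fromℕ m - fromℕ n                 ≈⟨ +-congʳ (+-assoc _ _ _) ⟩
    1# + (- 1# + fromℕ m) - fromℕ n             ≈⟨ +-congʳ (+-congˡ (+-comm _ _)) ⟩
    1# + (fromℕ m - 1#) - fromℕ n               ≈⟨ +-congʳ (+-assoc _ _ _) ⟨
    1# + fromℕ m - 1# - fromℕ n                 ≈⟨ +-assoc _ _ _ ⟩
    1# + fromℕ m + (- 1# - fromℕ n)             ≈⟨ +-congˡ (⁻¹-∙-comm _ _) ⟩
    fromℕ (suc m) - fromℕ (suc n)               ∎

  fromℤ-neg : ∀ i → fromℤ (ℤ.- i) ≈ - fromℤ i
  fromℤ-neg (+ zero)  = sym -0#≈0#
  fromℤ-neg (+ suc n) = refl
  fromℤ-neg -[1+ n ]  = sym (-‿involutive _)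

  fromℤ-+ : ∀ i j → fromℤ (i ℤ.+ j) ≈ fromℤ i + fromℤ j
  fromℤ-+ (+ m)    (+ n)    = fromℕ-+ m n
  fromℤ-+ (+ m)    -[1+ n ] = fromℤ-⊖ m (suc n)
  fromℤ-+ -[1+ m ] (+ n)    = trans (fromℤ-⊖ n (suc m)) (+-comm _ _)
  fromℤ-+ -[1+ m ] -[1+ n ] = begin-equality
    - fromℕ (suc (suc (m ℕ.+ n)))       ≡⟨ ≡.cong (λ k → - fromℕ (suc k)) (ℕ.+-suc m n) ⟨
    - fromℕ (suc m ℕ.+ suc n)           ≈⟨ -‿cong (fromℕ-+ (suc m) (suc n)) ⟩
    - (fromℕ (suc m) + fromℕ (suc n))   ≈⟨ ⁻¹-∙-comm _ _ ⟨
    - fromℕ (suc m) - fromℕ (suc n)     ∎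

  private
    fromℤ-+* : ∀ m j → fromℤ (+ m ℤ.* j) ≈ fromℕ m * fromℤ j
    fromℤ-+* m (+ n) = trans (reflexive (≡.cong fromℤ (≡.sym (ℤ.pos-* m n)))) (fromℕ-* m n)
    fromℤ-+* m -[1+ n ] = begin-equality
      fromℤ (+ m ℤ.* -[1+ n ])       ≡⟨ ≡.cong fromℤ (ℤ.neg-distribʳ-* (+ m) (+ suc n)) ⟨
      fromℤ (ℤ.- (+ m ℤ.* + suc n))  ≈⟨ fromℤ-neg (+ m ℤ.* + suc n) ⟩
      - fromℤ (+ m ℤ.* + suc n)      ≈⟨ -‿cong (fromℤ-+* m (+ suc n)) ⟩
      - (fromℕ m * fromℕ (suc n))    ≈⟨ -‿distribʳ-* _ _ ⟩
      fromℕ m * - fromℕ (suc n)      ∎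

  fromℤ-* : ∀ i j → fromℤ (i ℤ.* j) ≈ fromℤ i * fromℤ j
  fromℤ-* (+ m) j = fromℤ-+* m j
  fromℤ-* -[1+ m ] j = begin-equality
    fromℤ (-[1+ m ] ℤ.* j)         ≡⟨ ≡.cong fromℤ (ℤ.neg-distribˡ-* (+ suc m) j) ⟨
    fromℤ (ℤ.- (+ suc m ℤ.* j))    ≈⟨ fromℤ-neg (+ suc m ℤ.* j) ⟩
    - fromℤ (+ suc m ℤ.* j)        ≈⟨ -‿cong (fromℤ-+* (suc m) j) ⟩
    - (fromℕ (suc m) * fromℤ j)    ≈⟨ -‿distribˡ-* _ _ ⟩
    - fromℕ (suc m) * fromℤ j      ∎

  -- Interprets the coefficients of the ring solver; unlike fromℤ it sends 1 to 1# on the nose.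
  coefficient : ℤ → Carrier
  coefficient (+ 1) = 1#
  coefficient i     = fromℤ i

  coefficient≈fromℤ : ∀ i → coefficient i ≈ fromℤ i
  coefficient≈fromℤ (+ 0)             = refl
  coefficient≈fromℤ (+ 1)             = sym (+-identityʳ 1#)
  coefficient≈fromℤ (+ suc (suc n))   = refl
  coefficient≈fromℤ -[1+ n ]          = refl

  private
    coefficientMorphism : ℤ.+-*-rawRing -Raw-AlmostCommutative⟶ fromCommutativeRing commutativeRing
    coefficientMorphism = record
      { ⟦_⟧    = coefficient
      ; +-homo = λ i j → trans (coefficient≈fromℤ (i ℤ.+ j)) (trans (fromℤ-+ i j)
                   (sym (+-cong (coefficient≈fromℤ i) (coefficient≈fromℤ j))))
      ; *-homo = λ i j → trans (coefficient≈fromℤ (i ℤ.* j)) (trans (fromℤ-* i j)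
                   (sym (*-cong (coefficient≈fromℤ i) (coefficient≈fromℤ j))))
      ; -‿homo = λ i → trans (coefficient≈fromℤ (ℤ.- i)) (trans (fromℤ-neg i)
                   (-‿cong (sym (coefficient≈fromℤ i))))
      ; 0-homo = refl
      ; 1-homo = refl
      }

    coefficient≟ : WeaklyDecidable (Induced-equivalence coefficientMorphism)
    coefficient≟ i j with i ℤ.≟ j
    ... | yes ≡.refl = just refl
    ... | no  _      = nothing

  open RingSolver ℤ.+-*-rawRing (fromCommutativeRing commutativeRing)
    coefficientMorphism coefficient≟
    using (solve; _:=_; con; _:+_; _:*_; _:-_; :-_; _:^_)

  -- Ordered fields

  ≤-by : ∀ {x y c} → 0# ≤ c → y ≈ x + c → x ≤ y
  ≤-by {x} {y} {c} 0≤c y≈x+c = begin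
    x       ≈⟨ +-identityʳ x ⟨
    x + 0#  ≤⟨ +-monoʳ-≤ x 0≤c ⟩
    x + c   ≈⟨ y≈x+c ⟨
    y       ∎

  x≤y⇒0≤y-x : ∀ {x y} → x ≤ y → 0# ≤ y - x
  x≤y⇒0≤y-x {x} {y} x≤y = begin
    0#      ≈⟨ -‿inverseˡ x ⟨
    - x + x ≤⟨ +-monoʳ-≤ (- x) x≤y ⟩
    - x + y ≈⟨ +-comm _ _ ⟩
    y - x   ∎

  +-mono-≤ : ∀ {x y u v} → x ≤ y → u ≤ v → x + u ≤ y + v
  +-mono-≤ {x} {y} {u} {v} x≤y u≤v = begin
    x + u  ≤⟨ +-monoʳ-≤ x u≤v ⟩
    x + v  ≈⟨ +-comm x v ⟩
    v + x  ≤⟨ +-monoʳ-≤ v x≤y ⟩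
    v + y  ≈⟨ +-comm v y ⟩
    y + v  ∎

  +-nonNeg : ∀ {x y} → 0# ≤ x → 0# ≤ y → 0# ≤ x + y
  +-nonNeg 0≤x 0≤y = ≤-trans (≤-reflexive (sym (+-identityʳ 0#))) (+-mono-≤ 0≤x 0≤y)

  neg-mono-≤ : ∀ {x y} → x ≤ y → - y ≤ - x
  neg-mono-≤ {x} {y} x≤y = ≤-by (x≤y⇒0≤y-x x≤y) (solve 2 (λ x y → :- x := :- y :+ (y :- x)) refl x y)

  neg-nonNeg : ∀ {x} → x ≤ 0# → 0# ≤ - x
  neg-nonNeg x≤0 = ≤-trans (≤-reflexive (sym -0#≈0#)) (neg-mono-≤ x≤0)

  *-monoʳ-≤ : ∀ {z x y} → 0# ≤ z → x ≤ y → z * x ≤ z * y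
  *-monoʳ-≤ {z} {x} {y} 0≤z x≤y = ≤-by (*-nonNeg 0≤z (x≤y⇒0≤y-x x≤y))
    (solve 3 (λ x y z → z :* y := z :* x :+ z :* (y :- x)) refl x y z)

  *-monoˡ-≤ : ∀ {z x y} → 0# ≤ z → x ≤ y → x * z ≤ y * z
  *-monoˡ-≤ {z} {x} {y} 0≤z x≤y = ≤-by (*-nonNeg 0≤z (x≤y⇒0≤y-x x≤y))
    (solve 3 (λ x y z → y :* z := x :* z :+ z :* (y :- x)) refl x y z)

  *-mono-≤ : ∀ {x y u v} → 0# ≤ x → x ≤ y → 0# ≤ u → u ≤ v → x * u ≤ y * v
  *-mono-≤ 0≤x x≤y 0≤u u≤v = ≤-trans (*-monoˡ-≤ 0≤u x≤y) (*-monoʳ-≤ (≤-trans 0≤x x≤y) u≤v)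

  x*x-nonNeg : ∀ x → 0# ≤ x * x
  x*x-nonNeg x with total 0# x
  ... | inj₁ 0≤x = *-nonNeg 0≤x 0≤x
  ... | inj₂ x≤0 = ≤-trans (*-nonNeg (neg-nonNeg x≤0) (neg-nonNeg x≤0))
                     (≤-reflexive (solve 1 (λ x → (:- x) :* (:- x) := x :* x) refl x))

  0≤1 : 0# ≤ 1#
  0≤1 = ≤-trans (x*x-nonNeg 1#) (≤-reflexive (*-identityˡ 1#))

  0<1 : 0# < 1#
  0<1 = 0≤1 , (λ 0≈1 → 1≉0 (sym 0≈1))

  <⇒≤ : ∀ {x y} → x < y → x ≤ y
  <⇒≤ = proj₁

  <⇒≱ : ∀ {x y} → x < y → ¬ (y ≤ x)
  <⇒≱ = ToStrict.<⇒≱ _≈_ _≤_ antisym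

  ≰⇒> : ∀ {x y} → ¬ (x ≤ y) → y < x
  ≰⇒> = ToStrict.≰⇒> _≈_ _≤_ sym ≤-reflexive total

  ≤-<-trans : ∀ {x y z} → x ≤ y → y < z → x < z
  ≤-<-trans x≤y y<z = ToStrict.≤-<-trans _≈_ _≤_ ≤-trans antisym
    (λ x≈y x≤z → ≤-trans (≤-reflexive (sym x≈y)) x≤z) x≤y y<z

  <-≤-trans : ∀ {x y z} → x < y → y ≤ z → x < z
  <-≤-trans x<y y≤z = ToStrict.<-≤-trans _≈_ _≤_ sym ≤-trans antisym
    (λ x≈y z≤x → ≤-trans z≤x (≤-reflexive x≈y)) x<y y≤z

  ≤-or-> : ∀ x y → x ≤ y ⊎ y < x
  ≤-or-> x y with em {x ≤ y}
  ... | yes x≤y = inj₁ x≤y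
  ... | no  x≰y = inj₂ (≰⇒> x≰y)

  <⇒≉0 : ∀ {x} → 0# < x → x ≉ 0#
  <⇒≉0 0<x x≈0 = proj₂ 0<x (sym x≈0)

  x<y⇒0<y-x : ∀ {x y} → x < y → 0# < y - x
  x<y⇒0<y-x {x} {y} (x≤y , x≉y) = x≤y⇒0≤y-x x≤y , λ 0≈y-x → x≉y (begin-equality
    x            ≈⟨ +-identityʳ x ⟨
    x + 0#       ≈⟨ +-congˡ 0≈y-x ⟩
    x + (y - x)  ≈⟨ solve 2 (λ x y → x :+ (y :- x) := y) refl x y ⟩
    y            ∎)

  +-monoʳ-< : ∀ z {x y} → x < y → z + x < z + y
  +-monoʳ-< z {x} {y} x<y = +-monoʳ-≤ z (<⇒≤ x<y) , λ eq → proj₂ x<y (begin-equality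
    x            ≈⟨ solve 2 (λ x z → x := (z :+ x) :- z) refl x z ⟩
    (z + x) - z  ≈⟨ +-congʳ eq ⟩
    (z + y) - z  ≈⟨ solve 2 (λ x z → (z :+ x) :- z := x) refl y z ⟩
    y            ∎)

  +-mono-< : ∀ {x y u v} → x < y → u < v → x + u < y + v
  +-mono-< {x} {y} {u} {v} x<y u<v = <-≤-trans (+-monoʳ-< x u<v) (+-mono-≤ (<⇒≤ x<y) ≤-refl)

  *-cancelˡ-≈0 : ∀ {x y} → x ≉ 0# → x * y ≈ 0# → y ≈ 0#
  *-cancelˡ-≈0 {x} {y} x≉0 xy≈0 = begin-equality
    y               ≈⟨ *-identityˡ y ⟨
    1# * y          ≈⟨ *-congʳ (⁻¹-inverseʳ x≉0) ⟨
    x * x ⁻¹ * y    ≈⟨ solve 3 (λ x x⁻¹ y → x :* x⁻¹ :* y := x⁻¹ :* (x :* y)) refl x (x ⁻¹) y ⟩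
    x ⁻¹ * (x * y)  ≈⟨ *-congˡ xy≈0 ⟩
    x ⁻¹ * 0#       ≈⟨ zeroʳ _ ⟩
    0#              ∎

  *-pos : ∀ {x y} → 0# < x → 0# < y → 0# < x * y
  *-pos 0<x 0<y = *-nonNeg (<⇒≤ 0<x) (<⇒≤ 0<y) ,
    λ 0≈xy → <⇒≉0 0<y (*-cancelˡ-≈0 (<⇒≉0 0<x) (sym 0≈xy))

  +-pos-nonNeg : ∀ {x y} → 0# < x → 0# ≤ y → 0# < x + y
  +-pos-nonNeg {x} {y} 0<x 0≤y = <-≤-trans 0<x (≤-by 0≤y refl)

  ⁻¹-pos : ∀ {x} → 0# < x → 0# < x ⁻¹
  ⁻¹-pos {x} 0<x = ≰⇒> λ x⁻¹≤0 → <⇒≱ 0<1 (begin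
    1#             ≈⟨ ⁻¹-inverseʳ (<⇒≉0 0<x) ⟨
    x * x ⁻¹       ≤⟨ *-monoʳ-≤ (<⇒≤ 0<x) x⁻¹≤0 ⟩
    x * 0#         ≈⟨ zeroʳ x ⟩
    0#             ∎)

  ⁻¹-inverseˡ : ∀ {x} → x ≉ 0# → x ⁻¹ * x ≈ 1#
  ⁻¹-inverseˡ x≉0 = trans (*-comm _ _) (⁻¹-inverseʳ x≉0)

  fromℕ-nonNeg : ∀ n → 0# ≤ fromℕ n
  fromℕ-nonNeg zero    = ≤-refl
  fromℕ-nonNeg (suc n) = +-nonNeg 0≤1 (fromℕ-nonNeg n)

  fromℕ-pos : ∀ n → .{{ℕ.NonZero n}} → 0# < fromℕ n
  fromℕ-pos (suc n) = +-pos-nonNeg 0<1 (fromℕ-nonNeg n)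

  fromℕ-mono-≤ : ∀ {m n} → m ℕ.≤ n → fromℕ m ≤ fromℕ n
  fromℕ-mono-≤ {n = n} ℕ.z≤n = fromℕ-nonNeg n
  fromℕ-mono-≤ (ℕ.s≤s m≤n)   = +-monoʳ-≤ 1# (fromℕ-mono-≤ m≤n)

  fromℕ-1 : fromℕ 1 ≈ 1#
  fromℕ-1 = +-identityʳ 1#

  2*½≈1 : fromℕ 2 * ½ ≈ 1#
  2*½≈1 = ⁻¹-inverseʳ (<⇒≉0 (fromℕ-pos 2))

  0<½ : 0# < ½
  0<½ = ⁻¹-pos (fromℕ-pos 2)

  ½+½ : ∀ x → ½ * x + ½ * x ≈ x
  ½+½ x = begin-equality
    ½ * x + ½ * x      ≈⟨ solve 2 (λ h x → h :* x :+ h :* x := con (+ 2) :* h :* x) refl ½ x ⟩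
    fromℕ 2 * ½ * x    ≈⟨ *-congʳ 2*½≈1 ⟩
    1# * x             ≈⟨ *-identityˡ x ⟩
    x                  ∎

  ≤-by-ε : ∀ {x y} → (∀ ε → 0# < ε → x ≤ y + ε) → x ≤ y
  ≤-by-ε {x} {y} hyp with ≤-or-> x y
  ... | inj₁ x≤y = x≤y
  ... | inj₂ y<x = ⊥-elim (<⇒≱ 0<δ (begin
    δ                        ≈⟨ solve 3 (λ x y d → d := x :+ (d :+ d :- x :- d)) refl x y δ ⟩
    x + (δ + δ - x - δ)      ≤⟨ +-mono-≤ (hyp δ 0<δ) ≤-refl ⟩
    y + δ + (δ + δ - x - δ)  ≈⟨ +-congˡ (+-congʳ (+-congʳ (½+½ _))) ⟩
    y + δ + (x - y - x - δ)  ≈⟨ solve 3 (λ x y d → y :+ d :+ (x :- y :- x :- d) := con (+ 0)) refl x y δ ⟩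
    0#                       ∎))
    where
    δ = ½ * (x - y)
    0<δ = *-pos 0<½ (x<y⇒0<y-x y<x)

  -- If x bounded all natural numbers, they would have a supremum s; since n + 1 ≤ s for every n, s
  -- - 1 would be a smaller upper bound.
  archimedean : ∀ x → ∃[ n ] x ≤ fromℕ n
  archimedean x with em {∃[ n ] x ≤ fromℕ n}
  ... | yes h = h
  ... | no  h = ⊥-elim (<⇒≱ 0<1 (begin
    1#               ≈⟨ solve 1 (λ s → con (+ 1) := s :- (s :- con (+ 1))) refl s ⟩
    s - (s - 1#)     ≤⟨ +-mono-≤ (least (s - 1#) s-1-bound) ≤-refl ⟩
    s - 1# - (s - 1#) ≈⟨ -‿inverseʳ _ ⟩
    0#               ∎))
    where
    isℕ : Pred Carrier 0ℓ
    isℕ y = ∃[ n ] y ≈ fromℕ n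
    sup = complete isℕ (0# , 0 , refl)
      (x , λ y (n , y≈n) → ≤-trans (≤-reflexive y≈n) (<⇒≤ (≰⇒> (λ x≤n → h (n , x≤n)))))
    s = proj₁ sup
    least = proj₂ (proj₂ sup)
    s-1-bound : IsUpperBound isℕ (s - 1#)
    s-1-bound y (n , y≈n) = begin
      y                  ≈⟨ y≈n ⟩
      fromℕ n            ≈⟨ solve 1 (λ n → n := (con (+ 1) :+ n) :- con (+ 1)) refl (fromℕ n) ⟩
      fromℕ (suc n) - 1# ≤⟨ +-mono-≤ (proj₁ (proj₂ sup) _ (suc n , refl)) ≤-refl ⟩
      s - 1#             ∎

  ^-nonNeg : ∀ n {x} → 0# ≤ x → 0# ≤ x ^ n
  ^-nonNeg zero    0≤x = 0≤1
  ^-nonNeg (suc n) 0≤x = *-nonNeg 0≤x (^-nonNeg n 0≤x)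

  ^-monoˡ-≤ : ∀ n {x y} → 0# ≤ x → x ≤ y → x ^ n ≤ y ^ n
  ^-monoˡ-≤ zero    0≤x x≤y = ≤-refl
  ^-monoˡ-≤ (suc n) 0≤x x≤y = *-mono-≤ 0≤x x≤y (^-nonNeg n 0≤x) (^-monoˡ-≤ n 0≤x x≤y)

  1^n≈1 : ∀ n → 1# ^ n ≈ 1#
  1^n≈1 zero    = refl
  1^n≈1 (suc n) = trans (*-identityˡ _) (1^n≈1 n)

  1≤x⇒1≤x^n : ∀ n {x} → 1# ≤ x → 1# ≤ x ^ n
  1≤x⇒1≤x^n n 1≤x = ≤-trans (≤-reflexive (sym (1^n≈1 n))) (^-monoˡ-≤ n 0≤1 1≤x)

  ^-monoʳ-≤ : ∀ {m n x} → 1# ≤ x → m ℕ.≤ n → x ^ m ≤ x ^ n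
  ^-monoʳ-≤ {n = n} 1≤x ℕ.z≤n     = 1≤x⇒1≤x^n n 1≤x
  ^-monoʳ-≤         1≤x (ℕ.s≤s m≤n) = *-monoʳ-≤ (≤-trans 0≤1 1≤x) (^-monoʳ-≤ 1≤x m≤n)

  ∣x∣-cases : ∀ x → (0# ≤ x × ∣ x ∣ ≡ x) ⊎ (x ≤ 0# × ∣ x ∣ ≡ - x)
  ∣x∣-cases x with IsTotalOrder.total isTotalOrder 0# x
  ... | inj₁ 0≤x = inj₁ (0≤x , ≡.refl)
  ... | inj₂ x≤0 = inj₂ (x≤0 , ≡.refl)

  x≤∣x∣ : ∀ x → x ≤ ∣ x ∣
  x≤∣x∣ x with ∣x∣-cases x
  ... | inj₁ (_   , eq) = ≤-reflexive (reflexive (≡.sym eq))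
  ... | inj₂ (x≤0 , eq) = ≤-trans (≤-trans x≤0 (neg-nonNeg x≤0)) (≤-reflexive (reflexive (≡.sym eq)))

  -x≤∣x∣ : ∀ x → - x ≤ ∣ x ∣
  -x≤∣x∣ x with ∣x∣-cases x
  ... | inj₁ (0≤x , eq) = ≤-trans (≤-trans (neg-mono-≤ 0≤x) (≤-reflexive -0#≈0#))
                            (≤-trans 0≤x (≤-reflexive (reflexive (≡.sym eq))))
  ... | inj₂ (_   , eq) = ≤-reflexive (reflexive (≡.sym eq))

  ∣x∣≤ : ∀ {x y} → x ≤ y → - x ≤ y → ∣ x ∣ ≤ y
  ∣x∣≤ {x} x≤y -x≤y with ∣x∣-cases x
  ... | inj₁ (_ , eq) = ≤-trans (≤-reflexive (reflexive eq)) x≤y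
  ... | inj₂ (_ , eq) = ≤-trans (≤-reflexive (reflexive eq)) -x≤y

  ∣x∣-nonNeg : ∀ x → 0# ≤ ∣ x ∣
  ∣x∣-nonNeg x with ∣x∣-cases x
  ... | inj₁ (0≤x , eq) = ≤-trans 0≤x (≤-reflexive (reflexive (≡.sym eq)))
  ... | inj₂ (x≤0 , eq) = ≤-trans (neg-nonNeg x≤0) (≤-reflexive (reflexive (≡.sym eq)))

  -- `total` may choose different branches for x and y, so congruence comes from antisymmetry and
  -- not from computation.
  ∣∣-cong : ∀ {x y} → x ≈ y → ∣ x ∣ ≈ ∣ y ∣
  ∣∣-cong {x} {y} x≈y = antisym
    (∣x∣≤ (≤-trans (≤-reflexive x≈y) (x≤∣x∣ y)) (≤-trans (≤-reflexive (-‿cong x≈y)) (-x≤∣x∣ y)))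
    (∣x∣≤ (≤-trans (≤-reflexive (sym x≈y)) (x≤∣x∣ x)) (≤-trans (≤-reflexive (-‿cong (sym x≈y))) (-x≤∣x∣ x)))

  0≤x⇒∣x∣≈x : ∀ {x} → 0# ≤ x → ∣ x ∣ ≈ x
  0≤x⇒∣x∣≈x {x} 0≤x = antisym
    (∣x∣≤ ≤-refl (≤-trans (neg-mono-≤ 0≤x) (≤-trans (≤-reflexive -0#≈0#) 0≤x))) (x≤∣x∣ x)

  ∣-x∣≈∣x∣ : ∀ x → ∣ - x ∣ ≈ ∣ x ∣
  ∣-x∣≈∣x∣ x = antisym
    (∣x∣≤ (-x≤∣x∣ x) (≤-trans (≤-reflexive (-‿involutive x)) (x≤∣x∣ x)))
    (∣x∣≤ (≤-trans (≤-reflexive (sym (-‿involutive x))) (-x≤∣x∣ (- x))) (x≤∣x∣ (- x)))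

  ∣∣-triangle : ∀ x y → ∣ x + y ∣ ≤ ∣ x ∣ + ∣ y ∣
  ∣∣-triangle x y = ∣x∣≤ (+-mono-≤ (x≤∣x∣ x) (x≤∣x∣ y))
    (≤-trans (≤-reflexive (solve 2 (λ x y → :- (x :+ y) := :- x :+ :- y) refl x y))
             (+-mono-≤ (-x≤∣x∣ x) (-x≤∣x∣ y)))

  ∣∣-* : ∀ x y → ∣ x * y ∣ ≈ ∣ x ∣ * ∣ y ∣
  ∣∣-* x y with ∣x∣-cases x | ∣x∣-cases y
  ... | inj₁ (0≤x , ex) | inj₁ (0≤y , ey) = trans (0≤x⇒∣x∣≈x (*-nonNeg 0≤x 0≤y))
        (sym (*-cong (reflexive ex) (reflexive ey)))
  ... | inj₁ (0≤x , ex) | inj₂ (y≤0 , ey) = trans (sym (∣-x∣≈∣x∣ _)) (trans (∣∣-cong (-‿distribʳ-* x y))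
        (trans (0≤x⇒∣x∣≈x (*-nonNeg 0≤x (neg-nonNeg y≤0))) (sym (*-cong (reflexive ex) (reflexive ey)))))
  ... | inj₂ (x≤0 , ex) | inj₁ (0≤y , ey) = trans (sym (∣-x∣≈∣x∣ _)) (trans (∣∣-cong (-‿distribˡ-* x y))
        (trans (0≤x⇒∣x∣≈x (*-nonNeg (neg-nonNeg x≤0) 0≤y)) (sym (*-cong (reflexive ex) (reflexive ey)))))
  ... | inj₂ (x≤0 , ex) | inj₂ (y≤0 , ey) = trans
        (∣∣-cong (solve 2 (λ x y → x :* y := (:- x) :* (:- y)) refl x y))
        (trans (0≤x⇒∣x∣≈x (*-nonNeg (neg-nonNeg x≤0) (neg-nonNeg y≤0)))
               (sym (*-cong (reflexive ex) (reflexive ey))))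

  ∣∣-^ : ∀ x n → ∣ x ^ n ∣ ≈ ∣ x ∣ ^ n
  ∣∣-^ x zero    = 0≤x⇒∣x∣≈x 0≤1
  ∣∣-^ x (suc n) = trans (∣∣-* x (x ^ n)) (*-congˡ (∣∣-^ x n))

  ∣x-y∣≈∣y-x∣ : ∀ x y → ∣ x - y ∣ ≈ ∣ y - x ∣
  ∣x-y∣≈∣y-x∣ x y = trans (∣∣-cong (solve 2 (λ x y → x :- y := :- (y :- x)) refl x y)) (∣-x∣≈∣x∣ (y - x))

  -- Finite sums

  Σ-cong : {I : Set} {f g : I → Carrier} (F : List I) → (∀ x → x ∈ F → f x ≈ g x) →
           finiteSum f F ≈ finiteSum g F
  Σ-cong []      f≈g = refl
  Σ-cong (x ∷ F) f≈g = +-cong (f≈g x (here ≡.refl)) (Σ-cong F (λ y y∈F → f≈g y (there y∈F)))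

  Σ-mono : {I : Set} {f g : I → Carrier} (F : List I) → (∀ x → x ∈ F → f x ≤ g x) →
           finiteSum f F ≤ finiteSum g F
  Σ-mono []      f≤g = ≤-refl
  Σ-mono (x ∷ F) f≤g = +-mono-≤ (f≤g x (here ≡.refl)) (Σ-mono F (λ y y∈F → f≤g y (there y∈F)))

  Σ-nonNeg : {I : Set} {f : I → Carrier} (F : List I) → (∀ x → 0# ≤ f x) → 0# ≤ finiteSum f F
  Σ-nonNeg []      0≤f = ≤-refl
  Σ-nonNeg (x ∷ F) 0≤f = +-nonNeg (0≤f x) (Σ-nonNeg F 0≤f)

  Σ-+ : {I : Set} (f g : I → Carrier) (F : List I) →
        finiteSum (λ x → f x + g x) F ≈ finiteSum f F + finiteSum g F
  Σ-+ f g []      = sym (+-identityʳ 0#)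
  Σ-+ f g (x ∷ F) = trans (+-congˡ (Σ-+ f g F))
    (solve 4 (λ a b c d → a :+ b :+ (c :+ d) := a :+ c :+ (b :+ d)) refl (f x) (g x) _ _)

  Σ-* : {I : Set} (c : Carrier) (f : I → Carrier) (F : List I) →
        finiteSum (λ x → c * f x) F ≈ c * finiteSum f F
  Σ-* c f []      = sym (zeroʳ c)
  Σ-* c f (x ∷ F) = trans (+-congˡ (Σ-* c f F)) (sym (distribˡ c _ _))

  Σ-++ : {I : Set} (f : I → Carrier) (F G : List I) →
         finiteSum f (F ++ G) ≈ finiteSum f F + finiteSum f G
  Σ-++ f []      G = sym (+-identityˡ _)
  Σ-++ f (x ∷ F) G = trans (+-congˡ (Σ-++ f F G)) (sym (+-assoc _ _ _))

  Σ-map : {I J : Set} (f : J → Carrier) (φ : I → J) (F : List I) →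
          finiteSum f (map φ F) ≈ finiteSum (f ∘ φ) F
  Σ-map f φ []      = refl
  Σ-map f φ (x ∷ F) = +-congˡ (Σ-map f φ F)

  Σ-cartesianProduct : {I J : Set} (f : I → Carrier) (g : J → Carrier) (F : List I) (G : List J) →
    finiteSum (λ (x , y) → f x * g y) (cartesianProduct F G) ≈ finiteSum f F * finiteSum g G
  Σ-cartesianProduct f g []      G = sym (zeroˡ _)
  Σ-cartesianProduct f g (x ∷ F) G = begin-equality
    finiteSum h (map (x ,_) G ++ cartesianProduct F G)
      ≈⟨ Σ-++ h (map (x ,_) G) _ ⟩
    finiteSum h (map (x ,_) G) + finiteSum h (cartesianProduct F G)
      ≈⟨ +-cong (Σ-map h (x ,_) G) (Σ-cartesianProduct f g F G) ⟩
    finiteSum (λ y → f x * g y) G + finiteSum f F * finiteSum g G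
      ≈⟨ +-congʳ (Σ-* (f x) g G) ⟩
    f x * finiteSum g G + finiteSum f F * finiteSum g G
      ≈⟨ distribʳ _ _ _ ⟨
    (f x + finiteSum f F) * finiteSum g G ∎
    where
    h : _ × _ → Carrier
    h (x , y) = f x * g y

  -- Each element of F is cut out of G once. Since G may contain repetitions, crude covering lists
  -- can serve as majorants.
  Σ-⊆ : {I : Set} {f : I → Carrier} → (∀ x → 0# ≤ f x) →
        (F G : List I) → Unique F → F ⊆ G → finiteSum f F ≤ finiteSum f G
  Σ-⊆ 0≤f []      G _ _ = Σ-nonNeg G 0≤f
  Σ-⊆ {f = f} 0≤f (x ∷ F) G (x∉F ∷ uF) F⊆G with ∈-∃++ (F⊆G (here ≡.refl))
  ... | A , B , ≡.refl = begin
    f x + finiteSum f F                  ≤⟨ +-monoʳ-≤ (f x) (Σ-⊆ 0≤f F (A ++ B) uF F⊆A++B) ⟩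
    f x + finiteSum f (A ++ B)           ≈⟨ +-congˡ (Σ-++ f A B) ⟩
    f x + (finiteSum f A + finiteSum f B) ≈⟨ solve 3 (λ x a b → x :+ (a :+ b) := a :+ (x :+ b)) refl _ _ _ ⟩
    finiteSum f A + finiteSum f (x ∷ B)  ≈⟨ Σ-++ f A (x ∷ B) ⟨
    finiteSum f (A ++ x ∷ B)             ∎
    where
    F⊆A++B : F ⊆ A ++ B
    F⊆A++B {y} y∈F with ∈-++⁻ A (F⊆G (there y∈F))
    ... | inj₁ y∈A            = ∈-++⁺ˡ y∈A
    ... | inj₂ (here ≡.refl)  = ⊥-elim (All.lookup x∉F y∈F ≡.refl)
    ... | inj₂ (there y∈B)    = ∈-++⁺ʳ A y∈B

  0≤∣x∣+x : ∀ x → 0# ≤ ∣ x ∣ + x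
  0≤∣x∣+x x = ≤-trans (x≤y⇒0≤y-x (-x≤∣x∣ x)) (≤-reflexive (+-congˡ (-‿involutive x)))

  -- Writing f as (∣f∣ + f) - ∣f∣ reduces the claim to nonnegative families, where `Σ-⊆` applies in
  -- both directions.
  Σ-⊆-⊇ : {I : Set} (f : I → Carrier) (F G : List I) → Unique F → Unique G → F ⊆ G → G ⊆ F →
          finiteSum f F ≈ finiteSum f G
  Σ-⊆-⊇ f F G uF uG F⊆G G⊆F = begin-equality
    finiteSum f F                            ≈⟨ split F ⟩
    finiteSum f⁺ F - finiteSum f⁻ F          ≈⟨ +-cong (equal f⁺ (λ x → 0≤∣x∣+x (f x)))
                                                  (-‿cong (equal f⁻ (λ x → ∣x∣-nonNeg (f x)))) ⟩
    finiteSum f⁺ G - finiteSum f⁻ G          ≈⟨ split G ⟨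
    finiteSum f G                            ∎
    where
    f⁺ f⁻ : _ → Carrier
    f⁺ x = ∣ f x ∣ + f x
    f⁻ x = ∣ f x ∣
    split : ∀ H → finiteSum f H ≈ finiteSum f⁺ H - finiteSum f⁻ H
    split H = trans (solve 2 (λ a b → b := a :+ b :- a) refl _ _) (+-congʳ (sym (Σ-+ f⁻ f H)))
    equal : ∀ h → (∀ x → 0# ≤ h x) → finiteSum h F ≈ finiteSum h G
    equal h 0≤h = antisym (Σ-⊆ 0≤h F G uF F⊆G) (Σ-⊆ 0≤h G F uG G⊆F)

  -- Finite subsets as duplicate-free lists

  infix 4 _≟_
  _≟_ : {A : Set} (x y : A) → Dec (x ≡ y)
  x ≟ y = em

  infixr 5 _∪_
  _∪_ : {A : Set} → List A → List A → List A
  F ∪ G = deduplicate _≟_ (F ++ G)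

  ∪-⊆ˡ : {A : Set} (F G : List A) → F ⊆ F ∪ G
  ∪-⊆ˡ F G x∈F = ∈-deduplicate⁺ _≟_ (∈-++⁺ˡ x∈F)

  ∪-⊆ʳ : {A : Set} (F G : List A) → G ⊆ F ∪ G
  ∪-⊆ʳ F G x∈G = ∈-deduplicate⁺ _≟_ (∈-++⁺ʳ F x∈G)

  ∪-FiniteSubset : {A : Set} {S : Pred A 0ℓ} (F G : List A) → All S F → All S G → FiniteSubset S (F ∪ G)
  ∪-FiniteSubset F G sF sG = deduplicate-! _≟_ (F ++ G) ,
    All.tabulate (λ x∈ → All.lookup (All.++⁺ sF sG) (∈-deduplicate⁻ _≟_ (F ++ G) x∈))

  keep : {A : Set} (P : Pred A 0ℓ) → List A → List A
  keep P = filter {P = P} (λ _ → em)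

  ∈-keep⁺ : {A : Set} (P : Pred A 0ℓ) {x : A} {F : List A} → x ∈ F → P x → x ∈ keep P F
  ∈-keep⁺ P = ∈-filter⁺ (λ _ → em)

  ∈-keep⁻ : {A : Set} (P : Pred A 0ℓ) {x : A} {F : List A} → x ∈ keep P F → x ∈ F × P x
  ∈-keep⁻ P = ∈-filter⁻ (λ _ → em)

  keep-FiniteSubset : {A : Set} {S : Pred A 0ℓ} (P : Pred A 0ℓ) {F : List A} →
                      FiniteSubset S F → FiniteSubset (λ x → S x × P x) (keep P F)
  keep-FiniteSubset P (uF , sF) = Unique.filter⁺ (λ _ → em) uF ,
    All.tabulate (λ x∈ → let x∈F , Px = ∈-keep⁻ P x∈ in All.lookup sF x∈F , Px)

  Unique-map : {I J : Set} (φ : I → J) (F : List I) →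
               (∀ x y → x ∈ F → y ∈ F → φ x ≡ φ y → x ≡ y) → Unique F → Unique (map φ F)
  Unique-map φ []      inj _          = []
  Unique-map φ (x ∷ F) inj (x∉F ∷ uF) =
    All.tabulate (λ y∈ φx≡y → let z , z∈F , y≡φz = ∈-map⁻ φ y∈ in
      All.lookup x∉F z∈F (inj x z (here ≡.refl) (there z∈F) (≡.trans φx≡y y≡φz))) ∷
    Unique-map φ F (λ y z y∈ z∈ → inj y z (there y∈) (there z∈)) uF

  Unique-map⁻ : {I J : Set} (φ : I → J) (F : List I) → Unique (map φ F) → Unique F
  Unique-map⁻ φ []      _          = []
  Unique-map⁻ φ (x ∷ F) (φx∉ ∷ u) =
    All.tabulate (λ y∈F x≡y → All.lookup φx∉ (∈-map⁺ φ y∈F) (≡.cong φ x≡y)) ∷ Unique-map⁻ φ F u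

  -- Limit laws for unconditional sums

  HasSum-cong : {I : Set} {S : Pred I 0ℓ} {f g : I → Carrier} {s s′ : Carrier} →
                (∀ x → S x → f x ≈ g x) → s ≈ s′ → HasSum S f s → HasSum S g s′
  HasSum-cong f≈g s≈s′ h ε 0<ε with h ε 0<ε
  ... | F₀ , fs₀ , close = F₀ , fs₀ , λ F fs F₀⊆F → ≤-<-trans
    (≤-reflexive (∣∣-cong (+-cong (sym (Σ-cong F (λ x x∈F → f≈g x (All.lookup (proj₂ fs) x∈F)))) (-‿cong (sym s≈s′)))))
    (close F fs F₀⊆F)

  HasSum-+ : {I : Set} {S : Pred I 0ℓ} {f g : I → Carrier} {s s′ : Carrier} →
             HasSum S f s → HasSum S g s′ → HasSum S (λ x → f x + g x) (s + s′)
  HasSum-+ {f = f} {g} {s} {s′} hf hg ε 0<ε =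
    let F₁ , (_ , sF₁) , close₁ = hf (½ * ε) (*-pos 0<½ 0<ε)
        F₂ , (_ , sF₂) , close₂ = hg (½ * ε) (*-pos 0<½ 0<ε)
    in F₁ ∪ F₂ , ∪-FiniteSubset F₁ F₂ sF₁ sF₂ , λ F fs ⊆F → <-≤-trans
      (≤-<-trans (≤-trans (≤-reflexive (regroup F)) (∣∣-triangle _ _))
        (+-mono-< (close₁ F fs (⊆F ∘ ∪-⊆ˡ F₁ F₂)) (close₂ F fs (⊆F ∘ ∪-⊆ʳ F₁ F₂))))
      (≤-reflexive (½+½ ε))
    where
    regroup : ∀ F → ∣ finiteSum (λ x → f x + g x) F - (s + s′) ∣ ≈ ∣ (finiteSum f F - s) + (finiteSum g F - s′) ∣
    regroup F = ∣∣-cong (trans (+-congʳ (Σ-+ f g F))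
      (solve 4 (λ a b c d → a :+ b :- (c :+ d) := a :- c :+ (b :- d)) refl _ _ s s′))

  HasSum-* : {I : Set} {S : Pred I 0ℓ} {f : I → Carrier} {s : Carrier} (c : Carrier) →
             HasSum S f s → HasSum S (λ x → c * f x) (c * s)
  HasSum-* {f = f} {s} c h ε 0<ε =
    -- Dividing by 1 + ∣c∣ instead of ∣c∣ also covers c = 0.
    let F₀ , fs₀ , close = h ((1# + ∣ c ∣) ⁻¹ * ε) (*-pos (⁻¹-pos 0<1+∣c∣) 0<ε)
    in F₀ , fs₀ , λ F fs F₀⊆F → <-≤-trans
      (≤-<-trans (bound F) (*-monoʳ-< (close F fs F₀⊆F))) (≤-reflexive rescale)
    where
    0<1+∣c∣ = +-pos-nonNeg 0<1 (∣x∣-nonNeg c)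
    bound : ∀ F → ∣ finiteSum (λ x → c * f x) F - c * s ∣ ≤ (1# + ∣ c ∣) * ∣ finiteSum f F - s ∣
    bound F = begin
      ∣ finiteSum (λ x → c * f x) F - c * s ∣
        ≈⟨ ∣∣-cong (trans (+-congʳ (Σ-* c f F))
             (solve 3 (λ c a b → c :* a :- c :* b := c :* (a :- b)) refl c _ s)) ⟩
      ∣ c * (finiteSum f F - s) ∣             ≈⟨ ∣∣-* c _ ⟩
      ∣ c ∣ * ∣ finiteSum f F - s ∣           ≤⟨ *-monoˡ-≤ (∣x∣-nonNeg _) (≤-by 0≤1 (+-comm 1# ∣ c ∣)) ⟩
      (1# + ∣ c ∣) * ∣ finiteSum f F - s ∣    ∎
    rescale : (1# + ∣ c ∣) * ((1# + ∣ c ∣) ⁻¹ * ε) ≈ ε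
    rescale = begin-equality
      (1# + ∣ c ∣) * ((1# + ∣ c ∣) ⁻¹ * ε)    ≈⟨ *-assoc _ _ _ ⟨
      (1# + ∣ c ∣) * (1# + ∣ c ∣) ⁻¹ * ε      ≈⟨ *-congʳ (⁻¹-inverseʳ (<⇒≉0 0<1+∣c∣)) ⟩
      1# * ε                                  ≈⟨ *-identityˡ ε ⟩
      ε                                       ∎
    *-monoʳ-< : ∀ {x y} → x < y → (1# + ∣ c ∣) * x < (1# + ∣ c ∣) * y
    *-monoʳ-< {x} {y} x<y = *-monoʳ-≤ (<⇒≤ 0<1+∣c∣) (<⇒≤ x<y) , λ eq →
      <⇒≉0 (*-pos 0<1+∣c∣ (x<y⇒0<y-x x<y)) (begin-equality
        (1# + ∣ c ∣) * (y - x)                 ≈⟨ solve 3 (λ z y x → z :* (y :- x) := z :* y :- z :* x) refl _ _ _ ⟩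
        (1# + ∣ c ∣) * y - (1# + ∣ c ∣) * x    ≈⟨ +-congˡ (-‿cong eq) ⟩
        (1# + ∣ c ∣) * y - (1# + ∣ c ∣) * y    ≈⟨ -‿inverseʳ _ ⟩
        0#                                     ∎)

  HasSum-≤ : {I : Set} {S : Pred I 0ℓ} {f : I → Carrier} {s B : Carrier} →
             (∀ F → FiniteSubset S F → finiteSum f F ≤ B) → HasSum S f s → s ≤ B
  HasSum-≤ {f = f} {s} {B} bound h = ≤-by-ε λ ε 0<ε → let F₀ , fs₀ , close = h ε 0<ε in begin
    s                                           ≈⟨ solve 2 (λ s f → s := f :+ (s :- f)) refl s (finiteSum f F₀) ⟩
    finiteSum f F₀ + (s - finiteSum f F₀)       ≤⟨ +-mono-≤ (bound F₀ fs₀) (x≤∣x∣ _) ⟩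
    B + ∣ s - finiteSum f F₀ ∣                  ≈⟨ +-congˡ (∣x-y∣≈∣y-x∣ _ _) ⟩
    B + ∣ finiteSum f F₀ - s ∣                  ≤⟨ +-monoʳ-≤ B (<⇒≤ (close F₀ fs₀ id)) ⟩
    B + ε                                       ∎

  HasSum-neg : {I : Set} {S : Pred I 0ℓ} {f : I → Carrier} {s : Carrier} →
               HasSum S f s → HasSum S (λ x → - f x) (- s)
  HasSum-neg h = HasSum-cong (λ _ _ → solve 1 (λ x → con -[1+ 0 ] :* x := :- x) refl _)
    (solve 1 (λ x → con -[1+ 0 ] :* x := :- x) refl _) (HasSum-* (coefficient -[1+ 0 ]) h)

  HasSum-∣∣≤ : {I : Set} {S : Pred I 0ℓ} {f : I → Carrier} {s B : Carrier} →
              (∀ F → FiniteSubset S F → finiteSum (λ x → ∣ f x ∣) F ≤ B) → HasSum S f s → ∣ s ∣ ≤ B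
  HasSum-∣∣≤ {f = f} bound h = ∣x∣≤
    (HasSum-≤ (λ F fs → ≤-trans (Σ-mono F (λ x _ → x≤∣x∣ (f x))) (bound F fs)) h)
    (HasSum-≤ (λ F fs → ≤-trans (Σ-mono F (λ x _ → -x≤∣x∣ (f x))) (bound F fs)) (HasSum-neg h))

  HasSum-≥ : {I : Set} {S : Pred I 0ℓ} {f : I → Carrier} {s : Carrier} → (∀ x → 0# ≤ f x) →
             HasSum S f s → ∀ F → FiniteSubset S F → finiteSum f F ≤ s
  HasSum-≥ {f = f} {s} 0≤f h F (uF , sF) = ≤-by-ε λ ε 0<ε → let F₀ , fs₀ , close = h ε 0<ε in begin
    finiteSum f F                          ≤⟨ Σ-⊆ 0≤f F (F₀ ∪ F) uF (∪-⊆ʳ F₀ F) ⟩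
    finiteSum f (F₀ ∪ F)                   ≈⟨ solve 2 (λ s f → f := s :+ (f :- s)) refl s _ ⟩
    s + (finiteSum f (F₀ ∪ F) - s)         ≤⟨ +-monoʳ-≤ s (x≤∣x∣ _) ⟩
    s + ∣ finiteSum f (F₀ ∪ F) - s ∣
      ≤⟨ +-monoʳ-≤ s (<⇒≤ (close (F₀ ∪ F) (∪-FiniteSubset F₀ F (proj₂ fs₀) sF) (∪-⊆ˡ F₀ F))) ⟩
    s + ε                                  ∎

  -- s - s′ and s′ - s are both sums of a family whose partial sums vanish, so `HasSum-≤` bounds
  -- both by zero.
  HasSum-unique : {I : Set} {S : Pred I 0ℓ} {f : I → Carrier} {s s′ : Carrier} →
                  HasSum S f s → HasSum S f s′ → s ≈ s′
  HasSum-unique {f = f} {s} {s′} h h′ = begin-equality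
    s              ≈⟨ solve 2 (λ s s′ → s := s′ :+ (s :- s′)) refl s s′ ⟩
    s′ + (s - s′)  ≈⟨ +-congˡ (antisym s-s′≤0 0≤s-s′) ⟩
    s′ + 0#        ≈⟨ +-identityʳ s′ ⟩
    s′             ∎
    where
    vanishes : ∀ F → finiteSum (λ x → f x + - f x) F ≈ 0#
    vanishes F = trans (Σ-cong F (λ _ _ → trans (-‿inverseʳ _) (sym (zeroʳ 0#))))
                   (trans (Σ-* 0# (λ _ → 0#) F) (zeroˡ _))
    s-s′≤0 : s - s′ ≤ 0#
    s-s′≤0 = HasSum-≤ (λ F _ → ≤-reflexive (vanishes F)) (HasSum-+ h (HasSum-neg h′))
    0≤s-s′ : 0# ≤ s - s′
    0≤s-s′ = ≤-trans (neg-nonNeg (HasSum-≤ (λ F _ → ≤-reflexive (vanishes F)) (HasSum-+ h′ (HasSum-neg h))))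
      (≤-reflexive (solve 2 (λ s s′ → :- (s′ :- s) := s :- s′) refl s s′))

  -- Unconditional sums

  private
    -- The sum is the supremum of the partial sums: some partial sum exceeds s - ε, and every larger
    -- finite subset stays between that one and s.
    nonNeg-summable : {I : Set} {S : Pred I 0ℓ} {f : I → Carrier} {B : Carrier} → (∀ x → 0# ≤ f x) →
      (∀ F → FiniteSubset S F → finiteSum f F ≤ B) → ∃ (HasSum S f)
    nonNeg-summable {I} {S} {f} {B} 0≤f bound = s , converges
      where
      isSum : Pred Carrier 0ℓ
      isSum y = ∃[ F ] FiniteSubset S F × y ≈ finiteSum f F
      sup = complete isSum (0# , [] , ([] , []) , refl)
        (B , λ y (F , fs , y≈) → ≤-trans (≤-reflexive y≈) (bound F fs))
      s = proj₁ sup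
      converges : HasSum S f s
      converges ε 0<ε with em {∃[ F ] FiniteSubset S F × s - ε < finiteSum f F}
      ... | no h = ⊥-elim (<⇒≱ 0<ε (begin
        ε            ≈⟨ solve 2 (λ s e → e := s :- (s :- e)) refl s ε ⟩
        s - (s - ε)
          ≤⟨ +-mono-≤ (proj₂ (proj₂ sup) (s - ε) λ y (F , fs , y≈) → ≤-trans (≤-reflexive y≈) (small F fs)) ≤-refl ⟩
        s - ε - (s - ε) ≈⟨ -‿inverseʳ _ ⟩
        0#           ∎))
        where
        small : ∀ F → FiniteSubset S F → finiteSum f F ≤ s - ε
        small F fs with ≤-or-> (finiteSum f F) (s - ε)
        ... | inj₁ ≤s-ε = ≤s-ε
        ... | inj₂ s-ε< = ⊥-elim (h (F , fs , s-ε<))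
      ... | yes (F₀ , fs₀ , s-ε<) = F₀ , fs₀ , λ F fs F₀⊆F → ≤-<-trans
        (∣x∣≤ (≤-trans (≤-by {c = s - finiteSum f F + (s - finiteSum f F₀)}
                 (+-nonNeg (x≤y⇒0≤y-x (below F fs)) (x≤y⇒0≤y-x (below F₀ fs₀)))
                 (solve 3 (λ s f f₀ → s :- f₀ := f :- s :+ (s :- f :+ (s :- f₀))) refl s _ (finiteSum f F₀)))
                 ≤-refl)
              (≤-by (x≤y⇒0≤y-x (Σ-⊆ 0≤f F₀ F (proj₁ fs₀) F₀⊆F))
                 (solve 3 (λ s f f₀ → s :- f₀ := :- (f :- s) :+ (f :- f₀)) refl s _ _)))
        (≤-<-trans (≤-reflexive (solve 3 (λ s e f → s :- f := (:- f) :+ s :- e :+ e) refl s ε (finiteSum f F₀)))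
          (<-≤-trans (≤-<-trans (≤-reflexive (solve 3 (λ s e f → :- f :+ s :- e :+ e := (e :- f) :+ (s :- e)) refl s ε _))
            (+-monoʳ-< (ε - finiteSum f F₀) s-ε<)) (≤-reflexive (solve 2 (λ e f → e :- f :+ f := e) refl ε _))))
        where
        below : ∀ F → FiniteSubset S F → finiteSum f F ≤ s
        below F fs = proj₁ (proj₂ sup) _ (F , fs , refl)

  -- Again f is (∣f∣ + f) - ∣f∣, and both nonnegative families have bounded partial sums.
  Σ-bounded⇒summable : {I : Set} {S : Pred I 0ℓ} {f : I → Carrier} {B : Carrier} →
    (∀ F → FiniteSubset S F → finiteSum (λ x → ∣ f x ∣) F ≤ B) → ∃ (HasSum S f)
  Σ-bounded⇒summable {f = f} {B} bound
    with nonNeg-summable {f = λ x → ∣ f x ∣ + f x} {B + B} (λ x → 0≤∣x∣+x (f x)) (λ F fs → begin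
           finiteSum (λ x → ∣ f x ∣ + f x) F             ≈⟨ Σ-+ _ f F ⟩
           finiteSum (λ x → ∣ f x ∣) F + finiteSum f F   ≤⟨ +-mono-≤ (bound F fs)
             (≤-trans (Σ-mono F (λ x _ → x≤∣x∣ (f x))) (bound F fs)) ⟩
           B + B                                         ∎)
       | nonNeg-summable {f = λ x → ∣ f x ∣} (λ x → ∣x∣-nonNeg (f x)) bound
  ... | s⁺ , h⁺ | s⁻ , h⁻ = s⁺ - s⁻ ,
    HasSum-cong (λ x _ → solve 2 (λ a b → a :+ b :- a := b) refl _ _) refl (HasSum-+ h⁺ (HasSum-neg h⁻))

  HasSum-finite : {I : Set} {S : Pred I 0ℓ} (f : I → Carrier) (L : List I) → FiniteSubset S L →
                  (∀ x → S x → x ∈ L) → HasSum S f (finiteSum f L)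
  HasSum-finite f L fs all ε 0<ε = L , fs , λ F (uF , sF) L⊆F → ≤-<-trans
    (≤-reflexive (trans (∣∣-cong (trans (+-congʳ
      (Σ-⊆-⊇ f F L uF (proj₁ fs) (λ x∈F → all _ (All.lookup sF x∈F)) L⊆F)) (-‿inverseʳ _)))
      (0≤x⇒∣x∣≈x ≤-refl))) 0<ε

  HasSum-0 : {I : Set} {S : Pred I 0ℓ} → HasSum {I} S (λ _ → 0#) 0#
  HasSum-0 ε 0<ε = [] , ([] , []) , λ F _ _ → ≤-<-trans (≤-reflexive (trans (∣∣-cong
    (trans (+-congʳ (trans (Σ-cong F (λ _ _ → sym (zeroʳ 0#))) (trans (Σ-* 0# (λ _ → 0#) F) (zeroˡ _))))
      (-‿inverseʳ 0#))) (0≤x⇒∣x∣≈x ≤-refl))) 0<ε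

  -- Bijectivity is asked only between the predicates S and T, because the index types hold raw
  -- data: `signature`, for instance, is injective only on short triples of partitions.
  HasSum-reindex : {I J : Set} {S : Pred I 0ℓ} {T : Pred J 0ℓ} {g : J → Carrier} {s : Carrier} (φ : I → J) →
    (∀ x → S x → T (φ x)) → (∀ x y → S x → S y → φ x ≡ φ y → x ≡ y) →
    (∀ y → T y → ∃[ x ] S x × φ x ≡ y) → HasSum S (g ∘ φ) s → HasSum T g s
  HasSum-reindex {I} {J} {S} {T} {g} {s} φ maps inj surj h ε 0<ε with h ε 0<ε
  ... | F₀ , (u₀ , s₀) , close = map φ F₀ ,
    (Unique-map φ F₀ (λ x y x∈ y∈ → inj x y (All.lookup s₀ x∈) (All.lookup s₀ y∈)) u₀ ,
     All.map⁺ (All.map (maps _) s₀)) , large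
    where
    preimage : ∀ G → All T G → ∃[ F ] All S F × map φ F ≡ G
    preimage []      []        = [] , [] , ≡.refl
    preimage (y ∷ G) (ty ∷ tG) with surj y ty | preimage G tG
    ... | x , sx , ≡.refl | F , sF , ≡.refl = x ∷ F , sx ∷ sF , ≡.refl
    large : ∀ G → FiniteSubset T G → map φ F₀ ⊆ G → ∣ finiteSum g G - s ∣ < ε
    large G (uG , tG) ⊆G with preimage G tG
    ... | F , sF , ≡.refl = ≤-<-trans (≤-reflexive (∣∣-cong (+-congʳ (Σ-map g φ F))))
      (close F (Unique-map⁻ φ F uG , sF) λ {x} x∈F₀ → let z , z∈F , φx≡φz = ∈-map⁻ φ (⊆G (∈-map⁺ φ x∈F₀)) in
        ≡.subst (_∈ F) (≡.sym (inj x z (All.lookup s₀ x∈F₀) (All.lookup sF z∈F) φx≡φz)) z∈F)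

  HasSum-resp : {I : Set} {S T : Pred I 0ℓ} {f : I → Carrier} {s : Carrier} →
    (∀ x → S x → T x) → (∀ x → T x → S x) → HasSum S f s → HasSum T f s
  HasSum-resp S⇒T T⇒S = HasSum-reindex id S⇒T (λ _ _ _ _ eq → eq) (λ y Ty → y , T⇒S y Ty , ≡.refl)

  -- Iterated summation. Convergence of the total sum is given, so a finite set G of base points can
  -- be treated alone: choose in each of its fibres a finite subset close to the fibre sum and
  -- compare their union with s.
  HasSum-fibration : {I J : Set} {S : Pred I 0ℓ} {T : Pred J 0ℓ} {f : I → Carrier} {g : J → Carrier}
    {s : Carrier} (π : I → J) → (∀ x → S x → T (π x)) →
    (∀ j → T j → HasSum (λ x → S x × π x ≡ j) f (g j)) → HasSum S f s → HasSum T g s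
  HasSum-fibration {I} {J} {S} {T} {f} {g} {s} π maps fiber h ε 0<ε =
    deduplicate _≟_ (map π F₀) ,
    (deduplicate-! _≟_ _ , All.tabulate (λ j∈ → All.lookup (All.map⁺ (All.map (maps _) s₀)) (∈-deduplicate⁻ _≟_ (map π F₀) j∈))) ,
    large
    where
    0<½ε : 0# < ½ * ε
    0<½ε = *-pos 0<½ 0<ε
    F₀ : List I
    F₀ = proj₁ (h (½ * ε) 0<½ε)
    u₀ : Unique F₀
    u₀ = proj₁ (proj₁ (proj₂ (h (½ * ε) 0<½ε)))
    s₀ : All S F₀
    s₀ = proj₂ (proj₁ (proj₂ (h (½ * ε) 0<½ε)))
    close : ∀ F → FiniteSubset S F → F₀ ⊆ F → ∣ finiteSum f F - s ∣ < ½ * ε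
    close = proj₂ (proj₂ (h (½ * ε) 0<½ε))
    -- Each chosen fibre list is enlarged by the members of F₀ in that fibre, so the union contains
    -- F₀. Lists over different points are disjoint, which keeps the union duplicate-free, and each
    -- point of G costs an error of δ.
    lift : ∀ δ → 0# < δ → ∀ G → FiniteSubset T G → ∀ F₀ → FiniteSubset S F₀ → (∀ x → x ∈ F₀ → π x ∈ G) →
      ∃[ F ] FiniteSubset S F × F₀ ⊆ F × (∀ x → x ∈ F → π x ∈ G) ×
        ∣ finiteSum f F - finiteSum g G ∣ ≤ fromℕ (List.length G) * δ
    lift δ 0<δ [] _ [] fs πF₀ = [] , ([] , []) , id , (λ _ ()) ,
      ≤-reflexive (trans (trans (∣∣-cong (-‿inverseʳ 0#)) (0≤x⇒∣x∣≈x ≤-refl)) (sym (zeroˡ δ)))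
    lift δ 0<δ [] _ (x ∷ F₀) fs πF₀ with πF₀ x (here ≡.refl)
    ... | ()
    lift δ 0<δ (j ∷ G) (j∉G ∷ uG , tj ∷ tG) F₀ fs₀@(u₀ , s₀) πF₀ with fiber j tj δ 0<δ
    ... | Fⱼ , (uⱼ , sⱼ) , closeⱼ
      with lift δ 0<δ G (uG , tG) (keep (λ x → π x ∈ G) F₀)
             (let u , s = keep-FiniteSubset (λ x → π x ∈ G) fs₀ in u , All.map proj₁ s)
             (λ x x∈ → proj₂ (∈-keep⁻ (λ x → π x ∈ G) {F = F₀} x∈))
    ... | F′ , (u′ , s′) , ⊆F′ , πF′ , close′ = A ++ F′ ,
      (Unique.++⁺ (proj₁ fsA) u′ (λ {x} (x∈A , x∈F′) → All.lookup j∉G (πF′ x x∈F′)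
         (≡.sym (proj₂ (All.lookup (proj₂ fsA) x∈A)))) ,
       All.++⁺ (All.map proj₁ (proj₂ fsA)) s′) ,
      covers , πF , (begin
        ∣ finiteSum f (A ++ F′) - (g j + finiteSum g G) ∣
          ≈⟨ ∣∣-cong (trans (+-congʳ (Σ-++ f A F′))
               (solve 4 (λ a b c d → a :+ b :- (c :+ d) := a :- c :+ (b :- d)) refl _ _ _ _)) ⟩
        ∣ (finiteSum f A - g j) + (finiteSum f F′ - finiteSum g G) ∣    ≤⟨ ∣∣-triangle _ _ ⟩
        ∣ finiteSum f A - g j ∣ + ∣ finiteSum f F′ - finiteSum g G ∣
          ≤⟨ +-mono-≤ (<⇒≤ (closeⱼ A fsA (∪-⊆ˡ Fⱼ Aⱼ))) close′ ⟩
        δ + fromℕ (List.length G) * δ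
          ≈⟨ solve 2 (λ d n → d :+ n :* d := (con (+ 1) :+ n) :* d) refl δ _ ⟩
        fromℕ (List.length (j ∷ G)) * δ ∎)
      where
      Aⱼ = keep (λ x → π x ≡ j) F₀
      A = Fⱼ ∪ Aⱼ
      fsA : FiniteSubset (λ x → S x × π x ≡ j) A
      fsA = ∪-FiniteSubset Fⱼ Aⱼ sⱼ (proj₂ (keep-FiniteSubset (λ x → π x ≡ j) fs₀))
      covers : F₀ ⊆ A ++ F′
      covers {x} x∈F₀ with πF₀ x x∈F₀
      ... | here πx≡j  = ∈-++⁺ˡ (∪-⊆ʳ Fⱼ Aⱼ (∈-keep⁺ (λ x → π x ≡ j) x∈F₀ πx≡j))
      ... | there πx∈G = ∈-++⁺ʳ A (⊆F′ (∈-keep⁺ (λ x → π x ∈ G) x∈F₀ πx∈G))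
      πF : ∀ x → x ∈ A ++ F′ → π x ∈ j ∷ G
      πF x x∈ with ∈-++⁻ A x∈
      ... | inj₁ x∈A = here (proj₂ (All.lookup (proj₂ fsA) x∈A))
      ... | inj₂ x∈F′ = there (πF′ x x∈F′)
    large : ∀ G → FiniteSubset T G → deduplicate _≟_ (map π F₀) ⊆ G → ∣ finiteSum g G - s ∣ < ε
    large G fsG ⊆G =
      -- The accumulated error is n δ with n the length of G; dividing by 1 + n allows G to be
      -- empty.
      let F , fsF , F₀⊆F , _ , close′ = lift (1+n⁻¹ * (½ * ε)) (*-pos (⁻¹-pos 0<1+n) 0<½ε)
            G fsG F₀ (u₀ , s₀) (λ x x∈F₀ → ⊆G (∈-deduplicate⁺ _≟_ (∈-map⁺ π x∈F₀)))
      in <-≤-trans (≤-<-trans (before F close′) (+-monoʳ-< _ (close F fsF F₀⊆F))) after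
      where
      n = fromℕ (List.length G)
      1+n⁻¹ = (1# + n) ⁻¹
      0<1+n = +-pos-nonNeg 0<1 (fromℕ-nonNeg (List.length G))
      before : ∀ F → ∣ finiteSum f F - finiteSum g G ∣ ≤ n * (1+n⁻¹ * (½ * ε)) →
               ∣ finiteSum g G - s ∣ ≤ n * (1+n⁻¹ * (½ * ε)) + ∣ finiteSum f F - s ∣
      before F close′ = begin
        ∣ finiteSum g G - s ∣
          ≈⟨ ∣∣-cong (solve 3 (λ g s f → g :- s := (g :- f) :+ (f :- s)) refl _ s (finiteSum f F)) ⟩
        ∣ (finiteSum g G - finiteSum f F) + (finiteSum f F - s) ∣     ≤⟨ ∣∣-triangle _ _ ⟩
        ∣ finiteSum g G - finiteSum f F ∣ + ∣ finiteSum f F - s ∣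
          ≤⟨ +-mono-≤ (≤-trans (≤-reflexive (∣x-y∣≈∣y-x∣ _ _)) close′) ≤-refl ⟩
        n * (1+n⁻¹ * (½ * ε)) + ∣ finiteSum f F - s ∣                 ∎
      after : n * (1+n⁻¹ * (½ * ε)) + ½ * ε ≤ ε
      after = begin
        n * (1+n⁻¹ * (½ * ε)) + ½ * ε
          ≤⟨ +-mono-≤ (*-monoˡ-≤ (*-nonNeg (<⇒≤ (⁻¹-pos 0<1+n)) (<⇒≤ 0<½ε)) (≤-by 0≤1 (+-comm 1# n))) ≤-refl ⟩
        (1# + n) * (1+n⁻¹ * (½ * ε)) + ½ * ε    ≈⟨ +-congʳ (*-assoc _ _ _) ⟨
        (1# + n) * 1+n⁻¹ * (½ * ε) + ½ * ε      ≈⟨ +-congʳ (trans (*-congʳ (⁻¹-inverseʳ (<⇒≉0 0<1+n))) (*-identityˡ _)) ⟩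
        ½ * ε + ½ * ε                           ≈⟨ ½+½ ε ⟩
        ε                                       ∎

  -- Indicators, products and majorants of sums

  indicator : {I : Set} → Pred I 0ℓ → I → Carrier
  indicator P x with em {P x}
  ... | yes _ = 1#
  ... | no  _ = 0#

  indicator-yes : {I : Set} {P : Pred I 0ℓ} {x : I} → P x → indicator P x ≡ 1#
  indicator-yes {P = P} {x} Px with em {P x}
  ... | yes _  = ≡.refl
  ... | no ¬Px = ⊥-elim (¬Px Px)

  indicator-no : {I : Set} {P : Pred I 0ℓ} {x : I} → ¬ P x → indicator P x ≡ 0#
  indicator-no {P = P} {x} ¬Px with em {P x}
  ... | yes Px = ⊥-elim (¬Px Px)
  ... | no _   = ≡.refl

  Σ-keep : {I : Set} (P : Pred I 0ℓ) (f : I → Carrier) (F : List I) →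
           finiteSum (λ x → indicator P x * f x) F ≈ finiteSum f (keep P F)
  Σ-keep P f []      = refl
  Σ-keep P f (x ∷ F) with em {P x}
  ... | yes _ = +-cong (*-identityˡ (f x)) (Σ-keep P f F)
  ... | no  _ = trans (+-cong (zeroˡ (f x)) (Σ-keep P f F)) (+-identityˡ _)

  -- This turns the heat trace, a sum over short triples, into a sum over all triples, where it can
  -- be subtracted from the formal series term by term.
  HasSum-extend : {I : Set} {S : Pred I 0ℓ} {f : I → Carrier} {s : Carrier} (P : Pred I 0ℓ) →
    HasSum (λ x → S x × P x) f s → HasSum S (λ x → indicator P x * f x) s
  HasSum-extend {f = f} P h ε 0<ε with h ε 0<ε
  ... | F₀ , (u₀ , s₀) , close = F₀ , (u₀ , All.map proj₁ s₀) , λ F fs F₀⊆F → ≤-<-trans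
    (≤-reflexive (∣∣-cong (+-congʳ (Σ-keep P f F))))
    (close (keep P F) (keep-FiniteSubset P fs) (λ x∈F₀ → ∈-keep⁺ P (F₀⊆F x∈F₀) (proj₂ (All.lookup s₀ x∈F₀))))

  HasSum-∑ : {I : Set} {S : Pred I 0ℓ} {n : ℕ} {f : Fin n → I → Carrier} {s : Fin n → Carrier} →
    (∀ i → HasSum S (f i) (s i)) → HasSum S (λ x → ∑[ i < n ] f i x) (∑[ i < n ] s i)
  HasSum-∑ {n = zero}  h = HasSum-0
  HasSum-∑ {n = suc n} h = HasSum-+ (h Fin.zero) (HasSum-∑ (λ i → h (Fin.suc i)))

  -- Convergence rules out the default value, and by uniqueness it does not matter which limit `em`
  -- returns.
  sumOver-HasSum : {I : Set} {S : Pred I 0ℓ} {f : I → Carrier} {s : Carrier} → HasSum S f s → sumOver S f ≈ s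
  sumOver-HasSum {S = S} {f} {s} h with em {∃ (HasSum S f)}
  ... | yes (s′ , h′) = HasSum-unique h′ h
  ... | no  ¬h        = ⊥-elim (¬h (s , h))

  open SumProperties semiring using (*-distribˡ-sum; *-distribʳ-sum; ∑-distrib-+)

  ∑-cong : ∀ n {f g : Fin n → Carrier} → (∀ i → f i ≈ g i) → ∑[ i < n ] f i ≈ ∑[ i < n ] g i
  ∑-cong zero    f≈g = refl
  ∑-cong (suc n) f≈g = +-cong (f≈g Fin.zero) (∑-cong n (λ i → f≈g (Fin.suc i)))

  -- Fibring the product over its first factor gives the fibre sums f x * s′. Convergence of the
  -- product family is an assumption here; `HasSum-×` derives it from absolute bounds.
  HasSum-product : {I J : Set} {S : Pred I 0ℓ} {T : Pred J 0ℓ} {f : I → Carrier} {g : J → Carrier} {s s′ p : Carrier} →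
    HasSum S f s → HasSum T g s′ → HasSum (λ (x , y) → S x × T y) (λ (x , y) → f x * g y) p → p ≈ s * s′
  HasSum-product {I} {J} {S} {T} {f} {g} {s} {s′} hf hg h = HasSum-unique
    (HasSum-fibration {g = λ x → f x * s′} proj₁ (λ _ → proj₁) fiber h)
    (HasSum-cong (λ _ _ → *-comm s′ _) (*-comm s′ s) (HasSum-* s′ hf))
    where
    fiber : ∀ x → S x → HasSum (λ z → (S (proj₁ z) × T (proj₂ z)) × proj₁ z ≡ x) (λ z → f (proj₁ z) * g (proj₂ z)) (f x * s′)
    fiber x Sx = HasSum-reindex {S = T} (x ,_) (λ y Ty → (Sx , Ty) , ≡.refl) (λ { _ _ _ _ ≡.refl → ≡.refl })
      (λ { (x , y) ((Sx , Ty) , ≡.refl) → y , Ty , ≡.refl }) (HasSum-* (f x) hg)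

  -- Bounds a family by exhausting its index set with explicit (not necessarily duplicate-free) lists.
  Dominated : {I : Set} → Pred I 0ℓ → (I → Carrier) → Carrier → Set
  Dominated {I} S f B = ∀ F → All S F → ∃[ G ] F ⊆ G × finiteSum f G ≤ B

  Dominated⇒Σ≤ : {I : Set} {S : Pred I 0ℓ} {f : I → Carrier} {B : Carrier} → (∀ x → 0# ≤ f x) →
    Dominated S f B → ∀ F → FiniteSubset S F → finiteSum f F ≤ B
  Dominated⇒Σ≤ 0≤f dom F (uF , sF) = let G , F⊆G , ≤B = dom F sF in ≤-trans (Σ-⊆ 0≤f F G uF F⊆G) ≤B

  Dominated-product : {I J : Set} {S : Pred I 0ℓ} {T : Pred J 0ℓ} {f : I → Carrier} {g : J → Carrier} {A B : Carrier} →
    (∀ x → 0# ≤ f x) → (∀ y → 0# ≤ g y) → Dominated S f A → Dominated T g B →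
    Dominated (λ (x , y) → S x × T y) (λ (x , y) → f x * g y) (A * B)
  Dominated-product {f = f} {g} 0≤f 0≤g domf domg F sF
    with domf (map proj₁ F) (All.map⁺ (All.map proj₁ sF)) | domg (map proj₂ F) (All.map⁺ (All.map proj₂ sF))
  ... | G , ⊆G , ≤A | H , ⊆H , ≤B = cartesianProduct G H ,
    (λ z∈F → ∈-cartesianProduct⁺ (⊆G (∈-map⁺ proj₁ z∈F)) (⊆H (∈-map⁺ proj₂ z∈F))) ,
    ≤-trans (≤-reflexive (Σ-cartesianProduct f g G H)) (*-mono-≤ (Σ-nonNeg G 0≤f) ≤A (Σ-nonNeg H 0≤g) ≤B)

  Σ≤⇒Dominated : {I : Set} {S : Pred I 0ℓ} {f : I → Carrier} {B : Carrier} →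
    (∀ F → FiniteSubset S F → finiteSum f F ≤ B) → Dominated S f B
  -- The union with the empty list is F with repetitions removed.
  Σ≤⇒Dominated bound F sF = F ∪ [] , ∪-⊆ˡ F [] , bound (F ∪ []) (∪-FiniteSubset F [] sF [])

  HasSum-× : {I J : Set} {S : Pred I 0ℓ} {T : Pred J 0ℓ} {f : I → Carrier} {g : J → Carrier} {s s′ A B : Carrier} →
    (∀ F → FiniteSubset S F → finiteSum (λ x → ∣ f x ∣) F ≤ A) →
    (∀ F → FiniteSubset T F → finiteSum (λ x → ∣ g x ∣) F ≤ B) →
    HasSum S f s → HasSum T g s′ → HasSum (λ (x , y) → S x × T y) (λ (x , y) → f x * g y) (s * s′)
  HasSum-× {f = f} {g} boundf boundg hf hg = HasSum-cong (λ _ _ → refl) (HasSum-product hf hg h) h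
    where
    h = proj₂ (Σ-bounded⇒summable (λ F fs → ≤-trans (≤-reflexive (Σ-cong F (λ (x , y) _ → ∣∣-* (f x) (g y))))
      (Dominated⇒Σ≤ (λ (x , y) → *-nonNeg (∣x∣-nonNeg (f x)) (∣x∣-nonNeg (g y)))
        (Dominated-product (λ x → ∣x∣-nonNeg (f x)) (λ y → ∣x∣-nonNeg (g y)) (Σ≤⇒Dominated boundf) (Σ≤⇒Dominated boundg)) F fs)))

  -- The geometric and the exponential series

  ⊆-downFrom : ∀ F → ∃[ n ] F ⊆ downFrom n
  ⊆-downFrom []      = 0 , λ ()
  ⊆-downFrom (x ∷ F) with ⊆-downFrom F
  ... | n , F⊆ = suc x ℕ.⊔ n , λ
    { (here ≡.refl) → ∈-downFrom⁺ (ℕ.m≤m⊔n (suc x) n)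
    ; (there y∈F)   → ∈-downFrom⁺ (ℕ.≤-trans (∈-downFrom⁻ (F⊆ y∈F)) (ℕ.m≤n⊔m (suc x) n)) }

  Σ-geometric : ∀ {ρ} → 0# ≤ ρ → ρ < 1# → ∀ n → finiteSum (ρ ^_) (downFrom n) ≤ (1# - ρ) ⁻¹
  Σ-geometric {ρ} 0≤ρ ρ<1 n = begin
    Σρ                             ≈⟨ *-identityˡ Σρ ⟨
    1# * Σρ                        ≈⟨ *-congʳ (⁻¹-inverseˡ (<⇒≉0 (x<y⇒0<y-x ρ<1))) ⟨
    (1# - ρ) ⁻¹ * (1# - ρ) * Σρ    ≈⟨ *-assoc _ _ _ ⟩
    (1# - ρ) ⁻¹ * ((1# - ρ) * Σρ)  ≤⟨ *-monoʳ-≤ (<⇒≤ (⁻¹-pos (x<y⇒0<y-x ρ<1))) (≤-by (^-nonNeg n 0≤ρ) (telescope n)) ⟩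
    (1# - ρ) ⁻¹ * 1#               ≈⟨ *-identityʳ _ ⟩
    (1# - ρ) ⁻¹                    ∎
    where
    Σρ = finiteSum (ρ ^_) (downFrom n)
    telescope : ∀ n → 1# ≈ (1# - ρ) * finiteSum (ρ ^_) (downFrom n) + ρ ^ n
    telescope zero    = solve 1 (λ r → con (+ 1) := (con (+ 1) :- r) :* con (+ 0) :+ con (+ 1)) refl ρ
    telescope (suc n) = trans (telescope n) (solve 3 (λ r s p → (con (+ 1) :- r) :* s :+ p :=
      (con (+ 1) :- r) :* (p :+ s) :+ r :* p) refl ρ _ (ρ ^ n))

  geometric-Dominated : ∀ {ρ} → 0# ≤ ρ → ρ < 1# → Dominated U (ρ ^_) ((1# - ρ) ⁻¹)
  geometric-Dominated 0≤ρ ρ<1 F _ = let n , F⊆ = ⊆-downFrom F in downFrom n , F⊆ , Σ-geometric 0≤ρ ρ<1 n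

  fromℕ-!-pos : ∀ n → 0# < fromℕ (n !)
  fromℕ-!-pos n = fromℕ-pos (n !) {{n ℕ.!≢0}}

  n!*n!⁻¹≈1 : ∀ n → fromℕ (n !) * fromℕ (n !) ⁻¹ ≈ 1#
  n!*n!⁻¹≈1 n = ⁻¹-inverseʳ (<⇒≉0 (fromℕ-!-pos n))

  n!⁻¹≤1 : ∀ n → fromℕ (n !) ⁻¹ ≤ 1#
  n!⁻¹≤1 n = begin
    fromℕ (n !) ⁻¹                 ≈⟨ *-identityˡ _ ⟨
    1# * fromℕ (n !) ⁻¹            ≤⟨ *-monoˡ-≤ (<⇒≤ (⁻¹-pos (fromℕ-!-pos n)))
                                        (≤-trans (≤-reflexive (sym fromℕ-1)) (fromℕ-mono-≤ (ℕ.1≤n! n))) ⟩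
    fromℕ (n !) * fromℕ (n !) ⁻¹   ≈⟨ n!*n!⁻¹≈1 n ⟩
    1#                             ∎

  *-cancelˡ-≤ : ∀ {z x y} → 0# < z → z * x ≤ z * y → x ≤ y
  *-cancelˡ-≤ {z} {x} {y} 0<z zx≤zy = begin
    x               ≈⟨ unscale x ⟨
    z ⁻¹ * (z * x)  ≤⟨ *-monoʳ-≤ (<⇒≤ (⁻¹-pos 0<z)) zx≤zy ⟩
    z ⁻¹ * (z * y)  ≈⟨ unscale y ⟩
    y               ∎
    where
    unscale : ∀ w → z ⁻¹ * (z * w) ≈ w
    unscale w = trans (sym (*-assoc _ _ _)) (trans (*-congʳ (⁻¹-inverseˡ (<⇒≉0 0<z))) (*-identityˡ w))

  *-cancelˡ : ∀ {z x y} → 0# < z → z * x ≈ z * y → x ≈ y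
  *-cancelˡ 0<z eq = antisym (*-cancelˡ-≤ 0<z (≤-reflexive eq)) (*-cancelˡ-≤ 0<z (≤-reflexive (sym eq)))

  expSeries-nonNeg : ∀ {x} n → 0# ≤ x → 0# ≤ expSeries x n
  expSeries-nonNeg n 0≤x = *-nonNeg (^-nonNeg n 0≤x) (<⇒≤ (⁻¹-pos (fromℕ-!-pos n)))

  ∣expSeries∣ : ∀ x n → ∣ expSeries x n ∣ ≈ expSeries ∣ x ∣ n
  ∣expSeries∣ x n = trans (∣∣-* (x ^ n) _) (*-cong (∣∣-^ x n) (0≤x⇒∣x∣≈x (<⇒≤ (⁻¹-pos (fromℕ-!-pos n)))))

  expSeries-suc : ∀ x n → fromℕ (suc n) * expSeries x (suc n) ≈ x * expSeries x n
  expSeries-suc x n = *-cancelˡ (fromℕ-!-pos n) (begin-equality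
    n! * (fromℕ (suc n) * (x * x ^ n * [1+n]!⁻¹))
      ≈⟨ solve 4 (λ a b c d → a :* (b :* (c :* d)) := c :* (b :* a :* d)) refl n! (fromℕ (suc n)) (x * x ^ n) [1+n]!⁻¹ ⟩
    x * x ^ n * (fromℕ (suc n) * n! * [1+n]!⁻¹)      ≈⟨ *-congˡ (*-congʳ (fromℕ-* (suc n) (n !))) ⟨
    x * x ^ n * (fromℕ (suc n !) * [1+n]!⁻¹)         ≈⟨ *-congˡ (n!*n!⁻¹≈1 (suc n)) ⟩
    x * x ^ n * 1#                                   ≈⟨ *-congˡ (n!*n!⁻¹≈1 n) ⟨
    x * x ^ n * (n! * fromℕ (n !) ⁻¹)
      ≈⟨ solve 4 (λ a b c d → a :* b :* (c :* d) := c :* (a :* (b :* d))) refl x (x ^ n) n! _ ⟩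
    n! * (x * (x ^ n * fromℕ (n !) ⁻¹))              ∎)
    where
    n! = fromℕ (n !)
    [1+n]!⁻¹ = fromℕ (suc n !) ⁻¹

  -- Past n ≥ x the terms decrease.
  expSeries-bounded : ∀ {x} → 0# ≤ x → ∃[ C ] (∀ n → expSeries x n ≤ C)
  expSeries-bounded {x} 0≤x = C , bound
    where
    m = proj₁ (archimedean x)
    C = finiteSum (expSeries x) (downFrom (suc m))
    bound : ∀ n → expSeries x n ≤ C
    initial : ∀ n → n ℕ.≤ m → expSeries x n ≤ C
    initial n n≤m = ≤-trans (≤-reflexive (sym (+-identityʳ _)))
      (Σ-⊆ (λ k → expSeries-nonNeg k 0≤x) (n ∷ []) (downFrom (suc m)) ([] ∷ []) λ { (here ≡.refl) → ∈-downFrom⁺ (ℕ.s≤s n≤m) })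
    bound zero    = initial 0 ℕ.z≤n
    bound (suc n) with suc n ℕ.≤? m
    ... | yes n<m = initial (suc n) n<m
    ... | no  n≮m = ≤-trans (*-cancelˡ-≤ (fromℕ-pos (suc n)) (begin
      fromℕ (suc n) * expSeries x (suc n)  ≈⟨ expSeries-suc x n ⟩
      x * expSeries x n                    ≤⟨ *-monoˡ-≤ (expSeries-nonNeg n 0≤x)
        (≤-trans (proj₂ (archimedean x)) (fromℕ-mono-≤ (ℕ.<⇒≤ (ℕ.≰⇒> n≮m)))) ⟩
      fromℕ (suc n) * expSeries x n        ∎)) (bound n)

  ½<1 : ½ < 1#
  ½<1 = ≤-<-trans (≤-reflexive (sym (+-identityʳ ½))) (<-≤-trans (+-monoʳ-< ½ 0<½)
    (≤-reflexive (trans (sym (+-cong (*-identityʳ ½) (*-identityʳ ½))) (½+½ 1#))))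

  expSeries-cong : ∀ {x y} → x ≈ y → ∀ n → expSeries x n ≈ expSeries y n
  expSeries-cong x≈y n = *-congʳ (^-congˡ n x≈y)

  expSeries-* : ∀ c x n → expSeries (c * x) n ≈ c ^ n * expSeries x n
  expSeries-* c x n = trans (*-congʳ (^-distrib-* c x n)) (*-assoc _ _ _)

  Σ-expSeries-bounded : ∀ {x} → 0# ≤ x → ∃[ B ] (∀ F → FiniteSubset U F → finiteSum (expSeries x) F ≤ B)
  Σ-expSeries-bounded {x} 0≤x = C * (1# - ½) ⁻¹ , λ F fs → begin
    finiteSum (expSeries x) F                  ≤⟨ Σ-mono F (λ n _ → term n) ⟩
    finiteSum (λ n → C * ½ ^ n) F              ≈⟨ Σ-* C (½ ^_) F ⟩
    C * finiteSum (½ ^_) F                     ≤⟨ *-monoʳ-≤ 0≤C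
      (Dominated⇒Σ≤ (λ n → ^-nonNeg n (<⇒≤ 0<½)) (geometric-Dominated (<⇒≤ 0<½) ½<1) F fs) ⟩
    C * (1# - ½) ⁻¹                            ∎
    where
    bounded = expSeries-bounded {x + x} (+-nonNeg 0≤x 0≤x)
    C = proj₁ bounded
    0≤C : 0# ≤ C
    0≤C = ≤-trans (expSeries-nonNeg 0 (+-nonNeg 0≤x 0≤x)) (proj₂ bounded 0)
    term : ∀ n → expSeries x n ≤ C * ½ ^ n
    term n = begin
      expSeries x n                 ≈⟨ expSeries-cong (½+½ x) n ⟨
      expSeries (½ * x + ½ * x) n   ≈⟨ expSeries-cong (distribˡ ½ x x) n ⟨
      expSeries (½ * (x + x)) n     ≈⟨ expSeries-* ½ (x + x) n ⟩
      ½ ^ n * expSeries (x + x) n   ≤⟨ *-monoʳ-≤ (^-nonNeg n (<⇒≤ 0<½)) (proj₂ bounded n) ⟩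
      ½ ^ n * C                     ≈⟨ *-comm _ _ ⟩
      C * ½ ^ n                     ∎

  exp-HasSum : ∀ x → HasSum U (expSeries x) (exp x)
  exp-HasSum x = let s , h = Σ-bounded⇒summable (λ F fs → ≤-trans (≤-reflexive (Σ-cong F (λ n _ → ∣expSeries∣ x n)))
                                (proj₂ (Σ-expSeries-bounded (∣x∣-nonNeg x)) F fs))
                 in HasSum-cong (λ _ _ → refl) (sym (sumOver-HasSum h)) h

  exp-cong : ∀ {x y} → x ≈ y → exp x ≈ exp y
  exp-cong {x} {y} x≈y = HasSum-unique (exp-HasSum x)
    (HasSum-cong (λ n _ → expSeries-cong (sym x≈y) n) refl (exp-HasSum y))

  finiteSum-tabulate : {I : Set} {n : ℕ} (f : I → Carrier) (φ : Fin n → I) →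
                       finiteSum f (List.tabulate φ) ≈ ∑[ i < n ] f (φ i)
  finiteSum-tabulate {n = zero}  f φ = refl
  finiteSum-tabulate {n = suc n} f φ = +-congˡ (finiteSum-tabulate f (φ ∘ Fin.suc))

  HasSum-Fin : {n : ℕ} (f : Fin n → Carrier) → HasSum U f (∑[ i < n ] f i)
  HasSum-Fin {n} f = HasSum-cong (λ _ _ → refl) (finiteSum-tabulate f id)
    (HasSum-finite f (allFin n) (Unique.allFin⁺ n , All.tabulate (λ _ → tt)) (λ i _ → ∈-allFin i))

  n!≈C : ∀ {n k} → k ℕ.≤ n → fromℕ (n !) ≈ fromℕ (n choose k) * (fromℕ (k !) * fromℕ ((n ∸ k) !))
  n!≈C {n} {k} k≤n = trans (reflexive (≡.cong fromℕ n!≡)) (trans (fromℕ-* (n choose k) _) (*-congˡ (fromℕ-* (k !) _)))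
    where
    instance _ = k ℕ.!* (n ∸ k) !≢0
    n!≡ : n ! ≡ (n choose k) ℕ.* (k ! ℕ.* (n ∸ k) !)
    n!≡ = ≡.trans (≡.sym (m/n*n≡m (≡.subst (ℕ._∣ n !) (ℕ.*-comm ((n ∸ k) !) (k !)) ([n∸k]!k!∣n! k≤n))))
      (≡.cong (ℕ._* (k ! ℕ.* (n ∸ k) !)) (≡.sym (nCk≡n!/k![n-k]! k≤n)))

  -- The binomial theorem divided by n!. Besides the addition theorem of `exp`, it provides the
  -- merging of the exponential factors inside the coefficients of `𝒵`.
  expSeries-⊛ : ∀ x y n → (expSeries x ⊛ expSeries y) n ≈ expSeries (x + y) n
  expSeries-⊛ x y n = sym (begin-equality
    (x + y) ^ n * n!⁻¹                                        ≈⟨ *-congʳ (Binomial.theorem commutativeSemiring n x y) ⟩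
    Binomial.binomialExpansion commutativeSemiring x y n * n!⁻¹
      ≈⟨ *-distribʳ-sum n!⁻¹ (Binomial.binomialTerm commutativeSemiring x y n) ⟩
    ∑[ k ≤ n ] (Binomial.binomialTerm commutativeSemiring x y n k * n!⁻¹)
      ≈⟨ ∑-cong (suc n) (λ k → term (toℕ k) (Fin.toℕ≤pred[n] k)) ⟩
    (expSeries x ⊛ expSeries y) n                             ∎)
    where
    n!⁻¹ = fromℕ (n !) ⁻¹
    term : ∀ k → k ℕ.≤ n → (n choose k) · (x ^ k * y ^ (n ∸ k)) * n!⁻¹ ≈ expSeries x k * expSeries y (n ∸ k)
    term k k≤n = *-cancelˡ (*-pos (fromℕ-!-pos k) (fromℕ-!-pos (n ∸ k))) (begin-equality
      k! * l! * ((n choose k) · z * n!⁻¹)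
        ≈⟨ *-congˡ (*-congʳ (sym (trans (×-assoc-* (n choose k) 1# z) (×-congʳ (n choose k) (*-identityˡ z))))) ⟩
      k! * l! * (fromℕ (n choose k) * z * n!⁻¹)
        ≈⟨ solve 5 (λ k l c z n → k :* l :* (c :* z :* n) := z :* (c :* (k :* l) :* n)) refl k! l! _ z n!⁻¹ ⟩
      z * (fromℕ (n choose k) * (k! * l!) * n!⁻¹)        ≈⟨ *-congˡ (*-congʳ (n!≈C k≤n)) ⟨
      z * (fromℕ (n !) * n!⁻¹)                      ≈⟨ *-congˡ (n!*n!⁻¹≈1 n) ⟩
      z * 1#                                        ≈⟨ *-comm z 1# ⟩
      1# * z
        ≈⟨ *-congʳ (trans (*-cong (n!*n!⁻¹≈1 k) (n!*n!⁻¹≈1 (n ∸ k))) (*-identityˡ 1#)) ⟨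
      (k! * k!⁻¹) * (l! * l!⁻¹) * z                 ≈⟨ solve 6 (λ k k⁻¹ l l⁻¹ a b → (k :* k⁻¹) :* (l :* l⁻¹) :* (a :* b) :=
                                                         k :* l :* ((a :* k⁻¹) :* (b :* l⁻¹))) refl k! k!⁻¹ l! l!⁻¹ (x ^ k) (y ^ (n ∸ k)) ⟩
      k! * l! * (expSeries x k * expSeries y (n ∸ k)) ∎)
      where
      z = x ^ k * y ^ (n ∸ k)
      k! = fromℕ (k !)
      k!⁻¹ = fromℕ (k !) ⁻¹
      l! = fromℕ ((n ∸ k) !)
      l!⁻¹ = fromℕ ((n ∸ k) !) ⁻¹

  -- The exponential function

  -- The Cauchy product: the family over pairs (i , j) is summed along the fibres of i + j, each a
  -- finite sum given by `expSeries-⊛`.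
  exp-+ : ∀ x y → exp (x + y) ≈ exp x * exp y
  exp-+ x y = HasSum-unique (exp-HasSum (x + y)) (HasSum-fibration (λ (i , j) → i ℕ.+ j) (λ _ _ → tt)
      (λ n _ → HasSum-cong (λ _ _ → refl) (expSeries-⊛ x y n)
        (HasSum-reindex (λ k → toℕ k , n ∸ toℕ k) (λ k _ → (tt , tt) , ℕ.m+[n∸m]≡n (Fin.toℕ≤pred[n] k))
          (λ k l _ _ eq → Fin.toℕ-injective (≡.cong proj₁ eq))
          (λ { (i , j) (_ , ≡.refl) → Fin.fromℕ< (ℕ.s≤s (ℕ.m≤m+n i j)) , tt ,
               ≡.cong₂ _,_ (Fin.toℕ-fromℕ< _) (≡.trans (≡.cong (i ℕ.+ j ∸_) (Fin.toℕ-fromℕ< (ℕ.s≤s (ℕ.m≤m+n i j)))) (ℕ.m+n∸m≡n i j)) })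
          (HasSum-Fin {suc n} (λ k → f (toℕ k , n ∸ toℕ k)))))
      (HasSum-× (bound x) (bound y) (exp-HasSum x) (exp-HasSum y)))
    where
    f : ℕ × ℕ → Carrier
    f (i , j) = expSeries x i * expSeries y j
    bound : ∀ z F → FiniteSubset U F → finiteSum (λ n → ∣ expSeries z n ∣) F ≤ proj₁ (Σ-expSeries-bounded (∣x∣-nonNeg z))
    bound z F fs = ≤-trans (≤-reflexive (Σ-cong F (λ n _ → ∣expSeries∣ z n))) (proj₂ (Σ-expSeries-bounded (∣x∣-nonNeg z)) F fs)

  expSeries≤exp : ∀ {x} n → 0# ≤ x → expSeries x n ≤ exp x
  expSeries≤exp {x} n 0≤x = ≤-trans (≤-reflexive (sym (+-identityʳ _)))
    (HasSum-≥ (λ k → expSeries-nonNeg k 0≤x) (exp-HasSum x) (n ∷ []) ([] ∷ [] , tt ∷ []))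

  expSeries-0 : ∀ x → expSeries x 0 ≈ 1#
  expSeries-0 x = trans (*-congʳ (sym fromℕ-1)) (n!*n!⁻¹≈1 0)

  1≤exp : ∀ {x} → 0# ≤ x → 1# ≤ exp x
  1≤exp {x} 0≤x = ≤-trans (≤-reflexive (sym (expSeries-0 x))) (expSeries≤exp 0 0≤x)

  exp-0 : exp 0# ≈ 1#
  exp-0 = *-cancelˡ (<-≤-trans 0<1 (1≤exp ≤-refl))
    (trans (sym (exp-+ 0# 0#)) (trans (exp-cong (+-identityʳ 0#)) (sym (*-identityʳ _))))

  exp-inverse : ∀ x → exp x * exp (- x) ≈ 1#
  exp-inverse x = trans (sym (exp-+ x (- x))) (trans (exp-cong (-‿inverseʳ x)) exp-0)

  exp-pos : ∀ x → 0# < exp x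
  exp-pos x = nonNeg , λ 0≈exp → 1≉0 (trans (sym (exp-inverse x)) (trans (*-congʳ (sym 0≈exp)) (zeroˡ _)))
    where
    nonNeg : 0# ≤ exp x
    nonNeg = ≤-trans (x*x-nonNeg (exp (½ * x))) (≤-reflexive (trans (sym (exp-+ _ _)) (exp-cong (½+½ x))))

  exp-nonNeg : ∀ x → 0# ≤ exp x
  exp-nonNeg x = <⇒≤ (exp-pos x)

  exp-mono-≤ : ∀ {x y} → x ≤ y → exp x ≤ exp y
  exp-mono-≤ {x} {y} x≤y = begin
    exp x                  ≈⟨ *-identityʳ _ ⟨
    exp x * 1#             ≤⟨ *-monoʳ-≤ (exp-nonNeg x) (1≤exp (x≤y⇒0≤y-x x≤y)) ⟩
    exp x * exp (y - x)    ≈⟨ exp-+ x (y - x) ⟨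
    exp (x + (y - x))      ≈⟨ exp-cong (solve 2 (λ x y → x :+ (y :- x) := y) refl x y) ⟩
    exp y                  ∎

  exp-neg≤1 : ∀ {x} → 0# ≤ x → exp (- x) ≤ 1#
  exp-neg≤1 0≤x = ≤-trans (exp-mono-≤ (≤-trans (neg-mono-≤ 0≤x) (≤-reflexive -0#≈0#))) (≤-reflexive exp-0)

  1+x≤exp : ∀ {x} → 0# ≤ x → 1# + x ≤ exp x
  1+x≤exp {x} 0≤x = begin
    1# + x                                   ≈⟨ +-cong (expSeries-0 x) expSeries-1 ⟨
    expSeries x 0 + expSeries x 1            ≈⟨ +-congˡ (+-identityʳ _) ⟨
    expSeries x 0 + (expSeries x 1 + 0#)
      ≤⟨ HasSum-≥ (λ k → expSeries-nonNeg k 0≤x) (exp-HasSum x) (0 ∷ 1 ∷ []) ((((λ ()) ∷ []) ∷ [] ∷ []) , tt ∷ tt ∷ []) ⟩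
    exp x                                    ∎
    where
    expSeries-1 : expSeries x 1 ≈ x
    expSeries-1 = trans (*-cong (*-identityʳ x) (trans (sym (*-identityˡ _)) (expSeries-0 x))) (*-identityʳ x)

  exp-neg<1 : ∀ {x} → 0# < x → exp (- x) < 1#
  exp-neg<1 {x} 0<x = exp-neg≤1 (<⇒≤ 0<x) , λ exp≈1 → <⇒≱ (<-≤-trans (+-monoʳ-< 1# 0<x) (1+x≤exp (<⇒≤ 0<x))) (begin
    exp x                  ≈⟨ *-identityʳ _ ⟨
    exp x * 1#             ≈⟨ *-congˡ exp≈1 ⟨
    exp x * exp (- x)      ≈⟨ exp-inverse x ⟩
    1#                     ≈⟨ +-identityʳ 1# ⟨
    1# + 0#                ∎)

  exp-fromℕ* : ∀ n x → exp (fromℕ n * x) ≈ exp x ^ n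
  exp-fromℕ* zero    x = trans (exp-cong (zeroˡ x)) exp-0
  exp-fromℕ* (suc n) x = trans (exp-cong (trans (distribʳ x 1# _) (+-congʳ (*-identityˡ x))))
    (trans (exp-+ x _) (*-congˡ (exp-fromℕ* n x)))

  ^≤1 : ∀ n {x} → 0# ≤ x → x ≤ 1# → x ^ n ≤ 1#
  ^≤1 n 0≤x x≤1 = ≤-trans (^-monoˡ-≤ n 0≤x x≤1) (≤-reflexive (1^n≈1 n))

  ^-antimonoʳ-≤ : ∀ {m n x} → 0# ≤ x → x ≤ 1# → m ℕ.≤ n → x ^ n ≤ x ^ m
  ^-antimonoʳ-≤ {n = n} 0≤x x≤1 ℕ.z≤n       = ^≤1 n 0≤x x≤1
  ^-antimonoʳ-≤         0≤x x≤1 (ℕ.s≤s m≤n) = *-monoʳ-≤ 0≤x (^-antimonoʳ-≤ 0≤x x≤1 m≤n)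

  ∣∑∣≤ : ∀ n (f : Fin n → Carrier) B → (∀ i → ∣ f i ∣ ≤ B) → ∣ ∑[ i < n ] f i ∣ ≤ fromℕ n * B
  ∣∑∣≤ zero    f B ∣f∣≤B = ≤-reflexive (trans (0≤x⇒∣x∣≈x ≤-refl) (sym (zeroˡ B)))
  ∣∑∣≤ (suc n) f B ∣f∣≤B = begin
    ∣ f Fin.zero + ∑[ i < n ] f (Fin.suc i) ∣          ≤⟨ ∣∣-triangle _ _ ⟩
    ∣ f Fin.zero ∣ + ∣ ∑[ i < n ] f (Fin.suc i) ∣      ≤⟨ +-mono-≤ (∣f∣≤B Fin.zero) (∣∑∣≤ n _ B (λ i → ∣f∣≤B (Fin.suc i))) ⟩
    B + fromℕ n * B                                    ≈⟨ +-congʳ (*-identityˡ B) ⟨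
    1# * B + fromℕ n * B                               ≈⟨ distribʳ B 1# _ ⟨
    fromℕ (suc n) * B                                  ∎

  -- Taylor's formula for the exponential function

  taylor : ℕ → Carrier → Carrier
  taylor p y = ∑[ r ≤ p ] expSeries y (toℕ r)

  -- The summand exp 1 bounds the tail of the series when ∣y∣ ≤ 1; p + 1 counts the terms of the
  -- Taylor polynomial when ∣y∣ ≥ 1.
  taylorConstant : ℕ → Carrier
  taylorConstant p = exp 1# + fromℕ (suc p)

  expSeries≤^ : ∀ {y n} p → 1# ≤ y → n ℕ.≤ p → expSeries y n ≤ y ^ p
  expSeries≤^ {y} {n} p 1≤y n≤p = begin
    y ^ n * fromℕ (n !) ⁻¹   ≤⟨ *-monoʳ-≤ (^-nonNeg n (≤-trans 0≤1 1≤y)) (n!⁻¹≤1 n) ⟩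
    y ^ n * 1#               ≈⟨ *-identityʳ _ ⟩
    y ^ n                    ≤⟨ ^-monoʳ-≤ 1≤y n≤p ⟩
    y ^ p                    ∎

  private
    -- For n > p and ∣y∣ ≤ 1 the power ∣y∣^n is at most ∣y∣^{p+1}, and the remaining factors 1/n!
    -- sum to at most exp 1.
    taylor-small : ∀ p y → ∣ y ∣ ≤ 1# → ∣ exp y - taylor p y ∣ ≤ exp 1# * ∣ y ∣ ^ suc p
    taylor-small p y ∣y∣≤1 = HasSum-∣∣≤ bound (HasSum-+ (exp-HasSum y) (HasSum-neg (HasSum-extend {S = U} (ℕ._≤ p)
        (HasSum-reindex toℕ (λ r _ → tt , Fin.toℕ≤pred[n] r) (λ _ _ _ _ → Fin.toℕ-injective)
          (λ k (_ , k≤p) → Fin.fromℕ< (ℕ.s≤s k≤p) , tt , Fin.toℕ-fromℕ< _)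
          (HasSum-Fin {suc p} (λ r → expSeries y (toℕ r)))))))
      where
      tail : ℕ → Carrier
      tail n = expSeries y n - indicator (ℕ._≤ p) n * expSeries y n
      0≤∣y∣^ = ^-nonNeg (suc p) (∣x∣-nonNeg y)
      term : ∀ n → ∣ tail n ∣ ≤ ∣ y ∣ ^ suc p * expSeries 1# n
      term n with n ℕ.≤? p
      ... | yes n≤p = begin
        ∣ tail n ∣
          ≈⟨ ∣∣-cong (trans (+-congˡ (-‿cong (trans (*-congʳ (reflexive (indicator-yes {P = ℕ._≤ p} n≤p))) (*-identityˡ _)))) (-‿inverseʳ _)) ⟩
        ∣ 0# ∣                         ≈⟨ 0≤x⇒∣x∣≈x ≤-refl ⟩
        0#                             ≤⟨ *-nonNeg 0≤∣y∣^ (expSeries-nonNeg n 0≤1) ⟩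
        ∣ y ∣ ^ suc p * expSeries 1# n ∎
      ... | no n≰p = begin
        ∣ tail n ∣
          ≈⟨ ∣∣-cong (trans (+-congˡ (trans (-‿cong (trans (*-congʳ (reflexive (indicator-no {P = ℕ._≤ p} n≰p))) (zeroˡ _))) -0#≈0#)) (+-identityʳ _)) ⟩
        ∣ expSeries y n ∣                      ≈⟨ ∣expSeries∣ y n ⟩
        ∣ y ∣ ^ n * fromℕ (n !) ⁻¹
          ≤⟨ *-monoˡ-≤ (<⇒≤ (⁻¹-pos (fromℕ-!-pos n))) (^-antimonoʳ-≤ (∣x∣-nonNeg y) ∣y∣≤1 (ℕ.≰⇒> n≰p)) ⟩
        ∣ y ∣ ^ suc p * fromℕ (n !) ⁻¹         ≈⟨ *-congˡ (trans (*-congʳ (1^n≈1 n)) (*-identityˡ _)) ⟨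
        ∣ y ∣ ^ suc p * expSeries 1# n         ∎
      bound : ∀ F → FiniteSubset U F → finiteSum (λ n → ∣ tail n ∣) F ≤ exp 1# * ∣ y ∣ ^ suc p
      bound F fs = begin
        finiteSum (λ n → ∣ tail n ∣) F                       ≤⟨ Σ-mono F (λ n _ → term n) ⟩
        finiteSum (λ n → ∣ y ∣ ^ suc p * expSeries 1# n) F   ≈⟨ Σ-* _ (expSeries 1#) F ⟩
        ∣ y ∣ ^ suc p * finiteSum (expSeries 1#) F
          ≤⟨ *-monoʳ-≤ 0≤∣y∣^ (HasSum-≥ (λ n → expSeries-nonNeg n 0≤1) (exp-HasSum 1#) F fs) ⟩
        ∣ y ∣ ^ suc p * exp 1#                               ≈⟨ *-comm _ _ ⟩
        exp 1# * ∣ y ∣ ^ suc p                               ∎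

    taylor-large : ∀ p y → 1# ≤ ∣ y ∣ → ∣ exp y - taylor p y ∣ ≤ (exp y + fromℕ (suc p)) * ∣ y ∣ ^ suc p
    taylor-large p y 1≤∣y∣ = begin
      ∣ exp y - taylor p y ∣                                 ≤⟨ ∣∣-triangle _ _ ⟩
      ∣ exp y ∣ + ∣ - taylor p y ∣                           ≈⟨ +-cong (0≤x⇒∣x∣≈x (exp-nonNeg y)) (∣-x∣≈∣x∣ _) ⟩
      exp y + ∣ taylor p y ∣
        ≤⟨ +-mono-≤ (≤-trans (≤-reflexive (sym (*-identityʳ _))) (*-monoʳ-≤ (exp-nonNeg y) (1≤x⇒1≤x^n (suc p) 1≤∣y∣)))
             (∣∑∣≤ (suc p) _ _ λ r → ≤-trans (≤-reflexive (∣expSeries∣ y (toℕ r)))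
               (expSeries≤^ (suc p) 1≤∣y∣ (ℕ.≤-trans (Fin.toℕ≤pred[n] r) (ℕ.n≤1+n p)))) ⟩
      exp y * ∣ y ∣ ^ suc p + fromℕ (suc p) * ∣ y ∣ ^ suc p  ≈⟨ distribʳ _ _ _ ⟨
      (exp y + fromℕ (suc p)) * ∣ y ∣ ^ suc p                ∎

  -- The factor is 1 + exp y and not exp ∣y∣: multiplied by the weight w it becomes w + w e^{xE},
  -- whose summands both decay on short triples. For a long first row E is very negative, and w
  -- e^{∣xE∣} would grow.
  taylor-remainder : ∀ p y → ∣ exp y - taylor p y ∣ ≤ taylorConstant p * ∣ y ∣ ^ suc p * (1# + exp y)
  taylor-remainder p y with ≤-or-> ∣ y ∣ 1#
  ... | inj₁ ∣y∣≤1 = begin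
    ∣ exp y - taylor p y ∣              ≤⟨ taylor-small p y ∣y∣≤1 ⟩
    e * Y                               ≤⟨ ≤-by (+-nonNeg (*-nonNeg (*-nonNeg 0≤e 0≤Y) (exp-nonNeg y))
                                                  (*-nonNeg (*-nonNeg (fromℕ-nonNeg (suc p)) 0≤Y) (+-nonNeg 0≤1 (exp-nonNeg y))))
      (solve 4 (λ e Y n z → (e :+ n) :* Y :* (con (+ 1) :+ z) :=
          e :* Y :+ (e :* Y :* z :+ n :* Y :* (con (+ 1) :+ z))) refl e Y (fromℕ (suc p)) (exp y)) ⟩
    taylorConstant p * Y * (1# + exp y) ∎
    where
    e = exp 1#
    Y = ∣ y ∣ ^ suc p
    0≤e = exp-nonNeg 1#
    0≤Y = ^-nonNeg (suc p) (∣x∣-nonNeg y)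
  ... | inj₂ 1<∣y∣ = begin
    ∣ exp y - taylor p y ∣              ≤⟨ taylor-large p y (<⇒≤ 1<∣y∣) ⟩
    (exp y + fromℕ (suc p)) * Y         ≤⟨ ≤-by (+-nonNeg (*-nonNeg (*-nonNeg (x≤y⇒0≤y-x (1≤exp 0≤1)) 0≤Y) (exp-nonNeg y))
                                                  (+-nonNeg (*-nonNeg 0≤e 0≤Y) (*-nonNeg (*-nonNeg (fromℕ-nonNeg (suc p)) 0≤Y) (exp-nonNeg y))))
      (solve 4 (λ e Y n z → (e :+ n) :* Y :* (con (+ 1) :+ z) :=
          (z :+ n) :* Y :+ ((e :- con (+ 1)) :* Y :* z :+ (e :* Y :+ n :* Y :* z))) refl e Y (fromℕ (suc p)) (exp y)) ⟩
    taylorConstant p * Y * (1# + exp y) ∎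
    where
    e = exp 1#
    Y = ∣ y ∣ ^ suc p
    0≤e = exp-nonNeg 1#
    0≤Y = ^-nonNeg (suc p) (∣x∣-nonNeg y)

  -- Summability over triples of an integer and two partitions

  IsPartition : Pred (List ℕ) 0ℓ
  IsPartition μ = Linked ℕ._≥_ μ × All (0 ℕ.<_) μ

  -- Parts are at most k and their number at most l. The recursion asks whether `suc k` is the first
  -- part, which is the identity P_{k+1} = P_k + ρ^{k+1} P_{k+1} of generating functions; the bound
  -- on the length keeps the list finite.
  boundedPartitions : ℕ → ℕ → List (List ℕ)
  boundedPartitions zero    l       = [] ∷ []
  boundedPartitions (suc k) zero    = [] ∷ []
  boundedPartitions (suc k) (suc l) = boundedPartitions k (suc l) ++ map (suc k ∷_) (boundedPartitions (suc k) l)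

  ∈-boundedPartitions : ∀ k l μ → IsPartition μ → All (ℕ._≤ k) μ → List.length μ ℕ.≤ l → μ ∈ boundedPartitions k l
  ∈-boundedPartitions zero    l       []      _ _ _ = here ≡.refl
  ∈-boundedPartitions (suc k) zero    []      _ _ _ = here ≡.refl
  ∈-boundedPartitions (suc k) (suc l) []      p _ _ = ∈-++⁺ˡ (∈-boundedPartitions k (suc l) [] p [] ℕ.z≤n)
  ∈-boundedPartitions zero    l       (x ∷ μ) (_ , 0<x ∷ _) (x≤0 ∷ _) _ = ⊥-elim (ℕ.<⇒≱ 0<x x≤0)
  ∈-boundedPartitions (suc k) (suc l) (x ∷ μ) (d , 0<x ∷ 0<μ) (x≤ ∷ μ≤) (ℕ.s≤s len) with x ℕ.≟ suc k
  ... | yes ≡.refl = ∈-++⁺ʳ (boundedPartitions k (suc l))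
          (∈-map⁺ (suc k ∷_) (∈-boundedPartitions (suc k) l μ (Linked.tail d , 0<μ) μ≤ len))
  ... | no  x≢     with Linked⇒AllPairs (λ x≥y y≥z → ℕ.≤-trans y≥z x≥y) d
  ...   | x≥μ ∷ _ = ∈-++⁺ˡ (∈-boundedPartitions k (suc l) (x ∷ μ) (d , 0<x ∷ 0<μ)
          (x≤k ∷ All.map (λ y≤x → ℕ.≤-trans y≤x x≤k) x≥μ) (ℕ.s≤s len))
    where x≤k = ℕ.≤-pred (ℕ.≤∧≢⇒< x≤ x≢)

  parts≤sum : ∀ μ → All (ℕ._≤ ℕ.sum μ) μ
  parts≤sum []      = []
  parts≤sum (x ∷ μ) = ℕ.m≤m+n x _ ∷ All.map (λ y≤ → ℕ.≤-trans y≤ (ℕ.m≤n+m _ x)) (parts≤sum μ)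

  length≤sum : ∀ {μ} → All (0 ℕ.<_) μ → List.length μ ℕ.≤ ℕ.sum μ
  length≤sum []          = ℕ.z≤n
  length≤sum (0<x ∷ 0<μ) = ℕ.+-mono-≤ 0<x (length≤sum 0<μ)

  -- With c = 1/(1-ρ), B k = exp (c (1 + ρ + ⋯ + ρ^k)) satisfies B k ≤ (1 - ρ^(k+1)) B (k+1), so it
  -- majorises the generating function ∏_{j≤k} 1/(1-ρ^j) of the partitions with parts at most k.
  Σ-boundedPartitions : ∀ {ρ} → 0# ≤ ρ → ρ < 1# → ∀ k l →
    finiteSum (λ μ → ρ ^ ℕ.sum μ) (boundedPartitions k l) ≤ exp ((1# - ρ) ⁻¹ * finiteSum (ρ ^_) (downFrom (suc k)))
  Σ-boundedPartitions {ρ} 0≤ρ ρ<1 = go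
    where
    w : List ℕ → Carrier
    w μ = ρ ^ ℕ.sum μ
    c = (1# - ρ) ⁻¹
    0<1-ρ = x<y⇒0<y-x ρ<1
    0≤c : 0# ≤ c
    0≤c = <⇒≤ (⁻¹-pos 0<1-ρ)
    s B : ℕ → Carrier
    s k = finiteSum (ρ ^_) (downFrom (suc k))
    B k = exp (c * s k)
    1≤B : ∀ k → w [] + 0# ≤ B k
    1≤B k = ≤-trans (≤-reflexive (+-identityʳ 1#)) (1≤exp (*-nonNeg 0≤c (Σ-nonNeg (downFrom (suc k)) (λ n → ^-nonNeg n 0≤ρ))))
    B-step : ∀ k → B k + ρ ^ suc k * B (suc k) ≤ B (suc k)
    B-step k = begin
      -- Since y ≤ ρ gives c (1 - y) ≥ 1, the product (1 - y)(1 + c y) = 1 + y (c (1 - y) - 1) is at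
      -- least 1.
      B k + y * B (suc k)           ≤⟨ +-mono-≤ (≤-by (*-nonNeg (*-nonNeg 0≤y 0≤c[1-y]-1) (exp-nonNeg _))
                                         (solve 3 (λ b c y → (con (+ 1) :- y) :* ((con (+ 1) :+ c :* y) :* b) :=
                                           b :+ y :* (c :* (con (+ 1) :- y) :- con (+ 1)) :* b) refl (B k) c y)) ≤-refl ⟩
      (1# - y) * ((1# + c * y) * B k) + y * B (suc k)
        ≤⟨ +-mono-≤ (*-monoʳ-≤ 0≤1-y (*-monoˡ-≤ (exp-nonNeg _) (1+x≤exp (*-nonNeg 0≤c 0≤y)))) ≤-refl ⟩
      (1# - y) * (exp (c * y) * B k) + y * B (suc k)
        ≈⟨ +-congʳ (*-congˡ (trans (sym (exp-+ _ _)) (exp-cong (sym (distribˡ c y (s k)))))) ⟩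
      (1# - y) * B (suc k) + y * B (suc k)
        ≈⟨ solve 2 (λ b y → (con (+ 1) :- y) :* b :+ y :* b := b) refl (B (suc k)) y ⟩
      B (suc k)                     ∎
      where
      y = ρ ^ suc k
      0≤y = ^-nonNeg (suc k) 0≤ρ
      y≤ρ : y ≤ ρ
      y≤ρ = ≤-trans (*-monoʳ-≤ 0≤ρ (^≤1 k 0≤ρ (<⇒≤ ρ<1))) (≤-reflexive (*-identityʳ ρ))
      0≤1-y : 0# ≤ 1# - y
      0≤1-y = x≤y⇒0≤y-x (≤-trans y≤ρ (<⇒≤ ρ<1))
      0≤c[1-y]-1 : 0# ≤ c * (1# - y) - 1#
      0≤c[1-y]-1 = x≤y⇒0≤y-x (≤-trans (≤-reflexive (sym (⁻¹-inverseˡ (<⇒≉0 0<1-ρ)))) (*-monoʳ-≤ 0≤c (+-monoʳ-≤ 1# (neg-mono-≤ y≤ρ))))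
    go : ∀ k l → finiteSum w (boundedPartitions k l) ≤ B k
    go zero    l    = 1≤B zero
    go (suc k) zero = 1≤B (suc k)
    go (suc k) (suc l) = begin
      finiteSum w (boundedPartitions k (suc l) ++ map (suc k ∷_) P)
        ≈⟨ Σ-++ w (boundedPartitions k (suc l)) _ ⟩
      finiteSum w (boundedPartitions k (suc l)) + finiteSum w (map (suc k ∷_) P)    ≤⟨ +-mono-≤ (go k (suc l)) extended ⟩
      B k + ρ ^ suc k * B (suc k)                                                   ≤⟨ B-step k ⟩
      B (suc k)                                                                     ∎
      where
      P = boundedPartitions (suc k) l
      extended : finiteSum w (map (suc k ∷_) P) ≤ ρ ^ suc k * B (suc k)
      extended = begin
        finiteSum w (map (suc k ∷_) P)              ≈⟨ Σ-map w (suc k ∷_) P ⟩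
        finiteSum (λ μ → w (suc k ∷ μ)) P           ≈⟨ Σ-cong P (λ μ _ → ^-homo-* ρ (suc k) (ℕ.sum μ)) ⟩
        finiteSum (λ μ → ρ ^ suc k * w μ) P         ≈⟨ Σ-* (ρ ^ suc k) w P ⟩
        ρ ^ suc k * finiteSum w P                   ≤⟨ *-monoʳ-≤ (^-nonNeg (suc k) 0≤ρ) (go (suc k) l) ⟩
        ρ ^ suc k * B (suc k)                       ∎

  -- The sum of all parts bounds both the largest part and the number of parts. The geometric sum in
  -- the exponent of the majorant is at most 1/(1-ρ), whatever the bound on the parts.
  partition-Dominated : ∀ {ρ} → 0# ≤ ρ → ρ < 1# →
    Dominated IsPartition (λ μ → ρ ^ ℕ.sum μ) (exp ((1# - ρ) ⁻¹ * (1# - ρ) ⁻¹))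
  partition-Dominated 0≤ρ ρ<1 F pF =
    let n , F⊆ = ⊆-downFrom (map ℕ.sum F) in
    boundedPartitions n n ,
    (λ {μ} μ∈F → let p = All.lookup pF μ∈F
                     sum≤n = ℕ.<⇒≤ (∈-downFrom⁻ (F⊆ (∈-map⁺ ℕ.sum μ∈F)))
                 in ∈-boundedPartitions n n μ p (All.map (λ x≤ → ℕ.≤-trans x≤ sum≤n) (parts≤sum μ))
                      (ℕ.≤-trans (length≤sum (proj₂ p)) sum≤n)) ,
    ≤-trans (Σ-boundedPartitions 0≤ρ ρ<1 n n)
      (exp-mono-≤ (*-monoʳ-≤ (<⇒≤ (⁻¹-pos (x<y⇒0<y-x ρ<1))) (Σ-geometric 0≤ρ ρ<1 (suc n))))

  -- Comparison with two geometric series in the constructor argument i, by i ≤ i² for `+ i` and i ≤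
  -- (i+1)² for `-[1+ i ]`.
  integer-Dominated : ∀ {ρ} → 0# ≤ ρ → ρ < 1# →
    Dominated U (λ m → ρ ^ (ℤ.∣ m ∣ ℕ.* ℤ.∣ m ∣)) ((1# - ρ) ⁻¹ + (1# - ρ) ⁻¹)
  integer-Dominated {ρ} 0≤ρ ρ<1 F _ =
    let n , F⊆ = ⊆-downFrom (map ℤ.∣_∣ F) in
    map +_ (downFrom n) ++ map -[1+_] (downFrom n) ,
    (λ {m} m∈F → covers n m (∈-downFrom⁻ (F⊆ (∈-map⁺ ℤ.∣_∣ m∈F)))) ,
    ≤-trans (≤-reflexive (Σ-++ w (map +_ (downFrom n)) _)) (+-mono-≤
      (half n +_ (λ i → m≤m*m i))
      (half n -[1+_] (λ i → ℕ.≤-trans (ℕ.n≤1+n i) (m≤m*m (suc i)))))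
    where
    w : ℤ → Carrier
    w m = ρ ^ (ℤ.∣ m ∣ ℕ.* ℤ.∣ m ∣)
    m≤m*m : ∀ m → m ℕ.≤ m ℕ.* m
    m≤m*m zero    = ℕ.z≤n
    m≤m*m (suc m) = ℕ.m≤m*n (suc m) (suc m)
    covers : ∀ n m → ℤ.∣ m ∣ ℕ.< n → m ∈ map +_ (downFrom n) ++ map -[1+_] (downFrom n)
    covers n (+ i)    i<n = ∈-++⁺ˡ (∈-map⁺ +_ (∈-downFrom⁺ i<n))
    covers n -[1+ i ] i<n = ∈-++⁺ʳ (map +_ (downFrom n)) (∈-map⁺ -[1+_] (∈-downFrom⁺ (ℕ.<-trans (ℕ.n<1+n i) i<n)))
    half : ∀ n (φ : ℕ → ℤ) → (∀ i → i ℕ.≤ ℤ.∣ φ i ∣ ℕ.* ℤ.∣ φ i ∣) → finiteSum w (map φ (downFrom n)) ≤ (1# - ρ) ⁻¹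
    half n φ i≤ = ≤-trans (≤-reflexive (Σ-map w φ (downFrom n)))
      (≤-trans (Σ-mono (downFrom n) (λ i _ → ^-antimonoʳ-≤ 0≤ρ (<⇒≤ ρ<1) (i≤ i))) (Σ-geometric 0≤ρ ρ<1 n))

  Index : Set
  Index = ℤ × (List ℕ × List ℕ)

  IsIndex : Pred Index 0ℓ
  IsIndex (m , μ , ν) = U m × (IsPartition μ × IsPartition ν)

  size : Index → ℕ
  size (m , μ , ν) = ℤ.∣ m ∣ ℕ.* ℤ.∣ m ∣ ℕ.+ (ℕ.sum μ ℕ.+ ℕ.sum ν)

  -- `size` is additive in the three components, so ρ^S factors and the three majorants multiply.
  Σ-index-bounded : ∀ {ρ} → 0# ≤ ρ → ρ < 1# →
    ∃[ B ] (∀ F → FiniteSubset IsIndex F → finiteSum (λ z → ρ ^ size z) F ≤ B)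
  Σ-index-bounded {ρ} 0≤ρ ρ<1 = _ , λ F fs → ≤-trans
    (≤-reflexive (Σ-cong F (λ (m , μ , ν) _ → trans (^-homo-* ρ (ℤ.∣ m ∣ ℕ.* ℤ.∣ m ∣) _) (*-congˡ (^-homo-* ρ (ℕ.sum μ) (ℕ.sum ν))))))
    (Dominated⇒Σ≤ (λ (m , μ , ν) → *-nonNeg (^-nonNeg (ℤ.∣ m ∣ ℕ.* ℤ.∣ m ∣) 0≤ρ) (*-nonNeg (^-nonNeg (ℕ.sum μ) 0≤ρ) (^-nonNeg (ℕ.sum ν) 0≤ρ)))
      (Dominated-product (λ m → ^-nonNeg (ℤ.∣ m ∣ ℕ.* ℤ.∣ m ∣) 0≤ρ) (λ (μ , ν) → *-nonNeg (^-nonNeg (ℕ.sum μ) 0≤ρ) (^-nonNeg (ℕ.sum ν) 0≤ρ))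
        (integer-Dominated 0≤ρ ρ<1)
        (Dominated-product (λ μ → ^-nonNeg (ℕ.sum μ) 0≤ρ) (λ μ → ^-nonNeg (ℕ.sum μ) 0≤ρ)
          (partition-Dominated 0≤ρ ρ<1) (partition-Dominated 0≤ρ ρ<1))) F fs)

  polynomial≤exp : ∀ {a} → 0# < a → ∀ k → ∃[ C ] 0# ≤ C × (∀ x → 0# ≤ x → (1# + x) ^ k ≤ C * exp (a * x))
  polynomial≤exp {a} 0<a k = C , 0≤C , bound
    where
    a⁻¹ = a ⁻¹
    C = (a⁻¹ ^ k * fromℕ (k !)) * exp a
    0≤a⁻¹^k*k! : 0# ≤ a⁻¹ ^ k * fromℕ (k !)
    0≤a⁻¹^k*k! = *-nonNeg (^-nonNeg k (<⇒≤ (⁻¹-pos 0<a))) (fromℕ-nonNeg (k !))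
    0≤C = *-nonNeg 0≤a⁻¹^k*k! (exp-nonNeg a)
    bound : ∀ x → 0# ≤ x → (1# + x) ^ k ≤ C * exp (a * x)
    bound x 0≤x = begin
      (1# + x) ^ k
        ≈⟨ ^-congˡ k (trans (*-congʳ (⁻¹-inverseˡ (<⇒≉0 0<a))) (*-identityˡ _)) ⟨
      (a⁻¹ * a * (1# + x)) ^ k                         ≈⟨ ^-congˡ k (*-assoc _ _ _) ⟩
      (a⁻¹ * (a * (1# + x))) ^ k                       ≈⟨ ^-distrib-* _ _ k ⟩
      a⁻¹ ^ k * y ^ k                                  ≈⟨ *-congˡ (trans (*-congˡ (n!*n!⁻¹≈1 k)) (*-identityʳ _)) ⟨
      a⁻¹ ^ k * (y ^ k * (fromℕ (k !) * fromℕ (k !) ⁻¹))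
        ≈⟨ solve 4 (λ a y k k⁻¹ → a :* (y :* (k :* k⁻¹)) := a :* k :* (y :* k⁻¹)) refl (a⁻¹ ^ k) (y ^ k) (fromℕ (k !)) _ ⟩
      a⁻¹ ^ k * fromℕ (k !) * expSeries y k
        ≤⟨ *-monoʳ-≤ 0≤a⁻¹^k*k! (expSeries≤exp k (*-nonNeg (<⇒≤ 0<a) (+-nonNeg 0≤1 0≤x))) ⟩
      a⁻¹ ^ k * fromℕ (k !) * exp y
        ≈⟨ *-congˡ (trans (exp-cong (solve 2 (λ a x → a :* (con (+ 1) :+ x) := a :+ a :* x) refl a x)) (exp-+ a (a * x))) ⟩
      a⁻¹ ^ k * fromℕ (k !) * (exp a * exp (a * x))    ≈⟨ *-assoc _ _ _ ⟨
      C * exp (a * x)                                  ∎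
      where y = a * (1# + x)

  weight : Carrier → ℕ → Index → Carrier
  weight a k z = (1# + fromℕ (size z)) ^ k * exp (- (a * fromℕ (size z)))

  -- Half of the decay rate absorbs the polynomial; the other half leaves a ratio ρ < 1 for
  -- `Σ-index-bounded`.
  Σ-weight-bounded : ∀ {a} → 0# < a → ∀ k →
    ∃[ W ] (∀ F → FiniteSubset IsIndex F → finiteSum (weight a k) F ≤ W)
  Σ-weight-bounded {a} 0<a k = C * B , λ F fs → begin
    finiteSum (weight a k) F              ≤⟨ Σ-mono F (λ z _ → term (size z)) ⟩
    finiteSum (λ z → C * ρ ^ size z) F    ≈⟨ Σ-* C (λ z → ρ ^ size z) F ⟩
    C * finiteSum (λ z → ρ ^ size z) F    ≤⟨ *-monoʳ-≤ 0≤C (proj₂ bounded F fs) ⟩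
    C * B                                 ∎
    where
    h = ½ * a
    0<h = *-pos 0<½ 0<a
    ρ = exp (- h)
    bounded = Σ-index-bounded (exp-nonNeg (- h)) (exp-neg<1 0<h)
    B = proj₁ bounded
    poly = polynomial≤exp 0<h k
    C = proj₁ poly
    0≤C = proj₁ (proj₂ poly)
    term : ∀ n → (1# + fromℕ n) ^ k * exp (- (a * fromℕ n)) ≤ C * ρ ^ n
    term n = begin
      (1# + fromℕ n) ^ k * exp (- (a * fromℕ n))
        ≤⟨ *-monoˡ-≤ (exp-nonNeg _) (proj₂ (proj₂ poly) (fromℕ n) (fromℕ-nonNeg n)) ⟩
      C * exp (h * fromℕ n) * exp (- (a * fromℕ n))           ≈⟨ trans (*-assoc _ _ _) (*-congˡ (sym (exp-+ _ _))) ⟩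
      C * exp (h * fromℕ n - a * fromℕ n)
        ≈⟨ *-congˡ (exp-cong (+-congˡ (-‿cong (*-congʳ (sym (½+½ a)))))) ⟩
      C * exp (h * fromℕ n - (h + h) * fromℕ n)
        ≈⟨ *-congˡ (exp-cong (solve 2 (λ h n → h :* n :- (h :+ h) :* n := n :* (:- h)) refl h (fromℕ n))) ⟩
      C * exp (fromℕ n * - h)                                 ≈⟨ *-congˡ (exp-fromℕ* n (- h)) ⟩
      C * ρ ^ n                                               ∎

  -- Signatures as triples

  part : List ℕ → ℕ → ℕ
  part []      i       = 0
  part (x ∷ μ) zero    = x
  part (x ∷ μ) (suc i) = part μ i

  part-antimono : ∀ {μ i j} → Linked ℕ._≥_ μ → i ℕ.≤ j → part μ j ℕ.≤ part μ i
  part-antimono {[]}    d ℕ.z≤n = ℕ.z≤n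
  part-antimono {[]}    d (ℕ.s≤s _) = ℕ.z≤n
  part-antimono {x ∷ μ} {j = zero}  d ℕ.z≤n = ℕ.≤-refl
  part-antimono {x ∷ []} {j = suc j} d ℕ.z≤n = ℕ.z≤n
  part-antimono {x ∷ y ∷ μ} {j = suc j} (x≥y ∷ d) ℕ.z≤n = ℕ.≤-trans (part-antimono {y ∷ μ} {zero} {j} d ℕ.z≤n) x≥y
  part-antimono {x ∷ μ} d (ℕ.s≤s i≤j) = part-antimono (Linked.tail d) i≤j

  part-beyond : ∀ μ {i} → List.length μ ℕ.≤ i → part μ i ≡ 0
  part-beyond []      _             = ≡.refl
  part-beyond (x ∷ μ) (ℕ.s≤s len≤i) = part-beyond μ len≤i

  part-injective : ∀ μ ν → All (0 ℕ.<_) μ → All (0 ℕ.<_) ν → (∀ i → part μ i ≡ part ν i) → μ ≡ ν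
  part-injective []      []      _          _          eq = ≡.refl
  part-injective []      (y ∷ ν) _          (0<y ∷ _)  eq = ⊥-elim (ℕ.<⇒≢ 0<y (eq 0))
  part-injective (x ∷ μ) []      (0<x ∷ _)  _          eq = ⊥-elim (ℕ.<⇒≢ 0<x (≡.sym (eq 0)))
  part-injective (x ∷ μ) (y ∷ ν) (_ ∷ 0<μ) (_ ∷ 0<ν) eq =
    ≡.cong₂ _∷_ (eq 0) (part-injective μ ν 0<μ 0<ν (λ i → eq (suc i)))

  -- Stopping at the first zero keeps all parts positive and loses nothing when f is antitone.
  fromParts : (ℕ → ℕ) → ℕ → List ℕ
  fromParts f zero    = []
  fromParts f (suc a) with f 0
  ... | zero  = []
  ... | suc x = suc x ∷ fromParts (f ∘ suc) a

  part-fromParts : ∀ f a → (∀ i j → i ℕ.≤ j → f j ℕ.≤ f i) → (∀ i → a ℕ.≤ i → f i ≡ 0) →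
                   ∀ i → part (fromParts f a) i ≡ f i
  part-fromParts f zero    mono vanish i = ≡.sym (vanish i ℕ.z≤n)
  part-fromParts f (suc a) mono vanish i with f 0 in f0≡
  ... | zero = ≡.sym (ℕ.n≤0⇒n≡0 (≡.subst (f i ℕ.≤_) f0≡ (mono 0 i ℕ.z≤n)))
  part-fromParts f (suc a) mono vanish zero    | suc x = ≡.sym f0≡
  part-fromParts f (suc a) mono vanish (suc i) | suc x =
    part-fromParts (f ∘ suc) a (λ i j i≤j → mono (suc i) (suc j) (ℕ.s≤s i≤j)) (λ i a≤i → vanish (suc i) (ℕ.s≤s a≤i)) i

  fromParts-length : ∀ f a → List.length (fromParts f a) ℕ.≤ a
  fromParts-length f zero    = ℕ.z≤n
  fromParts-length f (suc a) with f 0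
  ... | zero  = ℕ.z≤n
  ... | suc x = ℕ.s≤s (fromParts-length (f ∘ suc) a)

  fromParts-IsPartition : ∀ f a → (∀ i j → i ℕ.≤ j → f j ℕ.≤ f i) → IsPartition (fromParts f a)
  fromParts-IsPartition f a mono = decreasing f a mono , positive f a
    where
    positive : ∀ f a → All (0 ℕ.<_) (fromParts f a)
    positive f zero    = []
    positive f (suc a) with f 0
    ... | zero  = []
    ... | suc x = ℕ.s≤s ℕ.z≤n ∷ positive (f ∘ suc) a
    cons : ∀ x f a → (∀ i j → i ℕ.≤ j → f j ℕ.≤ f i) → f 0 ℕ.≤ x → Linked ℕ._≥_ (x ∷ fromParts f a)
    cons x f zero    mono f0≤x = [-]
    cons x f (suc a) mono f0≤x with f 0 in f0≡
    ... | zero  = [-]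
    ... | suc y = f0≤x ∷ cons (suc y) (f ∘ suc) a (λ i j i≤j → mono (suc i) (suc j) (ℕ.s≤s i≤j))
                    (≡.subst (f 1 ℕ.≤_) f0≡ (mono 0 1 ℕ.z≤n))
    decreasing : ∀ f a → (∀ i j → i ℕ.≤ j → f j ℕ.≤ f i) → Linked ℕ._≥_ (fromParts f a)
    decreasing f zero    mono = []
    decreasing f (suc a) mono with f 0 in f0≡
    ... | zero  = []
    ... | suc x = cons (suc x) (f ∘ suc) a (λ i j i≤j → mono (suc i) (suc j) (ℕ.s≤s i≤j))
                    (≡.subst (f 1 ℕ.≤_) f0≡ (mono 0 1 ℕ.z≤n))

  -- Rows are zero-based, so `N ∸ suc i` is the row opposite to i. Because `part` is zero beyond the
  -- length, one formula covers the rows of μ, the rows of ν and those between.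
  entry : Index → ℕ → ℕ → ℤ
  entry (m , μ , ν) N i = m ℤ.+ + part μ i ℤ.- + part ν (N ∸ suc i)

  signature : (N : ℕ) → Index → Vec ℤ N
  signature N z = Vec.tabulate (λ i → entry z N (toℕ i))

  IsShort : ℕ → ℕ → Pred Index 0ℓ
  IsShort a c (m , μ , ν) = List.length μ ℕ.≤ a × List.length ν ℕ.≤ c

  Linked-tabulate : ∀ n (g : ℕ → ℤ) → (∀ i → g i ℤ.≥ g (suc i)) → VecLinked.Linked ℤ._≥_ (Vec.tabulate {n = n} (g ∘ toℕ))
  Linked-tabulate zero          g dec = VecLinked.[]
  Linked-tabulate (suc zero)    g dec = VecLinked.[-]
  Linked-tabulate (suc (suc n)) g dec = dec 0 VecLinked.∷ Linked-tabulate (suc n) (g ∘ suc) (dec ∘ suc)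

  signature-Signature : ∀ N z → IsIndex z → Signature N (signature N z)
  signature-Signature N (m , μ , ν) (_ , pμ , pν) = Linked-tabulate N _ λ i →
    ℤ.+-mono-≤ (ℤ.+-monoʳ-≤ m (ℤ.+≤+ (part-antimono (proj₁ pμ) (ℕ.n≤1+n i))))
               (ℤ.neg-mono-≤ (ℤ.+≤+ (part-antimono (proj₁ pν) (ℕ.∸-monoʳ-≤ N (ℕ.n≤1+n (suc i))))))

  module _ (a c : ℕ) where
    private
      N : ℕ
      N = suc (a ℕ.+ c)

      N∸1+a≡c : N ∸ suc a ≡ c
      N∸1+a≡c = ℕ.m+n∸m≡n a c

      c≤N∸1+i : ∀ {i} → i ℕ.≤ a → c ℕ.≤ N ∸ suc i
      c≤N∸1+i i≤a = ℕ.≤-trans (ℕ.≤-reflexive (≡.sym N∸1+a≡c)) (ℕ.∸-monoʳ-≤ N (ℕ.s≤s i≤a))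

      a≤N∸1+j : ∀ {j} → j ℕ.≤ c → a ℕ.≤ N ∸ suc j
      a≤N∸1+j j≤c = ℕ.≤-trans (ℕ.≤-reflexive (≡.sym (ℕ.m+n∸n≡m a c))) (ℕ.∸-monoʳ-≤ N (ℕ.s≤s j≤c))

      N∸1+i≤c : ∀ {i} → a ℕ.≤ i → N ∸ suc i ℕ.≤ c
      N∸1+i≤c a≤i = ℕ.≤-trans (ℕ.∸-monoʳ-≤ N (ℕ.s≤s a≤i)) (ℕ.≤-reflexive N∸1+a≡c)

      reflect : ∀ {i} → i ℕ.< N → N ∸ suc (N ∸ suc i) ≡ i
      reflect {i} (ℕ.s≤s i≤) = ℕ.m∸[m∸n]≡n i≤

      c<N : c ℕ.< N
      c<N = ℕ.s≤s (ℕ.m≤n+m c a)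

    entry-left : ∀ {m μ ν i} → List.length ν ℕ.≤ c → i ℕ.≤ a → entry (m , μ , ν) N i ≡ m ℤ.+ + part μ i
    entry-left {m} {μ} {ν} {i} lν i≤a rewrite part-beyond ν (ℕ.≤-trans lν (c≤N∸1+i i≤a)) = ℤ.+-identityʳ _

    entry-right : ∀ {m μ ν i} → List.length μ ℕ.≤ a → a ℕ.≤ i → entry (m , μ , ν) N i ≡ m ℤ.- + part ν (N ∸ suc i)
    entry-right {m} {μ} {ν} {i} lμ a≤i rewrite part-beyond μ (ℕ.≤-trans lμ a≤i) = ≡.cong (λ w → w ℤ.- + part ν (N ∸ suc i)) (ℤ.+-identityʳ m)

    -- Up to row a the opposite row lies beyond ν, and from row a on μ has ended. This removes the
    -- product of the two parts from λ_i², so that κ separates into contributions of μ and ν.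
    part*part≡0 : ∀ {m μ ν} → IsShort a c (m , μ , ν) → ∀ i → part μ i ≡ 0 ⊎ part ν (N ∸ suc i) ≡ 0
    part*part≡0 {μ = μ} {ν} (lμ , lν) i with ℕ.≤-total i a
    ... | inj₁ i≤a = inj₂ (part-beyond ν (ℕ.≤-trans lν (c≤N∸1+i i≤a)))
    ... | inj₂ a≤i = inj₁ (part-beyond μ (ℕ.≤-trans lμ a≤i))

    entry-middle : ∀ {m μ ν} → IsShort a c (m , μ , ν) → entry (m , μ , ν) N a ≡ m
    entry-middle {m} {μ} {ν} (lμ , lν) = ≡.trans (entry-left {m} {μ} {ν} lν ℕ.≤-refl)
      (≡.trans (≡.cong (λ k → m ℤ.+ + k) (part-beyond μ lμ)) (ℤ.+-identityʳ m))

    -- Row a returns m, because neither partition reaches it; the rows before it then return μ and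
    -- the rows after it ν.
    signature-injective : ∀ z z′ → IsIndex z × IsShort a c z → IsIndex z′ × IsShort a c z′ →
                          signature N z ≡ signature N z′ → z ≡ z′
    signature-injective z@(m , μ , ν) z′@(m′ , μ′ , ν′) ((_ , pμ , pν) , s@(lμ , lν)) ((_ , pμ′ , pν′) , s′@(lμ′ , lν′)) eq =
      ≡.cong₂ _,_ m≡m′ (≡.cong₂ _,_ (part-injective μ μ′ (proj₂ pμ) (proj₂ pμ′) μ≡) (part-injective ν ν′ (proj₂ pν) (proj₂ pν′) ν≡))
      where
      entry≡ : ∀ i → i ℕ.< N → entry z N i ≡ entry z′ N i
      entry≡ i i<N = ≡.subst (λ k → entry z N k ≡ entry z′ N k) (Fin.toℕ-fromℕ< i<N)
        (≡.trans (≡.sym (Vec.lookup∘tabulate (λ k → entry z N (toℕ k)) (Fin.fromℕ< i<N)))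
          (≡.trans (≡.cong (λ v → Vec.lookup v (Fin.fromℕ< i<N)) eq) (Vec.lookup∘tabulate (λ k → entry z′ N (toℕ k)) (Fin.fromℕ< i<N))))
      m≡m′ : m ≡ m′
      m≡m′ = ≡.trans (≡.sym (entry-middle {m} {μ} {ν} s)) (≡.trans (entry≡ a (ℕ.s≤s (ℕ.m≤m+n a c))) (entry-middle {m′} {μ′} {ν′} s′))
      μ≡ : ∀ i → part μ i ≡ part μ′ i
      μ≡ i with ℕ.≤-total i a
      ... | inj₂ a≤i = ≡.trans (part-beyond μ (ℕ.≤-trans lμ a≤i)) (≡.sym (part-beyond μ′ (ℕ.≤-trans lμ′ a≤i)))
      ... | inj₁ i≤a = ℤ.+-injective (AbelianGroupProperties.∙-cancelˡ ℤ.+-0-abelianGroup m _ _ (≡.trans (≡.sym (entry-left {m} {μ} {ν} lν i≤a))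
              (≡.trans (entry≡ i (ℕ.s≤s (ℕ.≤-trans i≤a (ℕ.m≤m+n a c))))
                (≡.trans (entry-left {m′} {μ′} {ν′} lν′ i≤a) (≡.cong (λ w → w ℤ.+ _) (≡.sym m≡m′))))))
      ν≡ : ∀ j → part ν j ≡ part ν′ j
      ν≡ j with ℕ.≤-total j c
      ... | inj₂ c≤j = ≡.trans (part-beyond ν (ℕ.≤-trans lν c≤j)) (≡.sym (part-beyond ν′ (ℕ.≤-trans lν′ c≤j)))
      ... | inj₁ j≤c = ≡.subst (λ k → part ν k ≡ part ν′ k) (reflect (ℕ.≤-<-trans j≤c c<N))
              (ℤ.+-injective (ℤ.neg-injective (AbelianGroupProperties.∙-cancelˡ ℤ.+-0-abelianGroup m _ _
                (≡.trans (≡.sym (entry-right {m} {μ} {ν} lμ (a≤N∸1+j j≤c)))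
                  (≡.trans (entry≡ (N ∸ suc j) (ℕ.s≤s (ℕ.m∸n≤m (a ℕ.+ c) j)))
                    (≡.trans (entry-right {m′} {μ′} {ν′} lμ′ (a≤N∸1+j j≤c)) (≡.cong (λ w → w ℤ.- _) (≡.sym m≡m′))))))))

    signature-surjective : ∀ v → Signature N v → ∃[ z ] (IsIndex z × IsShort a c z) × signature N z ≡ v
    signature-surjective v sv = z , ((tt , pμ , pν) , fromParts-length f a , fromParts-length g c) ,
      ≡.trans (Vec.tabulate-cong (λ i → entry≡ (toℕ i) (Fin.toℕ<n i))) (≡.trans (Vec.tabulate-cong at≡lookup) (Vec.tabulate∘lookup v))
      where
      -- A total function of the row number; its default value is never reached, as only rows below
      -- N are evaluated.
      at : ℕ → ℤ
      at i with i ℕ.<? N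
      ... | yes i<N = Vec.lookup v (Fin.fromℕ< i<N)
      ... | no  _   = + 0
      at≡lookup : ∀ i → at (toℕ i) ≡ Vec.lookup v i
      at≡lookup i with toℕ i ℕ.<? N
      ... | yes i<N = ≡.cong (Vec.lookup v) (Fin.fromℕ<-toℕ i i<N)
      ... | no  i≮N = ⊥-elim (i≮N (Fin.toℕ<n i))
      at-antimono : ∀ {i j} → i ℕ.≤ j → j ℕ.< N → at j ℤ.≤ at i
      at-antimono {i} {j} i≤j j<N with i ℕ.<? N | j ℕ.<? N
      ... | no i≮N  | _       = ⊥-elim (i≮N (ℕ.≤-<-trans i≤j j<N))
      ... | yes _   | no j≮N  = ⊥-elim (j≮N j<N)
      ... | yes i<N | yes j<N′ with ℕ.m≤n⇒m<n∨m≡n i≤j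
      ...   | inj₁ i<j = VecLinked.lookup⁺ (λ x≥y y≥z → ℤ.≤-trans y≥z x≥y) sv
                           (≡.subst₂ ℕ._<_ (≡.sym (Fin.toℕ-fromℕ< i<N)) (≡.sym (Fin.toℕ-fromℕ< j<N′)) i<j)
      ...   | inj₂ ≡.refl = ℤ.≤-reflexive (≡.cong (Vec.lookup v) (Fin.fromℕ<-cong _ _ ≡.refl j<N′ i<N))
      f g : ℕ → ℕ
      -- Truncating the row number at a makes f antitone on all of ℕ and zero from a on, as
      -- `part-fromParts` requires. The difference is already nonnegative; the absolute value only
      -- moves it to ℕ. The same holds for g and c.
      f i = ℤ.∣ at (i ℕ.⊓ a) ℤ.- at a ∣
      g j = ℤ.∣ at a ℤ.- at (N ∸ suc (j ℕ.⊓ c)) ∣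
      m : ℤ
      m = at a
      z : Index
      z = m , fromParts f a , fromParts g c
      a<N : a ℕ.< N
      a<N = ℕ.s≤s (ℕ.m≤m+n a c)
      +∣x-y∣ : ∀ {x y} → y ℤ.≤ x → + ℤ.∣ x ℤ.- y ∣ ≡ x ℤ.- y
      +∣x-y∣ y≤x = ℤ.0≤i⇒+∣i∣≡i (ℤ.i≤j⇒0≤j-i y≤x)
      at-a≤ : ∀ i → at a ℤ.≤ at (i ℕ.⊓ a)
      at-a≤ i = at-antimono (ℕ.m⊓n≤n i a) a<N
      ≤at-a : ∀ j → at (N ∸ suc (j ℕ.⊓ c)) ℤ.≤ at a
      ≤at-a j = at-antimono (a≤N∸1+j (ℕ.m⊓n≤n j c)) (ℕ.s≤s (ℕ.m∸n≤m (a ℕ.+ c) (j ℕ.⊓ c)))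
      f-antimono : ∀ i j → i ℕ.≤ j → f j ℕ.≤ f i
      f-antimono i j i≤j = ℤ.drop‿+≤+ (≡.subst₂ ℤ._≤_ (≡.sym (+∣x-y∣ (at-a≤ j))) (≡.sym (+∣x-y∣ (at-a≤ i)))
        (ℤ.+-monoˡ-≤ (ℤ.- at a) (at-antimono (ℕ.⊓-monoˡ-≤ a i≤j) (ℕ.≤-<-trans (ℕ.m⊓n≤n j a) a<N))))
      g-antimono : ∀ i j → i ℕ.≤ j → g j ℕ.≤ g i
      g-antimono i j i≤j = ℤ.drop‿+≤+ (≡.subst₂ ℤ._≤_ (≡.sym (+∣x-y∣ (≤at-a j))) (≡.sym (+∣x-y∣ (≤at-a i)))
        (ℤ.+-monoʳ-≤ (at a) (ℤ.neg-mono-≤ (at-antimono (ℕ.∸-monoʳ-≤ N (ℕ.s≤s (ℕ.⊓-monoˡ-≤ c i≤j)))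
          (ℕ.s≤s (ℕ.m∸n≤m (a ℕ.+ c) (i ℕ.⊓ c)))))))
      f-vanish : ∀ i → a ℕ.≤ i → f i ≡ 0
      f-vanish i a≤i = ≡.cong ℤ.∣_∣ (≡.trans (≡.cong (λ k → at k ℤ.- at a) (ℕ.m≥n⇒m⊓n≡n a≤i)) (ℤ.+-inverseʳ (at a)))
      g-vanish : ∀ j → c ℕ.≤ j → g j ≡ 0
      g-vanish j c≤j = ≡.cong ℤ.∣_∣ (≡.trans (≡.cong (λ k → at a ℤ.- at k)
        (≡.trans (≡.cong (λ k → N ∸ suc k) (ℕ.m≥n⇒m⊓n≡n c≤j)) (ℕ.m+n∸n≡m a c))) (ℤ.+-inverseʳ (at a)))
      pμ : IsPartition (fromParts f a)
      pμ = fromParts-IsPartition f a f-antimono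
      pν : IsPartition (fromParts g c)
      pν = fromParts-IsPartition g c g-antimono
      x+[y-x]≡y : ∀ x y → x ℤ.+ (y ℤ.- x) ≡ y
      x+[y-x]≡y x y = ≡.trans (ℤ.+-comm x (y ℤ.- x)) (≡.trans (ℤ.+-assoc y (ℤ.- x) x)
        (≡.trans (≡.cong (λ w → y ℤ.+ w) (ℤ.+-inverseˡ x)) (ℤ.+-identityʳ y)))
      x-[x-y]≡y : ∀ x y → x ℤ.- (x ℤ.- y) ≡ y
      x-[x-y]≡y x y = ≡.trans (≡.cong (λ w → x ℤ.+ w) (≡.trans (ℤ.neg-distrib-+ x (ℤ.- y))
        (≡.trans (≡.cong (λ w → ℤ.- x ℤ.+ w) (ℤ.neg-involutive y)) (ℤ.+-comm (ℤ.- x) y)))) (x+[y-x]≡y x y)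
      entry≡ : ∀ i → i ℕ.< N → entry z N i ≡ at i
      entry≡ i i<N with ℕ.≤-total i a
      ... | inj₁ i≤a = ≡.trans (entry-left {m} {fromParts f a} {fromParts g c} (fromParts-length g c) i≤a)
              (≡.trans (≡.cong (λ k → m ℤ.+ + k) (part-fromParts f a f-antimono f-vanish i))
                (≡.trans (≡.cong (λ w → m ℤ.+ w) (+∣x-y∣ (at-a≤ i)))
                  (≡.trans (x+[y-x]≡y m _) (≡.cong at (ℕ.m≤n⇒m⊓n≡m i≤a)))))
      ... | inj₂ a≤i = ≡.trans (entry-right {m} {fromParts f a} {fromParts g c} (fromParts-length f a) a≤i)
              (≡.trans (≡.cong (λ k → m ℤ.- + k) (part-fromParts g c g-antimono g-vanish (N ∸ suc i)))
                (≡.trans (≡.cong (λ w → m ℤ.- w) (+∣x-y∣ (≤at-a (N ∸ suc i))))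
                  (≡.trans (x-[x-y]≡y m _) (≡.cong at
                    (≡.trans (≡.cong (λ k → N ∸ suc k) (ℕ.m≤n⇒m⊓n≡m (N∸1+i≤c a≤i))) (reflect i<N))))))

  -- The eigenvalue κ of a signature

  ∑-last : ∀ n (f : ℕ → Carrier) → ∑[ i ≤ n ] f (toℕ i) ≈ ∑[ i < n ] f (toℕ i) + f n
  ∑-last zero    f = +-comm _ _
  ∑-last (suc n) f = trans (+-congˡ (∑-last n (f ∘ suc))) (sym (+-assoc _ _ _))

  ∑-reverse : ∀ n (f : ℕ → Carrier) → ∑[ i < n ] f (n ∸ suc (toℕ i)) ≈ ∑[ i < n ] f (toℕ i)
  ∑-reverse zero    f = refl
  ∑-reverse (suc n) f = trans (+-congˡ (∑-reverse n f)) (trans (+-comm _ _) (sym (∑-last n f)))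

  ∑-zero : ∀ n (f : Fin n → Carrier) → (∀ i → f i ≈ 0#) → ∑[ i < n ] f i ≈ 0#
  ∑-zero zero    f f≈0 = refl
  ∑-zero (suc n) f f≈0 = trans (+-cong (f≈0 Fin.zero) (∑-zero n (f ∘ Fin.suc) (f≈0 ∘ Fin.suc))) (+-identityʳ 0#)

  -- With n + 1 terms and c = n the sum is zero: the coefficients N + 1 - 2i cancel, so the common
  -- shift m contributes nothing linear to κ.
  ∑-arithmetic : ∀ n c → ∑[ i < n ] (c - fromℕ 2 * fromℕ (toℕ i)) ≈ fromℕ n * (c + 1# - fromℕ n)
  ∑-arithmetic zero    c = sym (zeroˡ _)
  ∑-arithmetic (suc n) c = trans (∑-last n (λ i → c - fromℕ 2 * fromℕ i)) (trans (+-congʳ (∑-arithmetic n c))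
    (solve 2 (λ n c → n :* (c :+ con (+ 1) :- n) :+ (c :- con (+ 2) :* n) :=
      (con (+ 1) :+ n) :* (c :+ con (+ 1) :- (con (+ 1) :+ n))) refl (fromℕ n) c))

  -- `moment μ` is the statistic ∑ i μ_i with zero-based i, usually written n(μ): each part is
  -- counted once for every row above it.
  norm squares moment : List ℕ → Carrier
  norm μ = finiteSum fromℕ μ
  squares μ = finiteSum (λ k → fromℕ k * fromℕ k) μ
  moment []      = 0#
  moment (x ∷ μ) = norm μ + moment μ

  fromℕ-sum : ∀ μ → fromℕ (ℕ.sum μ) ≈ norm μ
  fromℕ-sum []      = refl
  fromℕ-sum (x ∷ μ) = trans (fromℕ-+ x _) (+-congˡ (fromℕ-sum μ))

  norm-nonNeg : ∀ μ → 0# ≤ norm μ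
  norm-nonNeg μ = Σ-nonNeg μ fromℕ-nonNeg

  lookup≡part : ∀ μ i → List.lookup μ i ≡ part μ (toℕ i)
  lookup≡part (x ∷ μ) Fin.zero    = ≡.refl
  lookup≡part (x ∷ μ) (Fin.suc i) = lookup≡part μ i

  -- The N - length μ empty rows contribute f 0 = 0. The offset o counts the rows already removed by
  -- the induction.
  ∑-parts : ∀ (f : ℕ → Carrier) → f 0 ≈ 0# → ∀ N μ o → List.length μ ℕ.≤ N →
    ∑[ i < N ] (f (part μ (toℕ i)) - fromℕ 2 * ((fromℕ (toℕ i) + o) * fromℕ (part μ (toℕ i))))
      ≈ finiteSum f μ - fromℕ 2 * (moment μ + o * norm μ)
  ∑-parts f f0≈0 N []      o len≤N = trans
    (∑-zero N _ (λ i → trans (+-congʳ f0≈0)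
      (solve 1 (λ x → con (+ 0) :- con (+ 2) :* (x :* con (+ 0)) := con (+ 0)) refl _)))
    (solve 1 (λ o → con (+ 0) := con (+ 0) :- con (+ 2) :* (con (+ 0) :+ o :* con (+ 0))) refl o)
  ∑-parts f f0≈0 (suc N) (x ∷ μ) o (ℕ.s≤s len≤N) = begin-equality
    f x - fromℕ 2 * ((0# + o) * k) + ∑[ i < N ] (f (part μ (toℕ i)) - fromℕ 2 * ((1# + fromℕ (toℕ i) + o) * fromℕ (part μ (toℕ i))))
      ≈⟨ +-congˡ (∑-cong N (λ i → +-congˡ (-‿cong (*-congˡ (*-congʳ
        (solve 2 (λ i o → con (+ 1) :+ i :+ o := i :+ (con (+ 1) :+ o)) refl _ o)))))) ⟩
    f x - fromℕ 2 * ((0# + o) * k) + ∑[ i < N ] (f (part μ (toℕ i)) - fromℕ 2 * ((fromℕ (toℕ i) + (1# + o)) * fromℕ (part μ (toℕ i))))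
      ≈⟨ +-congˡ (∑-parts f f0≈0 N μ (1# + o) len≤N) ⟩
    f x - fromℕ 2 * ((0# + o) * k) + (finiteSum f μ - fromℕ 2 * (moment μ + (1# + o) * norm μ))
      ≈⟨ solve 6 (λ fx o k s m K → fx :- con (+ 2) :* ((con (+ 0) :+ o) :* k) :+ (s :- con (+ 2) :* (m :+ (con (+ 1) :+ o) :* K)) :=
           fx :+ s :- con (+ 2) :* (K :+ m :+ o :* (k :+ K))) refl (f x) o k _ _ _ ⟩
    f x + finiteSum f μ - fromℕ 2 * (norm μ + moment μ + o * (k + norm μ)) ∎
    where k = fromℕ x

  content-row : ∀ α i k → fromℕ 2 * ∑[ j < k ] (α * fromℕ (toℕ j) - i) ≈ α * (fromℕ k * fromℕ k - fromℕ k) - fromℕ 2 * (i * fromℕ k)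
  content-row α i zero    = solve 2 (λ a i → con (+ 2) :* con (+ 0) :=
      a :* (con (+ 0) :* con (+ 0) :- con (+ 0)) :- con (+ 2) :* (i :* con (+ 0))) refl α i
  content-row α i (suc k) = begin-equality
    fromℕ 2 * ∑[ j ≤ k ] (α * fromℕ (toℕ j) - i)
      ≈⟨ *-congˡ (∑-last k (λ j → α * fromℕ j - i)) ⟩
    fromℕ 2 * (∑[ j < k ] (α * fromℕ (toℕ j) - i) + (α * fromℕ k - i))         ≈⟨ distribˡ _ _ _ ⟩
    fromℕ 2 * ∑[ j < k ] (α * fromℕ (toℕ j) - i) + fromℕ 2 * (α * fromℕ k - i) ≈⟨ +-congʳ (content-row α i k) ⟩
    α * (fromℕ k * fromℕ k - fromℕ k) - fromℕ 2 * (i * fromℕ k) + fromℕ 2 * (α * fromℕ k - i)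
      ≈⟨ solve 3 (λ a i k → a :* (k :* k :- k) :- con (+ 2) :* (i :* k) :+ con (+ 2) :* (a :* k :- i) :=
           a :* ((con (+ 1) :+ k) :* (con (+ 1) :+ k) :- (con (+ 1) :+ k)) :- con (+ 2) :* (i :* (con (+ 1) :+ k))) refl α i (fromℕ k) ⟩
    α * (fromℕ (suc k) * fromℕ (suc k) - fromℕ (suc k)) - fromℕ 2 * (i * fromℕ (suc k)) ∎

  -- Row i contributes α k (k - 1)/2 - i k for its length k; doubling avoids the half.
  2*content : ∀ α μ → fromℕ 2 * content α μ ≈ α * (squares μ - norm μ) - fromℕ 2 * moment μ
  2*content α μ = begin-equality
    fromℕ 2 * content α μ
      ≈⟨ *-distribˡ-sum {List.length μ} (fromℕ 2) _ ⟩
    ∑[ i < List.length μ ] (fromℕ 2 * ∑[ j < List.lookup μ i ] (α * fromℕ (toℕ j) - fromℕ (toℕ i)))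
      ≈⟨ ∑-cong (List.length μ) (λ i → trans (content-row α (fromℕ (toℕ i)) (List.lookup μ i)) (row i)) ⟩
    ∑[ i < List.length μ ] (f (part μ (toℕ i)) - fromℕ 2 * ((fromℕ (toℕ i) + 0#) * fromℕ (part μ (toℕ i))))
      ≈⟨ ∑-parts f
        (solve 1 (λ a → a :* (con (+ 0) :* con (+ 0) :- con (+ 0)) := con (+ 0)) refl α) (List.length μ) μ 0# ℕ.≤-refl ⟩
    finiteSum f μ - fromℕ 2 * (moment μ + 0# * norm μ)
      ≈⟨ +-cong (Σf μ) (-‿cong (*-congˡ (solve 2 (λ m K → m :+ con (+ 0) :* K := m) refl _ _))) ⟩
    α * (squares μ - norm μ) - fromℕ 2 * moment μ ∎
    where
    f : ℕ → Carrier
    f k = α * (fromℕ k * fromℕ k - fromℕ k)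
    row : ∀ i → f (List.lookup μ i) - fromℕ 2 * (fromℕ (toℕ i) * fromℕ (List.lookup μ i)) ≈
                f (part μ (toℕ i)) - fromℕ 2 * ((fromℕ (toℕ i) + 0#) * fromℕ (part μ (toℕ i)))
    row i rewrite lookup≡part μ i = +-congˡ (-‿cong (*-congˡ (*-congʳ (sym (+-identityʳ _)))))
    Σf : ∀ μ → finiteSum f μ ≈ α * (squares μ - norm μ)
    Σf []      = solve 1 (λ a → con (+ 0) := a :* (con (+ 0) :- con (+ 0))) refl α
    Σf (x ∷ μ) = trans (+-congˡ (Σf μ))
      (solve 4 (λ a k s K → a :* (k :* k :- k) :+ a :* (s :- K) := a :* (k :* k :+ s :- (k :+ K))) refl α (fromℕ x) _ _)

  -- (N + α - 1) κ at the signature encoded by a triple, where n = N - 1.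
  numerator : Carrier → Carrier → Index → Carrier
  numerator α n (m , μ , ν) = (1# + n) * (α * (M * M))
    + ((fromℕ 2 * content α μ + (fromℕ 2 * α * M + α + n) * norm μ)
    +  (fromℕ 2 * content α ν + (fromℕ 2 * α * - M + α + n) * norm ν))
    where M = fromℤ m

  module _ (a c : ℕ) where
    private
      N : ℕ
      N = suc (a ℕ.+ c)
      n : Carrier
      n = fromℕ (a ℕ.+ c)

    module _ (α : Carrier) (m : ℤ) (μ ν : List ℕ) (short : IsShort a c (m , μ , ν)) where
      private
        z : Index
        z = m , μ , ν
        M : Carrier
        M = fromℤ m
        -- `h s μ i` is the share of a part P in row i: α P², the cross term 2 α s P, and (n - 2i)
        -- P. For ν both the cross term and the coefficient change sign; in the opposite row j = n -
        -- i the latter is again n - 2j, so ν has the same form with s = -M.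
        f : Carrier → ℕ → Carrier
        f s k = α * (fromℕ k * fromℕ k) + (fromℕ 2 * α * s + n) * fromℕ k
        h : Carrier → List ℕ → ℕ → Carrier
        h s μ i = f s (part μ i) - fromℕ 2 * ((fromℕ i + 0#) * fromℕ (part μ i))
        λᵢ : ℕ → Carrier
        λᵢ i = fromℤ (entry z N i)

        ∑h : ∀ s μ → List.length μ ℕ.≤ N → ∑[ i < N ] h s μ (toℕ i) ≈ fromℕ 2 * content α μ + (fromℕ 2 * α * s + α + n) * norm μ
        ∑h s μ len = begin-equality
          ∑[ i < N ] h s μ (toℕ i)
            ≈⟨ ∑-parts (f s)
              (solve 2 (λ a b → a :* (con (+ 0) :* con (+ 0)) :+ b :* con (+ 0) := con (+ 0)) refl α _) N μ 0# len ⟩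
          finiteSum (f s) μ - fromℕ 2 * (moment μ + 0# * norm μ)
            ≈⟨ +-congʳ (Σf μ) ⟩
          α * squares μ + (fromℕ 2 * α * s + n) * norm μ - fromℕ 2 * (moment μ + 0# * norm μ)
            ≈⟨ solve 6 (λ a s n Q K I → a :* Q :+ (con (+ 2) :* a :* s :+ n) :* K :- con (+ 2) :* (I :+ con (+ 0) :* K) :=
                 a :* (Q :- K) :- con (+ 2) :* I :+ (con (+ 2) :* a :* s :+ a :+ n) :* K) refl α s n (squares μ) (norm μ) (moment μ) ⟩
          α * (squares μ - norm μ) - fromℕ 2 * moment μ + (fromℕ 2 * α * s + α + n) * norm μ
            ≈⟨ +-congʳ (2*content α μ) ⟨
          fromℕ 2 * content α μ + (fromℕ 2 * α * s + α + n) * norm μ ∎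
          where
          Σf : ∀ μ → finiteSum (f s) μ ≈ α * squares μ + (fromℕ 2 * α * s + n) * norm μ
          Σf []      = solve 2 (λ a b → con (+ 0) := a :* con (+ 0) :+ b :* con (+ 0)) refl α _
          Σf (x ∷ μ) = trans (+-congˡ (Σf μ)) (solve 5 (λ a b k Q K → a :* (k :* k) :+ b :* k :+ (a :* Q :+ b :* K) :=
            a :* (k :* k :+ Q) :+ b :* (k :+ K)) refl α _ (fromℕ x) _ _)

        entry-fromℤ : ∀ i → λᵢ i ≈ M + fromℕ (part μ i) - fromℕ (part ν (N ∸ suc i))
        entry-fromℤ i = trans (fromℤ-+ (m ℤ.+ + part μ i) _) (+-cong (fromℤ-+ m (+ part μ i)) (fromℤ-neg (+ part ν (N ∸ suc i))))

        part*part≈0 : ∀ i → fromℕ (part μ i) * fromℕ (part ν (N ∸ suc i)) ≈ 0#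
        part*part≈0 i with part*part≡0 a c {m} {μ} {ν} short i
        ... | inj₁ eq = trans (*-congʳ (reflexive (≡.cong fromℕ eq))) (zeroˡ _)
        ... | inj₂ eq = trans (*-congˡ (reflexive (≡.cong fromℕ eq))) (zeroʳ _)

        term : ∀ i → i ℕ.≤ a ℕ.+ c → α * λᵢ i ^ 2 + (fromℕ N + 1# - fromℕ 2 * fromℕ (suc i)) * λᵢ i ≈
          (α * (M * M) + M * (n - fromℕ 2 * fromℕ i)) + (h M μ i + h (- M) ν (N ∸ suc i))
        term i i≤ = begin-equality
          α * λᵢ i ^ 2 + (fromℕ N + 1# - fromℕ 2 * fromℕ (suc i)) * λᵢ i
            ≈⟨ +-cong (*-congˡ (^-congˡ 2 (entry-fromℤ i))) (*-cong (+-congʳ (+-congʳ (+-congˡ n≈I+J))) (entry-fromℤ i)) ⟩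
          α * (M + P - Q) ^ 2 + (1# + (I + J) + 1# - fromℕ 2 * (1# + I)) * (M + P - Q)
            ≈⟨ solve 6 (λ a M P Q I J → a :* (M :+ P :- Q) :^ 2 :+ (con (+ 1) :+ (I :+ J) :+ con (+ 1) :- con (+ 2) :* (con (+ 1) :+ I)) :* (M :+ P :- Q) :=
                 (a :* (M :* M) :+ M :* (I :+ J :- con (+ 2) :* I)) :+
                 ((a :* (P :* P) :+ (con (+ 2) :* a :* M :+ (I :+ J)) :* P :- con (+ 2) :* ((I :+ con (+ 0)) :* P)) :+
                  (a :* (Q :* Q) :+ (con (+ 2) :* a :* (:- M) :+ (I :+ J)) :* Q :- con (+ 2) :* ((J :+ con (+ 0)) :* Q)))
                 :- con (+ 2) :* a :* (P :* Q)) refl α M P Q I J ⟩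
          rhs (I + J) - fromℕ 2 * α * (P * Q)
            ≈⟨ +-congˡ (-‿cong (trans (*-congˡ (part*part≈0 i)) (zeroʳ _))) ⟩
          rhs (I + J) - 0#      ≈⟨ trans (+-congˡ -0#≈0#) (+-identityʳ _) ⟩
          rhs (I + J)           ≈⟨ rhs-cong (sym n≈I+J) ⟩
          rhs n                 ∎
          where
          P = fromℕ (part μ i)
          Q = fromℕ (part ν (N ∸ suc i))
          I = fromℕ i
          J = fromℕ (N ∸ suc i)
          n≈I+J : n ≈ I + J
          n≈I+J = trans (reflexive (≡.cong fromℕ (≡.sym (ℕ.m+[n∸m]≡n i≤)))) (fromℕ-+ i _)
          rhs : Carrier → Carrier
          rhs n = (α * (M * M) + M * (n - fromℕ 2 * I)) +
            ((α * (P * P) + (fromℕ 2 * α * M + n) * P - fromℕ 2 * ((I + 0#) * P)) +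
             (α * (Q * Q) + (fromℕ 2 * α * - M + n) * Q - fromℕ 2 * ((J + 0#) * Q)))
          rhs-cong : ∀ {n n′} → n ≈ n′ → rhs n ≈ rhs n′
          rhs-cong eq = +-cong (+-congˡ (*-congˡ (+-congʳ eq))) (+-cong (+-congʳ (+-congˡ (*-congʳ (+-congˡ eq)))) (+-congʳ (+-congˡ (*-congʳ (+-congˡ eq)))))

        len≤ : ∀ {l k} → l ℕ.≤ k → k ℕ.≤ a ℕ.+ c → l ℕ.≤ N
        len≤ l≤k k≤ = ℕ.≤-trans l≤k (ℕ.≤-trans k≤ (ℕ.n≤1+n _))

      κ-signature : κ α N (signature N z) ≈ (fromℕ N + α - 1#) ⁻¹ * numerator α n z
      κ-signature = *-congˡ (begin-equality
        α * ∑[ i < N ] (lookupᵢ i ^ 2) + ∑[ i < N ] (coeff i * lookupᵢ i)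
          ≈⟨ +-congʳ (*-distribˡ-sum {N} α (λ i → lookupᵢ i ^ 2)) ⟩
        ∑[ i < N ] (α * lookupᵢ i ^ 2) + ∑[ i < N ] (coeff i * lookupᵢ i)
          ≈⟨ ∑-distrib-+ {N} (λ i → α * lookupᵢ i ^ 2) (λ i → coeff i * lookupᵢ i) ⟨
        ∑[ i < N ] (α * lookupᵢ i ^ 2 + coeff i * lookupᵢ i)
          ≈⟨ ∑-cong N (λ i → trans (reflexive (≡.cong (λ k → α * fromℤ k ^ 2 + coeff i * fromℤ k) (Vec.lookup∘tabulate (λ k → entry z N (toℕ k)) i)))
                                   (term (toℕ i) (Fin.toℕ≤pred[n] i))) ⟩
        ∑[ i < N ] ((α * (M * M) + M * (n - fromℕ 2 * fromℕ (toℕ i))) + (h M μ (toℕ i) + h (- M) ν (N ∸ suc (toℕ i))))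
          ≈⟨ ∑-distrib-+ {N} (λ i → α * (M * M) + M * (n - fromℕ 2 * fromℕ (toℕ i))) hᵢ ⟩
        ∑[ i < N ] (α * (M * M) + M * (n - fromℕ 2 * fromℕ (toℕ i))) + ∑[ i < N ] (h M μ (toℕ i) + h (- M) ν (N ∸ suc (toℕ i)))
          ≈⟨ +-cong (trans (∑-distrib-+ {N} (λ _ → α * (M * M)) (λ i → M * (n - fromℕ 2 * fromℕ (toℕ i)))) (+-cong (∑-const N) middle))
               (trans (∑-distrib-+ {N} (λ i → h M μ (toℕ i)) (λ i → h (- M) ν (N ∸ suc (toℕ i))))
                 (+-cong (∑h M μ (len≤ (proj₁ short) (ℕ.m≤m+n a c)))
                   (trans (∑-reverse N (h (- M) ν)) (∑h (- M) ν (len≤ (proj₂ short) (ℕ.m≤n+m c a)))))) ⟩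
        fromℕ N * (α * (M * M)) + 0# + _  ≈⟨ +-congʳ (+-identityʳ _) ⟩
        numerator α n z                   ∎)
        where
        lookupᵢ : Fin N → Carrier
        lookupᵢ i = fromℤ (Vec.lookup (signature N z) i)
        coeff : Fin N → Carrier
        coeff i = fromℕ N + 1# - fromℕ 2 * fromℕ (suc (toℕ i))
        hᵢ : Fin N → Carrier
        hᵢ i = h M μ (toℕ i) + h (- M) ν (N ∸ suc (toℕ i))
        ∑-const : ∀ k → ∑[ i < k ] (α * (M * M)) ≈ fromℕ k * (α * (M * M))
        ∑-const zero    = sym (zeroˡ _)
        ∑-const (suc k) = trans (+-cong (sym (*-identityˡ _)) (∑-const k)) (sym (distribʳ _ 1# _))
        middle : ∑[ i < N ] (M * (n - fromℕ 2 * fromℕ (toℕ i))) ≈ 0#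
        middle = trans (sym (*-distribˡ-sum {N} M (λ i → n - fromℕ 2 * fromℕ (toℕ i)))) (trans (*-congˡ (∑-arithmetic N n))
          (solve 2 (λ M n → M :* ((con (+ 1) :+ n) :* (n :+ con (+ 1) :- (con (+ 1) :+ n))) := con (+ 0)) refl M n))

  -- Bounds for the exponents

  squares-nonNeg : ∀ μ → 0# ≤ squares μ
  squares-nonNeg μ = Σ-nonNeg μ (λ k → x*x-nonNeg (fromℕ k))

  moment-nonNeg : ∀ μ → 0# ≤ moment μ
  moment-nonNeg []      = ≤-refl
  moment-nonNeg (x ∷ μ) = +-nonNeg (norm-nonNeg μ) (moment-nonNeg μ)

  k≤k*k : ∀ k → fromℕ k ≤ fromℕ k * fromℕ k
  k≤k*k zero    = ≤-reflexive (sym (zeroˡ 0#))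
  k≤k*k (suc k) = ≤-by (*-nonNeg (fromℕ-nonNeg k) (fromℕ-nonNeg (suc k)))
    (solve 1 (λ k → (con (+ 1) :+ k) :* (con (+ 1) :+ k) := con (+ 1) :+ k :+ k :* (con (+ 1) :+ k)) refl (fromℕ k))

  norm≤squares : ∀ μ → norm μ ≤ squares μ
  norm≤squares μ = Σ-mono μ (λ k _ → k≤k*k k)

  squares≤norm*norm : ∀ μ → squares μ ≤ norm μ * norm μ
  squares≤norm*norm []      = ≤-reflexive (sym (zeroˡ 0#))
  squares≤norm*norm (x ∷ μ) = ≤-by (+-nonNeg (x≤y⇒0≤y-x (squares≤norm*norm μ)) (*-nonNeg (fromℕ-nonNeg 2) (*-nonNeg (fromℕ-nonNeg x) (norm-nonNeg μ))))
    (solve 3 (λ x K Q → (x :+ K) :* (x :+ K) :=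
        x :* x :+ Q :+ (K :* K :- Q :+ con (+ 2) :* (x :* K))) refl (fromℕ x) (norm μ) (squares μ))

  norm≤length*first : ∀ {x} μ → All (ℕ._≤ x) μ → norm μ ≤ fromℕ (List.length μ) * fromℕ x
  norm≤length*first []      _          = ≤-reflexive (sym (zeroˡ _))
  norm≤length*first (y ∷ μ) (y≤x ∷ ≤x) = ≤-trans (+-mono-≤ (fromℕ-mono-≤ y≤x) (norm≤length*first μ ≤x))
    (≤-reflexive (solve 2 (λ x l → x :+ l :* x := (con (+ 1) :+ l) :* x) refl _ _))

  -- Chebyshev's sum inequality for the decreasing parts and the increasing row numbers 0, ..., l -
  -- 1, whose mean is (l - 1)/2. In the induction the first part exceeds the mean of the others.
  2*moment≤ : ∀ μ → Linked ℕ._≥_ μ → fromℕ 2 * moment μ + norm μ ≤ fromℕ (List.length μ) * norm μ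
  2*moment≤ []      _ = ≤-reflexive (solve 0 (con (+ 2) :* con (+ 0) :+ con (+ 0) := con (+ 0) :* con (+ 0)) refl)
  2*moment≤ (x ∷ μ) d with Linked⇒AllPairs (λ x≥y y≥z → ℕ.≤-trans y≥z x≥y) d
  ... | x≥μ ∷ _ = ≤-by (+-nonNeg (x≤y⇒0≤y-x (2*moment≤ μ (Linked.tail d))) (x≤y⇒0≤y-x (norm≤length*first μ x≥μ)))
    (solve 4 (λ x l K I → (con (+ 1) :+ l) :* (x :+ K) := con (+ 2) :* (K :+ I) :+ (x :+ K) :+
      (l :* K :- (con (+ 2) :* I :+ K) :+ (l :* x :- K))) refl (fromℕ x) (fromℕ (List.length μ)) (norm μ) (moment μ))

  -- The expansion of ∑ (y - μ_i)². It controls the negative cross term in κ between the shift and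
  -- one of the partitions.
  Σ[y-μ]²-nonNeg : ∀ y μ → 0# ≤ fromℕ (List.length μ) * (y * y) - fromℕ 2 * y * norm μ + squares μ
  Σ[y-μ]²-nonNeg y []      = ≤-reflexive
    (solve 1 (λ y → con (+ 0) := con (+ 0) :* (y :* y) :- con (+ 2) :* y :* con (+ 0) :+ con (+ 0)) refl y)
  Σ[y-μ]²-nonNeg y (x ∷ μ) = ≤-trans (+-nonNeg (x*x-nonNeg (y - fromℕ x)) (Σ[y-μ]²-nonNeg y μ))
    (≤-reflexive (solve 5 (λ y x l K Q → (y :- x) :* (y :- x) :+ (l :* (y :* y) :- con (+ 2) :* y :* K :+ Q) :=
      (con (+ 1) :+ l) :* (y :* y) :- con (+ 2) :* y :* (x :+ K) :+ (x :* x :+ Q)) refl y (fromℕ x) (fromℕ (List.length μ)) (norm μ) (squares μ)))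

  fromℤ-square : ∀ m → fromℕ (ℤ.∣ m ∣ ℕ.* ℤ.∣ m ∣) ≈ fromℤ m * fromℤ m
  fromℤ-square (+ k)    = fromℕ-* k k
  fromℤ-square -[1+ k ] = trans (fromℕ-* (suc k) (suc k)) (solve 1 (λ x → x :* x := (:- x) :* (:- x)) refl _)

  ∣fromℤ∣ : ∀ m → ∣ fromℤ m ∣ ≈ fromℕ ℤ.∣ m ∣
  ∣fromℤ∣ (+ k)    = 0≤x⇒∣x∣≈x (fromℕ-nonNeg k)
  ∣fromℤ∣ -[1+ k ] = trans (∣-x∣≈∣x∣ _) (0≤x⇒∣x∣≈x (fromℕ-nonNeg (suc k)))

  fromℕ-size : ∀ m μ ν → fromℕ (size (m , μ , ν)) ≈ fromℤ m * fromℤ m + (norm μ + norm ν)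
  fromℕ-size m μ ν = trans (fromℕ-+ (ℤ.∣ m ∣ ℕ.* ℤ.∣ m ∣) (ℕ.sum μ ℕ.+ ℕ.sum ν)) (+-cong (fromℤ-square m) (trans (fromℕ-+ (ℕ.sum μ) (ℕ.sum ν)) (+-cong (fromℕ-sum μ) (fromℕ-sum ν))))

  module _ (a c : ℕ) (2a≤N : 2 ℕ.* a ℕ.≤ suc (a ℕ.+ c)) (2c≤N : 2 ℕ.* c ℕ.≤ suc (a ℕ.+ c)) where
    private
      n : Carrier
      n = fromℕ (a ℕ.+ c)

      cast : ∀ {d} → 2 ℕ.* d ℕ.≤ suc (a ℕ.+ c) → 0# ≤ (1# + n) - fromℕ 2 * fromℕ d
      cast {d} h = x≤y⇒0≤y-x (≤-trans (≤-reflexive (sym (fromℕ-* 2 d))) (fromℕ-mono-≤ h))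

      -- By Chebyshev n |μ| - 2 ∑ i μ_i is at least (N - d) |μ|, hence at least half of N |μ|.
      linear : ∀ d μ → 2 ℕ.* d ℕ.≤ suc (a ℕ.+ c) → Linked ℕ._≥_ μ → List.length μ ℕ.≤ d →
               0# ≤ fromℕ 2 * (n * norm μ - fromℕ 2 * moment μ) - (1# + n) * norm μ
      linear d μ h dec len = ≤-trans
        (+-nonNeg (*-nonNeg (cast {d} h) (norm-nonNeg μ)) (*-nonNeg (fromℕ-nonNeg 2)
          (x≤y⇒0≤y-x (≤-trans (2*moment≤ μ dec) (*-monoˡ-≤ (norm-nonNeg μ) (fromℕ-mono-≤ len))))))
        (≤-reflexive
          (solve 4 (λ n d K I → ((con (+ 1) :+ n) :- con (+ 2) :* d) :* K :+ con (+ 2) :* (d :* K :- (con (+ 2) :* I :+ K)) :=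
          con (+ 2) :* (n :* K :- con (+ 2) :* I) :- (con (+ 1) :+ n) :* K) refl n (fromℕ d) (norm μ) (moment μ)))

      -- For y ≥ 0 only -2 y |ν| is negative; together with ∑ ν_i² it is at least -d y², which costs
      -- at most half of N y².
      one-sided : ∀ d y μ ν → 2 ℕ.* d ℕ.≤ suc (a ℕ.+ c) → List.length ν ℕ.≤ d → 0# ≤ y →
        0# ≤ fromℕ 2 * ((1# + n) * (y * y) + fromℕ 2 * y * (norm μ - norm ν) + squares μ + squares ν) - (1# + n) * (y * y)
      one-sided d y μ ν h len 0≤y = ≤-trans
        (+-nonNeg (*-nonNeg (cast {d} h) 0≤y²) (*-nonNeg (fromℕ-nonNeg 2)
          (+-nonNeg (+-nonNeg (*-nonNeg (*-nonNeg (fromℕ-nonNeg 2) 0≤y) (norm-nonNeg μ)) (squares-nonNeg μ))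
            (+-nonNeg (Σ[y-μ]²-nonNeg y ν) (*-nonNeg (x≤y⇒0≤y-x (fromℕ-mono-≤ len)) 0≤y²)))))
        (≤-reflexive (solve 8 (λ n d l y K L Q T →
          ((con (+ 1) :+ n) :- con (+ 2) :* d) :* (y :* y) :+ con (+ 2) :* (con (+ 2) :* y :* K :+ Q :+
            (l :* (y :* y) :- con (+ 2) :* y :* L :+ T :+ (d :- l) :* (y :* y))) :=
          con (+ 2) :* ((con (+ 1) :+ n) :* (y :* y) :+ con (+ 2) :* y :* (K :- L) :+ Q :+ T) :- (con (+ 1) :+ n) :* (y :* y))
          refl n (fromℕ d) (fromℕ (List.length ν)) y (norm μ) (norm ν) (squares μ) (squares ν)))
        where 0≤y² = x*x-nonNeg y

    -- The terms α |μ| and α |ν| cancel against those in twice the contents. What remains is α times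
    -- a quadratic form, bounded by `one-sided` and α ≥ 1, and a linear part for each partition,
    -- bounded by `linear`; each keeps half of its share of N S. The sign of M decides whether the
    -- rows of ν or those of μ have to absorb the cross term.
    numerator-lower : ∀ {α} z → 1# ≤ α → IsIndex z → IsShort a c z →
                      fromℕ (suc (a ℕ.+ c)) * fromℕ (size z) ≤ fromℕ 2 * numerator α n z
    numerator-lower {α} z@(m , μ , ν) 1≤α (_ , pμ , pν) (lμ , lν) = ≤-trans
      (≤-reflexive (*-congˡ (fromℕ-size m μ ν)))
      (≤-by (+-nonNeg (+-nonNeg (*-nonNeg (≤-trans 0≤1 1≤α) quadratic) (*-nonNeg (x≤y⇒0≤y-x 1≤α) (*-nonNeg (fromℕ-nonNeg (suc (a ℕ.+ c))) (x*x-nonNeg M))))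
                      (+-nonNeg (linear a μ 2a≤N (proj₁ pμ) lμ) (linear c ν 2c≤N (proj₁ pν) lν)))
        (trans (*-congˡ (+-congˡ (+-cong (+-congʳ (2*content α μ)) (+-congʳ (2*content α ν)))))
          (solve 9 (λ a n M K L Q T I J →
            con (+ 2) :* ((con (+ 1) :+ n) :* (a :* (M :* M)) :+
              ((a :* (Q :- K) :- con (+ 2) :* I :+ (con (+ 2) :* a :* M :+ a :+ n) :* K) :+
               (a :* (T :- L) :- con (+ 2) :* J :+ (con (+ 2) :* a :* (:- M) :+ a :+ n) :* L))) :=
            (con (+ 1) :+ n) :* (M :* M :+ (K :+ L)) :+
            ((a :* (con (+ 2) :* ((con (+ 1) :+ n) :* (M :* M) :+ con (+ 2) :* M :* (K :- L) :+ Q :+ T) :- (con (+ 1) :+ n) :* (M :* M)) :+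
              (a :- con (+ 1)) :* ((con (+ 1) :+ n) :* (M :* M))) :+
             (con (+ 2) :* (n :* K :- con (+ 2) :* I) :- (con (+ 1) :+ n) :* K :+
              (con (+ 2) :* (n :* L :- con (+ 2) :* J) :- (con (+ 1) :+ n) :* L))))
            refl α n M (norm μ) (norm ν) (squares μ) (squares ν) (moment μ) (moment ν))))
      where
      M = fromℤ m
      quadratic : 0# ≤ fromℕ 2 * ((1# + n) * (M * M) + fromℕ 2 * M * (norm μ - norm ν) + squares μ + squares ν) - (1# + n) * (M * M)
      quadratic with total 0# M
      ... | inj₁ 0≤M = one-sided c M μ ν 2c≤N lν 0≤M
      ... | inj₂ M≤0 = ≤-trans (one-sided a (- M) ν μ 2a≤N lμ (neg-nonNeg M≤0))
        (≤-reflexive (solve 6 (λ n M K L Q T →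
          con (+ 2) :* ((con (+ 1) :+ n) :* ((:- M) :* (:- M)) :+ con (+ 2) :* (:- M) :* (L :- K) :+ T :+ Q) :- (con (+ 1) :+ n) :* ((:- M) :* (:- M)) :=
          con (+ 2) :* ((con (+ 1) :+ n) :* (M :* M) :+ con (+ 2) :* M :* (K :- L) :+ Q :+ T) :- (con (+ 1) :+ n) :* (M :* M))
          refl n M (norm μ) (norm ν) (squares μ) (squares ν)))

  -- Both ∑ μ_i² and 2 ∑ i μ_i are at most |μ|², the latter by Chebyshev and length μ ≤ |μ|. The
  -- formula is for twice the content, and the spare factor 2 is given away.
  ∣content∣≤ : ∀ {α} μ → 0# ≤ α → IsPartition μ → ∣ content α μ ∣ ≤ (α + 1#) * (norm μ * norm μ)
  ∣content∣≤ {α} μ 0≤α (dec , 0<μ) = ≤-trans (≤-by (∣x∣-nonNeg C)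
    (solve 1 (λ x → con (+ 2) :* x := x :+ x) refl ∣ C ∣)) (begin
    fromℕ 2 * ∣ C ∣                                   ≈⟨ trans (∣∣-* _ _) (*-congʳ (0≤x⇒∣x∣≈x (fromℕ-nonNeg 2))) ⟨
    ∣ fromℕ 2 * C ∣                                   ≈⟨ ∣∣-cong (2*content α μ) ⟩
    ∣ α * (squares μ - norm μ) - fromℕ 2 * moment μ ∣ ≤⟨ ∣∣-triangle _ _ ⟩
    ∣ α * (squares μ - norm μ) ∣ + ∣ - (fromℕ 2 * moment μ) ∣
      ≈⟨ +-cong (0≤x⇒∣x∣≈x (*-nonNeg 0≤α (x≤y⇒0≤y-x (norm≤squares μ))))
                (trans (∣-x∣≈∣x∣ _) (0≤x⇒∣x∣≈x (*-nonNeg (fromℕ-nonNeg 2) (moment-nonNeg μ)))) ⟩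
    α * (squares μ - norm μ) + fromℕ 2 * moment μ
      ≤⟨ +-mono-≤ (*-monoʳ-≤ 0≤α (≤-by (+-nonNeg (x≤y⇒0≤y-x (squares≤norm*norm μ)) (norm-nonNeg μ))
                    (solve 3 (λ K Q P → P := Q :- K :+ (P :- Q :+ K)) refl (norm μ) (squares μ) K²))) 2I≤K² ⟩
    α * K² + K²                                       ≈⟨ solve 2 (λ a K → a :* K :+ K := (a :+ con (+ 1)) :* K) refl α K² ⟩
    (α + 1#) * K²                                     ∎)
    where
    C = content α μ
    K² = norm μ * norm μ
    2I≤K² : fromℕ 2 * moment μ ≤ K²
    2I≤K² = ≤-trans (≤-by (norm-nonNeg μ) refl) (≤-trans (2*moment≤ μ dec)
      (*-monoˡ-≤ (norm-nonNeg μ) (≤-trans (fromℕ-mono-≤ (length≤sum 0<μ)) (≤-reflexive (fromℕ-sum μ)))))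

  -- The coefficient of x with which one partition enters the exponent in ℋ_b(q e^{vx}; -tx); the
  -- two chiralities have v = -α t m and v = α t m.
  chiralExponent : (b t v : Carrier) → List ℕ → Carrier
  chiralExponent b t v μ = v * fromℕ (ℕ.sum μ) + - t * content (1# + b) μ

  -- The coefficient of x = 1/(N+b) in the exponent of the heat trace term indexed by (m , μ , ν).
  exponent : (b t : Carrier) → Index → Carrier
  exponent b t (m , μ , ν) = ½ * b * (1# + b) * t * fromℤ m ^ 2
    + (chiralExponent b t (- ((1# + b) * t * fromℤ m)) μ + chiralExponent b t ((1# + b) * t * fromℤ m) ν)

  -- The m² term contributes t α b, with its factor ½ dropped; each partition contributes t α from
  -- the shift and t (α + 1) from the content.
  exponentConstant : (b t : Carrier) → Carrier
  exponentConstant b t = t * ((1# + b) * b + fromℕ 4 * (1# + b) + fromℕ 2)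

  exponentConstant-nonNeg : ∀ {b t} → 0# ≤ b → 0# ≤ t → 0# ≤ exponentConstant b t
  exponentConstant-nonNeg 0≤b 0≤t = *-nonNeg 0≤t (+-nonNeg (+-nonNeg (*-nonNeg (+-nonNeg 0≤1 0≤b) 0≤b)
    (*-nonNeg (fromℕ-nonNeg 4) (+-nonNeg 0≤1 0≤b))) (fromℕ-nonNeg 2))

  ∣exponent∣≤ : ∀ {b t} z → 0# ≤ b → 0# ≤ t → IsIndex z →
                ∣ exponent b t z ∣ ≤ exponentConstant b t * (1# + fromℕ (size z)) ^ 2
  ∣exponent∣≤ {b} {t} z@(m , μ , ν) 0≤b 0≤t (_ , pμ , pν) = begin
    ∣ exponent b t z ∣
      ≤⟨ ≤-trans (∣∣-triangle _ _) (+-mono-≤ constant (≤-trans (∣∣-triangle _ _)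
           (+-mono-≤ (chiral (- (α * t * M)) μ (∣-x∣≈∣x∣ _) K≤S pμ) (chiral (α * t * M) ν refl L≤S pν)))) ⟩
    b * α * t * P + (α * t * P + t * ((α + 1#) * P) + (α * t * P + t * ((α + 1#) * P)))
      ≈⟨ solve 3 (λ b t P → b :* (con (+ 1) :+ b) :* t :* P :+ ((con (+ 1) :+ b) :* t :* P :+ t :* ((con (+ 1) :+ b :+ con (+ 1)) :* P) :+
           ((con (+ 1) :+ b) :* t :* P :+ t :* ((con (+ 1) :+ b :+ con (+ 1)) :* P))) :=
           t :* ((con (+ 1) :+ b) :* b :+ con (+ 4) :* (con (+ 1) :+ b) :+ con (+ 2)) :* P) refl b t P ⟩
    exponentConstant b t * P ∎
    where
    α = 1# + b
    M = fromℤ m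
    S = fromℕ (size z)
    P = (1# + S) ^ 2
    0≤α = +-nonNeg 0≤1 0≤b
    0≤S : 0# ≤ S
    0≤S = fromℕ-nonNeg (size z)
    S*S≤P : S * S ≤ P
    S*S≤P = ≤-by (+-nonNeg 0≤1 (*-nonNeg (fromℕ-nonNeg 2) 0≤S))
      (solve 1 (λ S → (con (+ 1) :+ S) :^ 2 := S :* S :+ (con (+ 1) :+ con (+ 2) :* S)) refl S)
    S≤P : S ≤ P
    S≤P = ≤-trans (k≤k*k (size z)) S*S≤P
    M²≤S : M * M ≤ S
    M²≤S = ≤-trans (≤-by (+-nonNeg (norm-nonNeg μ) (norm-nonNeg ν)) refl) (≤-reflexive (sym (fromℕ-size m μ ν)))
    ∣M∣≤S : ∣ M ∣ ≤ S
    ∣M∣≤S = ≤-trans (≤-trans (≤-reflexive (∣fromℤ∣ m)) (≤-trans (k≤k*k ℤ.∣ m ∣)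
      (≤-reflexive (trans (sym (fromℕ-* ℤ.∣ m ∣ ℤ.∣ m ∣)) (fromℤ-square m))))) M²≤S
    K≤S : norm μ ≤ S
    K≤S = ≤-trans (≤-by (+-nonNeg (x*x-nonNeg M) (norm-nonNeg ν))
      (solve 3 (λ m K L → m :+ (K :+ L) := K :+ (m :+ L)) refl _ _ _)) (≤-reflexive (sym (fromℕ-size m μ ν)))
    L≤S : norm ν ≤ S
    L≤S = ≤-trans (≤-by (+-nonNeg (x*x-nonNeg M) (norm-nonNeg μ))
      (solve 3 (λ m K L → m :+ (K :+ L) := L :+ (m :+ K)) refl _ _ _)) (≤-reflexive (sym (fromℕ-size m μ ν)))
    0≤bαt : 0# ≤ b * α * t
    0≤bαt = *-nonNeg (*-nonNeg 0≤b 0≤α) 0≤t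
    constant : ∣ ½ * b * α * t * M ^ 2 ∣ ≤ b * α * t * P
    constant = begin
      ∣ ½ * b * α * t * M ^ 2 ∣
        ≈⟨ ∣∣-cong (solve 5 (λ h b a t M → h :* b :* a :* t :* M :^ 2 := b :* a :* t :* (h :* (M :* M))) refl ½ b α t M) ⟩
      ∣ b * α * t * (½ * (M * M)) ∣  ≈⟨ 0≤x⇒∣x∣≈x (*-nonNeg 0≤bαt (*-nonNeg (<⇒≤ 0<½) (x*x-nonNeg M))) ⟩
      b * α * t * (½ * (M * M))
        ≤⟨ *-monoʳ-≤ 0≤bαt (≤-trans (*-monoˡ-≤ (x*x-nonNeg M) (<⇒≤ ½<1)) (≤-trans (≤-reflexive (*-identityˡ _)) (≤-trans M²≤S S≤P))) ⟩
      b * α * t * P                  ∎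
    chiral : ∀ v λs → ∣ v ∣ ≈ ∣ α * t * M ∣ → norm λs ≤ S → IsPartition λs → ∣ chiralExponent b t v λs ∣ ≤ α * t * P + t * ((α + 1#) * P)
    chiral v λs ∣v∣≈ K≤S pλ = begin
      ∣ chiralExponent b t v λs ∣
        ≤⟨ ∣∣-triangle _ _ ⟩
      ∣ v * fromℕ (ℕ.sum λs) ∣ + ∣ - t * content α λs ∣
        ≈⟨ +-cong (∣∣-* _ _) (∣∣-* _ _) ⟩
      ∣ v ∣ * ∣ fromℕ (ℕ.sum λs) ∣ + ∣ - t ∣ * ∣ content α λs ∣
        ≈⟨ +-cong (*-cong (trans ∣v∣≈ (trans (∣∣-* _ _) (*-congʳ (0≤x⇒∣x∣≈x (*-nonNeg 0≤α 0≤t)))))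
             (trans (0≤x⇒∣x∣≈x (fromℕ-nonNeg (ℕ.sum λs))) (fromℕ-sum λs))) (*-congʳ (trans (∣-x∣≈∣x∣ t) (0≤x⇒∣x∣≈x 0≤t))) ⟩
      α * t * ∣ M ∣ * norm λs + t * ∣ content α λs ∣
        ≤⟨ +-mono-≤ (≤-trans (≤-reflexive (*-assoc _ _ _)) (*-monoʳ-≤ (*-nonNeg 0≤α 0≤t) (≤-trans (*-mono-≤ (∣x∣-nonNeg M) ∣M∣≤S (norm-nonNeg λs) K≤S) S*S≤P)))
             (*-monoʳ-≤ 0≤t (≤-trans (∣content∣≤ λs 0≤α pλ) (*-monoʳ-≤ (+-nonNeg 0≤α 0≤1) (≤-trans (*-mono-≤ (norm-nonNeg λs) K≤S (norm-nonNeg λs) K≤S) S*S≤P)))) ⟩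
      α * t * P + t * ((α + 1#) * P) ∎

  -- The heat trace term by term

  boltzmann : (b t : Carrier) → Index → Carrier
  boltzmann b t (m , μ , ν) = gaussian (1# + b) t m * (exp (- (t * ½)) ^ ℕ.sum μ * exp (- (t * ½)) ^ ℕ.sum ν)

  boltzmannExponent : (b t : Carrier) → Index → Carrier
  boltzmannExponent b t (m , μ , ν) = - (t * ½ * (1# + b) * fromℤ m ^ 2)
    + (fromℕ (ℕ.sum μ) * - (t * ½) + fromℕ (ℕ.sum ν) * - (t * ½))

  boltzmann≈exp : ∀ b t z → boltzmann b t z ≈ exp (boltzmannExponent b t z)
  boltzmann≈exp b t (m , μ , ν) = sym (trans (exp-+ _ _) (*-congˡ (trans (exp-+ _ _)
    (*-cong (exp-fromℕ* (ℕ.sum μ) _) (exp-fromℕ* (ℕ.sum ν) _)))))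

  boltzmann-nonNeg : ∀ b t z → 0# ≤ boltzmann b t z
  boltzmann-nonNeg b t z = ≤-trans (exp-nonNeg _) (≤-reflexive (sym (boltzmann≈exp b t z)))

  heatTrace-term : ∀ a c {b t} z → 0# ≤ b → IsShort a c z → let N = suc (a ℕ.+ c) in
    exp (- (t * ½ * κ (1# + b) N (signature N z))) ≈ boltzmann b t z * exp ((fromℕ N + b) ⁻¹ * exponent b t z)
  heatTrace-term a c {b} {t} z@(m , μ , ν) 0≤b short = begin-equality
    exp (- (t * ½ * κ α N (signature N z)))              ≈⟨ exp-cong exponents ⟩
    exp (boltzmannExponent b t z + x * exponent b t z)   ≈⟨ exp-+ _ _ ⟩
    exp (boltzmannExponent b t z) * exp (x * exponent b t z) ≈⟨ *-congʳ (boltzmann≈exp b t z) ⟨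
    boltzmann b t z * exp (x * exponent b t z)           ∎
    where
    N = suc (a ℕ.+ c)
    n = fromℕ (a ℕ.+ c)
    α = 1# + b
    x = (fromℕ N + b) ⁻¹
    M = fromℤ m
    K = fromℕ (ℕ.sum μ)
    L = fromℕ (ℕ.sum ν)
    C = content α μ
    D = content α ν
    0<N+b : 0# < fromℕ N + b
    0<N+b = +-pos-nonNeg (fromℕ-pos N) 0≤b
    main = boltzmannExponent b t z + x * exponent b t z
    exponents : - (t * ½ * κ α N (signature N z)) ≈ main
    exponents = begin-equality
      - (t * ½ * κ α N (signature N z))
        ≈⟨ -‿cong (*-congˡ (trans (κ-signature a c α m μ ν short) (*-cong
             (⁻¹-cong (solve 2 (λ n b → con (+ 1) :+ n :+ (con (+ 1) :+ b) :- con (+ 1) := con (+ 1) :+ n :+ b) refl n b))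
             (+-congˡ (+-cong (+-congˡ (*-congˡ (sym (fromℕ-sum μ)))) (+-congˡ (*-congˡ (sym (fromℕ-sum ν))))))))) ⟩
      - (t * ½ * (x * ((1# + n) * (α * (M * M)) + ((fromℕ 2 * C + (fromℕ 2 * α * M + α + n) * K) + (fromℕ 2 * D + (fromℕ 2 * α * - M + α + n) * L)))))
        -- The solver treats x and ½ as free variables. The identity becomes polynomial after adding
        -- multiples of 1 - (N + b) x and 1 - 2 ½, which vanish in the next step.
        ≈⟨ solve 10 (λ t h x n b M K L C D →
             :- (t :* h :* (x :* ((con (+ 1) :+ n) :* ((con (+ 1) :+ b) :* (M :* M)) :+ ((con (+ 2) :* C :+ (con (+ 2) :* (con (+ 1) :+ b) :* M :+ (con (+ 1) :+ b) :+ n) :* K)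
               :+ (con (+ 2) :* D :+ (con (+ 2) :* (con (+ 1) :+ b) :* (:- M) :+ (con (+ 1) :+ b) :+ n) :* L))))) :=
             (:- (t :* h :* (con (+ 1) :+ b) :* M :^ 2) :+ (K :* (:- (t :* h)) :+ L :* (:- (t :* h)))
               :+ x :* (h :* b :* (con (+ 1) :+ b) :* t :* M :^ 2 :+ (((:- ((con (+ 1) :+ b) :* t :* M)) :* K :+ (:- t) :* C) :+ ((con (+ 1) :+ b) :* t :* M :* L :+ (:- t) :* D))))
             :+ ((con (+ 1) :- (con (+ 1) :+ n :+ b) :* x) :* (t :* h :* (con (+ 1) :+ b) :* (M :* M) :+ t :* h :* (K :+ L))
               :+ (con (+ 1) :- con (+ 2) :* h) :* (x :* t :* (C :+ D :+ (con (+ 1) :+ b) :* M :* (K :- L)))))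
             refl t ½ x n b M K L C D ⟩
      main + ((1# - (fromℕ N + b) * x) * (t * ½ * α * (M * M) + t * ½ * (K + L)) + (1# - fromℕ 2 * ½) * (x * t * (C + D + α * M * (K - L))))
        ≈⟨ +-congˡ (+-cong (vanish (⁻¹-inverseʳ (<⇒≉0 0<N+b))) (vanish 2*½≈1)) ⟩
      main + (0# + 0#) ≈⟨ trans (+-congˡ (+-identityʳ 0#)) (+-identityʳ main) ⟩
      main ∎
      where
      vanish : ∀ {u w} → u ≈ 1# → (1# - u) * w ≈ 0#
      vanish u≈1 = trans (*-congʳ (trans (+-congˡ (-‿cong u≈1)) (-‿inverseʳ 1#))) (zeroˡ _)

  -- The rate t/8: one half comes from the factor t/2 of κ, one from `numerator-lower`, and one from
  -- x ≥ 1/(2N), which uses b ≤ N.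
  decay : Carrier → Carrier
  decay t = ½ * (½ * (½ * t))

  decay-pos : ∀ {t} → 0# < t → 0# < decay t
  decay-pos 0<t = *-pos 0<½ (*-pos 0<½ (*-pos 0<½ 0<t))

  ½*x≤x : ∀ {x} → 0# ≤ x → ½ * x ≤ x
  ½*x≤x 0≤x = ≤-trans (*-monoˡ-≤ 0≤x (<⇒≤ ½<1)) (≤-reflexive (*-identityˡ _))

  boltzmann≤ : ∀ {b t t₀} z → 0# ≤ b → 0# ≤ t₀ → t₀ ≤ t → boltzmann b t z ≤ exp (- (decay t₀ * fromℕ (size z)))
  boltzmann≤ {b} {t} {t₀} z@(m , μ , ν) 0≤b 0≤t₀ t₀≤t = ≤-trans (≤-reflexive (boltzmann≈exp b t z)) (exp-mono-≤
    (≤-trans (≤-by (*-nonNeg (*-nonNeg (*-nonNeg 0≤t (<⇒≤ 0<½)) 0≤b) (x*x-nonNeg M))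
        (trans (-‿cong (*-congˡ (fromℕ-size m μ ν)))
          (trans (solve 6 (λ t h b M K L → :- (t :* h :* (M :* M :+ (K :+ L))) :=
            :- (t :* h :* (con (+ 1) :+ b) :* M :^ 2) :+ (K :* (:- (t :* h)) :+ L :* (:- (t :* h))) :+ t :* h :* b :* (M :* M)) refl t ½ b M _ _)
            (+-congʳ (+-congˡ (+-cong (*-congʳ (sym (fromℕ-sum μ))) (*-congʳ (sym (fromℕ-sum ν)))))))))
      (neg-mono-≤ (*-monoˡ-≤ (fromℕ-nonNeg (size z)) decay≤))))
    where
    M = fromℤ m
    0≤t = ≤-trans 0≤t₀ t₀≤t
    0≤½t₀ = *-nonNeg (<⇒≤ 0<½) 0≤t₀
    decay≤ : decay t₀ ≤ t * ½
    decay≤ = ≤-trans (½*x≤x (*-nonNeg (<⇒≤ 0<½) 0≤½t₀)) (≤-trans (½*x≤x 0≤½t₀)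
      (≤-trans (*-monoʳ-≤ (<⇒≤ 0<½) t₀≤t) (≤-reflexive (*-comm ½ t))))

  heatTrace-term≤ : ∀ a c {b t t₀} z → 2 ℕ.* a ℕ.≤ suc (a ℕ.+ c) → 2 ℕ.* c ℕ.≤ suc (a ℕ.+ c) →
    0# ≤ b → b ≤ fromℕ (suc (a ℕ.+ c)) → 0# ≤ t₀ → t₀ ≤ t → IsIndex z → IsShort a c z →
    boltzmann b t z * exp ((fromℕ (suc (a ℕ.+ c)) + b) ⁻¹ * exponent b t z) ≤ exp (- (decay t₀ * fromℕ (size z)))
  heatTrace-term≤ a c {b} {t} {t₀} z@(m , μ , ν) 2a≤N 2c≤N 0≤b b≤N 0≤t₀ t₀≤t iz short =
    ≤-trans (≤-reflexive (sym (heatTrace-term a c z 0≤b short))) (exp-mono-≤ (neg-mono-≤ (begin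
      decay t₀ * S
        ≈⟨ solve 3 (λ h t S → h :* (h :* (h :* t)) :* S := h :* t :* (h :* (h :* S))) refl ½ t₀ S ⟩
      ½ * t₀ * (½ * (½ * S))
        ≤⟨ *-mono-≤ (*-nonNeg (<⇒≤ 0<½) 0≤t₀) (*-monoʳ-≤ (<⇒≤ 0<½) t₀≤t) (*-nonNeg 0≤½ (*-nonNeg 0≤½ 0≤S)) κ-lower ⟩
      ½ * t * κ α N (signature N z) ≈⟨ *-congʳ (*-comm ½ t) ⟩
      t * ½ * κ α N (signature N z) ∎)))
    where
    N = suc (a ℕ.+ c)
    n = fromℕ (a ℕ.+ c)
    α = 1# + b
    x = (fromℕ N + b) ⁻¹
    S = fromℕ (size z)
    0≤½ = <⇒≤ 0<½
    0≤S : 0# ≤ S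
    0≤S = fromℕ-nonNeg (size z)
    0<N+b : 0# < fromℕ N + b
    0<N+b = +-pos-nonNeg (fromℕ-pos N) 0≤b
    0≤x = <⇒≤ (⁻¹-pos 0<N+b)
    1≤2xN : 1# ≤ x * (fromℕ N + fromℕ N)
    1≤2xN = ≤-trans (≤-reflexive (sym (⁻¹-inverseˡ (<⇒≉0 0<N+b)))) (*-monoʳ-≤ 0≤x (+-monoʳ-≤ (fromℕ N) b≤N))
    κ-lower : ½ * (½ * S) ≤ κ α N (signature N z)
    κ-lower = begin
      ½ * (½ * S)
        ≤⟨ *-monoʳ-≤ 0≤½ (≤-trans (≤-reflexive (sym (*-identityˡ _))) (*-monoˡ-≤ (*-nonNeg 0≤½ 0≤S) 1≤2xN)) ⟩
      ½ * (x * (fromℕ N + fromℕ N) * (½ * S))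
        ≈⟨ solve 4 (λ h x N S → h :* (x :* (N :+ N) :* (h :* S)) :=
            (con (+ 2) :* h) :* (x :* (h :* (N :* S)))) refl ½ x (fromℕ N) S ⟩
      fromℕ 2 * ½ * (x * (½ * (fromℕ N * S)))       ≈⟨ trans (*-congʳ 2*½≈1) (*-identityˡ _) ⟩
      x * (½ * (fromℕ N * S))
        ≤⟨ *-monoʳ-≤ 0≤x (*-monoʳ-≤ 0≤½ (numerator-lower a c 2a≤N 2c≤N z (≤-by 0≤b refl) iz short)) ⟩
      x * (½ * (fromℕ 2 * numerator α n z))
        ≈⟨ *-congˡ (trans (sym (*-assoc _ _ _)) (trans (*-congʳ (trans (*-comm ½ (fromℕ 2)) 2*½≈1)) (*-identityˡ _))) ⟩
      x * numerator α n z
        ≈⟨ *-congʳ (⁻¹-cong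
          (solve 2 (λ n b → con (+ 1) :+ n :+ b := con (+ 1) :+ n :+ (con (+ 1) :+ b) :- con (+ 1)) refl n b)) ⟩
      (fromℕ N + α - 1#) ⁻¹ * numerator α n z       ≈⟨ κ-signature a c α m μ ν short ⟨
      κ α N (signature N z)                         ∎

  -- The coefficients of 𝒵

  partitionsOf-HasSum : ∀ d (f : List ℕ → Carrier) → ∃ (HasSum (IsPartitionOf d) f)
  partitionsOf-HasSum d f = _ , HasSum-finite f L
    (∪-FiniteSubset P [] (All.tabulate (λ μ∈ → proj₂ (∈-keep⁻ (IsPartitionOf d) {F = boundedPartitions d d} μ∈))) [])
    (λ { μ p@(dec , 0<μ , ≡.refl) → ∪-⊆ˡ P [] (∈-keep⁺ (IsPartitionOf d)
      (∈-boundedPartitions d d μ (dec , 0<μ) (parts≤sum μ) (length≤sum 0<μ)) p) })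
    where
    P = keep (IsPartitionOf d) (boundedPartitions d d)
    L = P ∪ []

  ellipticHurwitz-HasSum : ∀ b d r → HasSum (IsPartitionOf d) (λ μ → content (1# + b) μ ^ r) (ellipticHurwitz b d r)
  ellipticHurwitz-HasSum b d r = let s , h = partitionsOf-HasSum d (λ μ → content (1# + b) μ ^ r) in
    HasSum-cong (λ _ _ → refl) (sym (sumOver-HasSum h)) h

  ∣expSeries∣≤ : ∀ {c E S} r → 0# ≤ c → 0# ≤ S → ∣ E ∣ ≤ c * (1# + S) ^ 2 → ∣ expSeries E r ∣ ≤ c ^ r * (1# + S) ^ (2 ℕ.* r)
  ∣expSeries∣≤ {c} {E} {S} r 0≤c 0≤S ∣E∣≤ = begin
    ∣ expSeries E r ∣                 ≈⟨ ∣expSeries∣ E r ⟩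
    ∣ E ∣ ^ r * fromℕ (r !) ⁻¹        ≤⟨ *-monoʳ-≤ (^-nonNeg r (∣x∣-nonNeg E)) (n!⁻¹≤1 r) ⟩
    ∣ E ∣ ^ r * 1#                    ≈⟨ *-identityʳ _ ⟩
    ∣ E ∣ ^ r                         ≤⟨ ^-monoˡ-≤ r (∣x∣-nonNeg E) ∣E∣≤ ⟩
    (c * (1# + S) ^ 2) ^ r            ≈⟨ trans (^-distrib-* c _ r) (*-congˡ (^-assocʳ (1# + S) 2 r)) ⟩
    c ^ r * (1# + S) ^ (2 ℕ.* r)      ∎

  -- One majorant for every family in use: φ embeds single partitions, integers, short triples or
  -- all triples into triples, where `weight` is summable.
  Σ-slice-bounded : ∀ {J : Set} {T : Pred J 0ℓ} {f : J → Carrier} (φ : J → Index) {a D} k → 0# < a → 0# ≤ D →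
    (∀ {x y} → φ x ≡ φ y → x ≡ y) → (∀ x → T x → IsIndex (φ x)) → (∀ x → T x → ∣ f x ∣ ≤ D * weight a k (φ x)) →
    ∃[ B ] (∀ F → FiniteSubset T F → finiteSum (λ x → ∣ f x ∣) F ≤ B)
  Σ-slice-bounded {f = f} φ {a} {D} k 0<a 0≤D inj maps ∣f∣≤ = D * proj₁ W , λ F (uF , tF) → begin
    finiteSum (λ x → ∣ f x ∣) F                  ≤⟨ Σ-mono F (λ x x∈F → ∣f∣≤ x (All.lookup tF x∈F)) ⟩
    finiteSum (λ x → D * weight a k (φ x)) F     ≈⟨ Σ-* D (weight a k ∘ φ) F ⟩
    D * finiteSum (weight a k ∘ φ) F             ≈⟨ *-congˡ (Σ-map (weight a k) φ F) ⟨
    D * finiteSum (weight a k) (map φ F)         ≤⟨ *-monoʳ-≤ 0≤D (proj₂ W (map φ F)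
      (Unique-map φ F (λ _ _ _ _ → inj) uF , All.map⁺ (All.map (maps _) tF))) ⟩
    D * proj₁ W                                  ∎
    where W = Σ-weight-bounded 0<a k

  module _ {b t : Carrier} (0≤b : 0# ≤ b) (0<t : 0# < t) where
    private
      α q : Carrier
      α = 1# + b
      q = exp (- (t * ½))
      0≤α = +-nonNeg 0≤1 0≤b
      0≤t = <⇒≤ 0<t
      0<t½ : 0# < t * ½
      0<t½ = *-pos 0<t 0<½

      q^≈exp : ∀ k → q ^ k ≈ exp (- (t * ½ * fromℕ k))
      q^≈exp k = trans (sym (exp-fromℕ* k _)) (exp-cong (solve 2 (λ k a → k :* (:- a) := :- (a :* k)) refl (fromℕ k) _))

      chiralTerm : Carrier → ℕ → List ℕ → Carrier
      chiralTerm v r μ = q ^ ℕ.sum μ * expSeries (chiralExponent b t v μ) r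

      ∣chiralExponent∣≤ : ∀ v μ → IsPartition μ → ∣ chiralExponent b t v μ ∣ ≤ (∣ v ∣ + t * (α + 1#)) * (1# + fromℕ (ℕ.sum μ)) ^ 2
      ∣chiralExponent∣≤ v μ pμ = begin
        ∣ v * K + - t * content α μ ∣             ≤⟨ ∣∣-triangle _ _ ⟩
        ∣ v * K ∣ + ∣ - t * content α μ ∣
          ≈⟨ +-cong (∣∣-* v K) (trans (∣∣-* _ _) (*-congʳ (trans (∣-x∣≈∣x∣ t) (0≤x⇒∣x∣≈x 0≤t)))) ⟩
        ∣ v ∣ * ∣ K ∣ + t * ∣ content α μ ∣
          ≤⟨ +-mono-≤ (*-monoʳ-≤ (∣x∣-nonNeg v) (≤-trans (≤-reflexive (0≤x⇒∣x∣≈x 0≤K)) K≤P))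
            (*-monoʳ-≤ 0≤t (≤-trans (∣content∣≤ μ 0≤α pμ) (*-monoʳ-≤ (+-nonNeg 0≤α 0≤1)
              (≤-trans (≤-reflexive (*-cong (sym (fromℕ-sum μ)) (sym (fromℕ-sum μ)))) K²≤P)))) ⟩
        ∣ v ∣ * P + t * ((α + 1#) * P)
          ≈⟨ solve 4 (λ v t a P → v :* P :+ t :* (a :* P) := (v :+ t :* a) :* P) refl ∣ v ∣ t (α + 1#) P ⟩
        (∣ v ∣ + t * (α + 1#)) * P                ∎
        where
        K = fromℕ (ℕ.sum μ)
        P = (1# + K) ^ 2
        0≤K : 0# ≤ K
        0≤K = fromℕ-nonNeg (ℕ.sum μ)
        K²≤P : K * K ≤ P
        K²≤P = ≤-by (+-nonNeg 0≤1 (*-nonNeg (fromℕ-nonNeg 2) 0≤K))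
          (solve 1 (λ S → (con (+ 1) :+ S) :^ 2 := S :* S :+ (con (+ 1) :+ con (+ 2) :* S)) refl K)
        K≤P : K ≤ P
        K≤P = ≤-trans (k≤k*k (ℕ.sum μ)) K²≤P

      Σ-chiral-bounded : ∀ v r → ∃[ B ] (∀ F → FiniteSubset IsPartition F → finiteSum (λ μ → ∣ chiralTerm v r μ ∣) F ≤ B)
      Σ-chiral-bounded v r = Σ-slice-bounded φ (2 ℕ.* r) 0<t½ (^-nonNeg r 0≤c) (λ { ≡.refl → ≡.refl }) (λ μ pμ → tt , pμ , [] , []) λ μ pμ → begin
        ∣ chiralTerm v r μ ∣
          ≈⟨ trans (∣∣-* _ _) (*-congʳ (0≤x⇒∣x∣≈x (^-nonNeg (ℕ.sum μ) (exp-nonNeg _)))) ⟩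
        q ^ ℕ.sum μ * ∣ expSeries (chiralExponent b t v μ) r ∣
          ≤⟨ *-monoʳ-≤ (^-nonNeg (ℕ.sum μ) (exp-nonNeg _)) (∣expSeries∣≤ r 0≤c (fromℕ-nonNeg (ℕ.sum μ)) (∣chiralExponent∣≤ v μ pμ)) ⟩
        q ^ ℕ.sum μ * (c ^ r * (1# + fromℕ (ℕ.sum μ)) ^ (2 ℕ.* r))
          ≈⟨ trans (*-congʳ (q^≈exp (ℕ.sum μ))) (solve 3 (λ e c p → e :* (c :* p) := c :* (p :* e)) refl _ _ _) ⟩
        c ^ r * ((1# + fromℕ (ℕ.sum μ)) ^ (2 ℕ.* r) * exp (- (t * ½ * fromℕ (ℕ.sum μ))))
          ≡⟨ ≡.cong (λ k → c ^ r * ((1# + fromℕ k) ^ (2 ℕ.* r) * exp (- (t * ½ * fromℕ k)))) (ℕ.+-identityʳ (ℕ.sum μ)) ⟨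
        c ^ r * weight (t * ½) (2 ℕ.* r) (φ μ) ∎
        where
        φ : List ℕ → Index
        φ μ = + 0 , μ , []
        c = ∣ v ∣ + t * (α + 1#)
        0≤c : 0# ≤ c
        0≤c = +-nonNeg (∣x∣-nonNeg v) (*-nonNeg 0≤t (+-nonNeg 0≤α 0≤1))

      ℋ-coefficient : Carrier → ℕ → ℕ → Carrier
      ℋ-coefficient v r d = q ^ d * ∑[ j ≤ r ] (ℋ-shifted b d (r ∸ toℕ j) (toℕ j) * v ^ toℕ j * (- t) ^ (r ∸ toℕ j))

      chiral-fiber : ∀ v r d → HasSum (λ μ → IsPartition μ × ℕ.sum μ ≡ d) (chiralTerm v r) (ℋ-coefficient v r d)
      chiral-fiber v r d = HasSum-resp (λ μ (dec , 0<μ , eq) → (dec , 0<μ) , eq) (λ μ ((dec , 0<μ) , eq) → dec , 0<μ , eq)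
        (HasSum-cong terms coefficients (HasSum-* (q ^ d)
          (HasSum-∑ {n = suc r} (λ j → HasSum-* (k (toℕ j)) (ellipticHurwitz-HasSum b d (r ∸ toℕ j))))))
        where
        k : ℕ → Carrier
        k j = fromℕ d ^ j * fromℕ (j !) ⁻¹ * fromℕ ((r ∸ j) !) ⁻¹ * v ^ j * (- t) ^ (r ∸ j)
        coefficients : q ^ d * ∑[ j ≤ r ] (k (toℕ j) * ellipticHurwitz b d (r ∸ toℕ j)) ≈ ℋ-coefficient v r d
        coefficients = *-congˡ (∑-cong (suc r) (λ j → solve 6 (λ d f g v t e → d :* f :* g :* v :* t :* e :=
            (d :* f) :* (e :* g) :* v :* t) refl
          (fromℕ d ^ toℕ j) (fromℕ (toℕ j !) ⁻¹) (fromℕ ((r ∸ toℕ j) !) ⁻¹) (v ^ toℕ j) ((- t) ^ (r ∸ toℕ j)) (ellipticHurwitz b d (r ∸ toℕ j))))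
        terms : ∀ μ → IsPartitionOf d μ → q ^ d * ∑[ j ≤ r ] (k (toℕ j) * content α μ ^ (r ∸ toℕ j)) ≈ chiralTerm v r μ
        terms μ (_ , _ , ≡.refl) = *-congˡ (trans (∑-cong (suc r) (λ j → trans
          (solve 6 (λ d f g v t e → d :* f :* g :* v :* t :* e := (v :* d) :* f :* ((t :* e) :* g)) refl
            (fromℕ d ^ toℕ j) (fromℕ (toℕ j !) ⁻¹) (fromℕ ((r ∸ toℕ j) !) ⁻¹) (v ^ toℕ j) ((- t) ^ (r ∸ toℕ j)) (content α μ ^ (r ∸ toℕ j)))
          (*-cong (*-congʳ (sym (^-distrib-* v (fromℕ d) (toℕ j)))) (*-congʳ (sym (^-distrib-* (- t) (content α μ) (r ∸ toℕ j)))))))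
          (expSeries-⊛ (v * fromℕ d) (- t * content α μ) r))

      chiral-HasSum : ∀ v r → HasSum IsPartition (chiralTerm v r) (ℋ-series b q v (- t) r)
      chiral-HasSum v r = let s , h = Σ-bounded⇒summable (proj₂ (Σ-chiral-bounded v r)) in
        HasSum-cong (λ _ _ → refl)
          (sym (sumOver-HasSum (HasSum-fibration {T = U} {g = ℋ-coefficient v r} ℕ.sum (λ _ _ → tt) (λ d _ → chiral-fiber v r d) h))) h

      E₀ : ℤ → Carrier
      E₀ m = ½ * b * (1# + b) * t * fromℤ m ^ 2

      v : ℤ → Carrier
      v m = (1# + b) * t * fromℤ m

      integerTerm : ℤ → Series
      integerTerm m = expSeries (E₀ m) ⊛ ℋ-series b q (- v m) (- t) ⊛ ℋ-series b q (v m) (- t)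

      -- In each term of the threefold Cauchy product, a product of two absolutely convergent sums
      -- is a sum over pairs (μ , ν); then `expSeries-⊛`, used twice, merges the three exponentials
      -- into that of E.
      pair-HasSum : ∀ m r → HasSum (λ (μ , ν) → IsPartition μ × IsPartition ν)
        (λ (μ , ν) → (q ^ ℕ.sum μ * q ^ ℕ.sum ν) * expSeries (exponent b t (m , μ , ν)) r) (integerTerm m r)
      pair-HasSum m r = HasSum-cong terms coefficients
        (HasSum-∑ {n = suc r} (λ j → HasSum-∑ {n = suc (toℕ j)} (λ i → HasSum-* (expSeries (E₀ m) (toℕ i))
          (HasSum-× (proj₂ (Σ-chiral-bounded (- v m) (toℕ j ∸ toℕ i))) (proj₂ (Σ-chiral-bounded (v m) (r ∸ toℕ j)))
            (chiral-HasSum (- v m) (toℕ j ∸ toℕ i)) (chiral-HasSum (v m) (r ∸ toℕ j))))))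
        where
        factor : ∀ (A B : Series) (c : ℕ → Carrier) →
          ∑[ j ≤ r ] (∑[ i ≤ toℕ j ] (A (toℕ i) * (B (toℕ j ∸ toℕ i) * c (r ∸ toℕ j)))) ≈ (A ⊛ B ⊛ c) r
        factor A B c = ∑-cong (suc r) {g = λ j → (A ⊛ B) (toℕ j) * c (r ∸ toℕ j)} (λ j → trans
          (∑-cong (suc (toℕ j)) (λ i → sym (*-assoc (A (toℕ i)) (B (toℕ j ∸ toℕ i)) (c (r ∸ toℕ j)))))
          (sym (*-distribʳ-sum {suc (toℕ j)} (c (r ∸ toℕ j)) (λ i → A (toℕ i) * B (toℕ j ∸ toℕ i)))))
        coefficients : ∑[ j ≤ r ] (∑[ i ≤ toℕ j ] (expSeries (E₀ m) (toℕ i) *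
          (ℋ-series b q (- v m) (- t) (toℕ j ∸ toℕ i) * ℋ-series b q (v m) (- t) (r ∸ toℕ j)))) ≈ integerTerm m r
        coefficients = factor (expSeries (E₀ m)) (ℋ-series b q (- v m) (- t)) (ℋ-series b q (v m) (- t))
        terms : ∀ (p : List ℕ × List ℕ) → IsPartition (proj₁ p) × IsPartition (proj₂ p) →
          ∑[ j ≤ r ] (∑[ i ≤ toℕ j ] (expSeries (E₀ m) (toℕ i) * (chiralTerm (- v m) (toℕ j ∸ toℕ i) (proj₁ p) * chiralTerm (v m) (r ∸ toℕ j) (proj₂ p))))
            ≈ (q ^ ℕ.sum (proj₁ p) * q ^ ℕ.sum (proj₂ p)) * expSeries (exponent b t (m , p)) r
        terms (μ , ν) _ = begin-equality
          ∑[ j ≤ r ] (∑[ i ≤ toℕ j ] (expSeries (E₀ m) (toℕ i) * (chiralTerm (- v m) (toℕ j ∸ toℕ i) μ * chiralTerm (v m) (r ∸ toℕ j) ν)))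
            ≈⟨ ∑-cong (suc r) (λ j → trans (∑-cong (suc (toℕ j)) (λ i →
                 solve 5 (λ a x y z w → a :* (x :* y :* (z :* w)) := (x :* z) :* (a :* (y :* w))) refl
                   (expSeries (E₀ m) (toℕ i)) (q ^ ℕ.sum μ) (expSeries E₁ (toℕ j ∸ toℕ i)) (q ^ ℕ.sum ν) (expSeries E₂ (r ∸ toℕ j))))
                 (sym (*-distribˡ-sum {suc (toℕ j)} Q (λ i → expSeries (E₀ m) (toℕ i) * (expSeries E₁ (toℕ j ∸ toℕ i) * expSeries E₂ (r ∸ toℕ j)))))) ⟩
          ∑[ j ≤ r ] (Q * ∑[ i ≤ toℕ j ] (expSeries (E₀ m) (toℕ i) * (expSeries E₁ (toℕ j ∸ toℕ i) * expSeries E₂ (r ∸ toℕ j))))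
            ≈⟨ *-distribˡ-sum {suc r} Q (λ j → ∑[ i ≤ toℕ j ] (expSeries (E₀ m) (toℕ i) * (expSeries E₁ (toℕ j ∸ toℕ i) * expSeries E₂ (r ∸ toℕ j)))) ⟨
          Q * ∑[ j ≤ r ] (∑[ i ≤ toℕ j ] (expSeries (E₀ m) (toℕ i) * (expSeries E₁ (toℕ j ∸ toℕ i) * expSeries E₂ (r ∸ toℕ j))))
            ≈⟨ *-congˡ (factor (expSeries (E₀ m)) (expSeries E₁) (expSeries E₂)) ⟩
          Q * (expSeries (E₀ m) ⊛ expSeries E₁ ⊛ expSeries E₂) r
            ≈⟨ *-congˡ (∑-cong (suc r) (λ j → *-congʳ {x = expSeries E₂ (r ∸ toℕ j)} (expSeries-⊛ (E₀ m) E₁ (toℕ j)))) ⟩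
          Q * (expSeries (E₀ m + E₁) ⊛ expSeries E₂) r
            ≈⟨ *-congˡ (trans (expSeries-⊛ (E₀ m + E₁) E₂ r) (expSeries-cong (+-assoc _ _ _) r)) ⟩
          Q * expSeries (exponent b t (m , μ , ν)) r ∎
          where
          Q = q ^ ℕ.sum μ * q ^ ℕ.sum ν
          E₁ = chiralExponent b t (- v m) μ
          E₂ = chiralExponent b t (v m) ν

      boltzmann-weight : ∀ z r → IsIndex z → ∣ boltzmann b t z * expSeries (exponent b t z) r ∣ ≤ exponentConstant b t ^ r * weight (decay t) (2 ℕ.* r) z
      boltzmann-weight z r iz = begin
        ∣ boltzmann b t z * expSeries (exponent b t z) r ∣
          ≈⟨ trans (∣∣-* _ _) (*-congʳ (0≤x⇒∣x∣≈x (boltzmann-nonNeg b t z))) ⟩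
        boltzmann b t z * ∣ expSeries (exponent b t z) r ∣
          ≤⟨ *-mono-≤ (boltzmann-nonNeg b t z) (boltzmann≤ z 0≤b 0≤t ≤-refl) (∣x∣-nonNeg _)
               (∣expSeries∣≤ r (exponentConstant-nonNeg 0≤b 0≤t) (fromℕ-nonNeg (size z)) (∣exponent∣≤ z 0≤b 0≤t iz)) ⟩
        exp (- (decay t * fromℕ (size z))) * (exponentConstant b t ^ r * (1# + fromℕ (size z)) ^ (2 ℕ.* r))
          ≈⟨ solve 3 (λ e c p → e :* (c :* p) := c :* (p :* e)) refl _ _ _ ⟩
        exponentConstant b t ^ r * weight (decay t) (2 ℕ.* r) z ∎

      Θ-HasSum : HasSum U (gaussian α t) (Θ α t)
      Θ-HasSum = let s , h = Σ-bounded⇒summable (proj₂ (Σ-slice-bounded {T = U} {f = gaussian α t} φ 0 (decay-pos 0<t) 0≤1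
                       (λ { ≡.refl → ≡.refl }) (λ _ _ → tt , ([] , []) , ([] , [])) bound))
                 in HasSum-cong (λ _ _ → refl) (sym (sumOver-HasSum h)) h
        where
        φ : ℤ → Index
        φ m = m , [] , []
        bound : ∀ m → U m → ∣ gaussian α t m ∣ ≤ 1# * weight (decay t) 0 (φ m)
        bound m _ = begin
          ∣ gaussian α t m ∣                       ≈⟨ 0≤x⇒∣x∣≈x (exp-nonNeg _) ⟩
          gaussian α t m                           ≈⟨ trans (*-congˡ (*-identityˡ 1#)) (*-identityʳ _) ⟨
          boltzmann b t (φ m)                      ≤⟨ boltzmann≤ (φ m) 0≤b 0≤t ≤-refl ⟩
          exp (- (decay t * fromℕ (size (φ m))))   ≈⟨ trans (*-identityˡ _) (*-identityˡ _) ⟨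
          1# * weight (decay t) 0 (φ m)            ∎

      -- The term at m = 0 is already positive. This lets the prefactor Θ of `𝒵` cancel the
      -- normalisation of the expectation.
      0<Θ : 0# < Θ α t
      0<Θ = <-≤-trans (exp-pos _) (≤-trans (≤-reflexive (sym (+-identityʳ _)))
        (HasSum-≥ (λ m → exp-nonNeg _) Θ-HasSum (+ 0 ∷ []) ([] ∷ [] , tt ∷ [])))

    -- The sum over triples converges by domination; grouped by m, its fibres are the expressions
    -- inside the expectation.
    𝒵-HasSum : ∀ r → HasSum IsIndex (λ z → boltzmann b t z * expSeries (exponent b t z) r) (𝒵 b t r)
    𝒵-HasSum r = HasSum-cong (λ _ _ → refl) (sym 𝒵≈s) h
      where
      summable = Σ-bounded⇒summable (proj₂ (Σ-slice-bounded {T = IsIndex} {f = λ z → boltzmann b t z * expSeries (exponent b t z) r}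
        id (2 ℕ.* r) (decay-pos 0<t) (^-nonNeg r (exponentConstant-nonNeg 0≤b 0≤t)) id (λ _ → id) (λ z → boltzmann-weight z r)))
      s = proj₁ summable
      h = proj₂ summable
      byInteger : HasSum U (λ m → gaussian α t m * integerTerm m r) s
      byInteger = HasSum-fibration proj₁ (λ _ _ → tt) (λ m _ →
        HasSum-reindex {S = λ (μ , ν) → IsPartition μ × IsPartition ν} (m ,_) (λ _ p → (tt , p) , ≡.refl) (λ { _ _ _ _ ≡.refl → ≡.refl })
          (λ { (m , p) ((_ , pp) , ≡.refl) → p , pp , ≡.refl })
          (HasSum-cong (λ _ _ → sym (*-assoc _ _ _)) refl (HasSum-* (gaussian α t m) (pair-HasSum m r)))) h
      𝒵≈s : 𝒵 b t r ≈ s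
      𝒵≈s = begin-equality
        𝒵 b t r               ≈⟨ *-congˡ (sumOver-HasSum (HasSum-cong
          (λ m _ → trans (sym (*-assoc _ _ _)) (*-congʳ (*-comm _ _))) refl (HasSum-* (Θ α t ⁻¹) byInteger))) ⟩
        Θ α t * (Θ α t ⁻¹ * s) ≈⟨ *-assoc _ _ _ ⟨
        Θ α t * Θ α t ⁻¹ * s   ≈⟨ trans (*-congʳ (⁻¹-inverseʳ (<⇒≉0 0<Θ))) (*-identityˡ s) ⟩
        s                      ∎

  -- The remainder

  module _ (a c : ℕ) (a≤1+c : a ℕ.≤ suc c) (c≤1+a : c ℕ.≤ suc a)
           {t₀ t₁ b₁ : Carrier} (0<t₀ : 0# < t₀) (0≤b₁ : 0# ≤ b₁) (b₁≤N : b₁ ≤ fromℕ (suc (a ℕ.+ c)))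
           {t b : Carrier} (t₀≤t : t₀ ≤ t) (t≤t₁ : t ≤ t₁) (0≤b : 0# ≤ b) (b≤b₁ : b ≤ b₁) (p : ℕ) where
    private
      N k : ℕ
      N = suc (a ℕ.+ c)
      -- For long triples, P^p bounds the Taylor polynomial and the inserted factor (x P)^{p+1} adds
      -- p + 1 powers. Short triples produce p + 1 powers only and are raised to the same exponent.
      k = p ℕ.+ suc p

      x d : Carrier
      x = (fromℕ N + b) ⁻¹
      -- The summand 4 ensures P ≥ 4 (1 + S)², hence P ≥ 1 and, for long triples, P ≥ 4 S ≥ N + b.
      d = exponentConstant b₁ t₁ + fromℕ 4

      0≤t₀ = <⇒≤ 0<t₀
      0<t = <-≤-trans 0<t₀ t₀≤t
      0≤t = <⇒≤ 0<t
      b≤N = ≤-trans b≤b₁ b₁≤N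

      2a≤N : 2 ℕ.* a ℕ.≤ N
      2a≤N = ≡.subst₂ ℕ._≤_ (≡.cong (a ℕ.+_) (≡.sym (ℕ.+-identityʳ a))) (ℕ.+-suc a c) (ℕ.+-monoʳ-≤ a a≤1+c)

      2c≤N : 2 ℕ.* c ℕ.≤ N
      2c≤N = ≡.subst (ℕ._≤ N) (≡.cong (c ℕ.+_) (≡.sym (ℕ.+-identityʳ c))) (ℕ.+-monoˡ-≤ c c≤1+a)

      0<N+b : 0# < fromℕ N + b
      0<N+b = +-pos-nonNeg (fromℕ-pos N) 0≤b

      0≤x : 0# ≤ x
      0≤x = <⇒≤ (⁻¹-pos 0<N+b)

      x[N+b]≈1 : x * (fromℕ N + b) ≈ 1#
      x[N+b]≈1 = ⁻¹-inverseˡ (<⇒≉0 0<N+b)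

      x≤1 : x ≤ 1#
      x≤1 = ≤-trans (≤-reflexive (sym (*-identityʳ x))) (≤-trans (*-monoʳ-≤ 0≤x
        (≤-by (+-nonNeg (fromℕ-nonNeg (a ℕ.+ c)) 0≤b) (+-assoc _ _ _))) (≤-reflexive x[N+b]≈1))

      E w e⁻ P : Index → Carrier
      E = exponent b t
      w = boltzmann b t
      e⁻ z = exp (- (decay t₀ * fromℕ (size z)))
      P z = d * (1# + fromℕ (size z)) ^ 2

      exponentConstant-mono : exponentConstant b t ≤ exponentConstant b₁ t₁
      exponentConstant-mono = *-mono-≤ 0≤t t≤t₁
        (+-nonNeg (+-nonNeg (*-nonNeg (+-nonNeg 0≤1 0≤b) 0≤b) (*-nonNeg (fromℕ-nonNeg 4) (+-nonNeg 0≤1 0≤b))) (fromℕ-nonNeg 2))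
        (+-mono-≤ (+-mono-≤ (*-mono-≤ (+-nonNeg 0≤1 0≤b) (+-monoʳ-≤ 1# b≤b₁) 0≤b b≤b₁) (*-monoʳ-≤ (fromℕ-nonNeg 4) (+-monoʳ-≤ 1# b≤b₁))) ≤-refl)

      0≤d : 0# ≤ d
      0≤d = +-nonNeg (exponentConstant-nonNeg 0≤b₁ (≤-trans 0≤t t≤t₁)) (fromℕ-nonNeg 4)

      1≤[1+S]² : ∀ z → 1# ≤ (1# + fromℕ (size z)) ^ 2
      1≤[1+S]² z = 1≤x⇒1≤x^n 2 (≤-by (fromℕ-nonNeg (size z)) refl)

      0≤[1+S]² : ∀ z → 0# ≤ (1# + fromℕ (size z)) ^ 2
      0≤[1+S]² z = ≤-trans 0≤1 (1≤[1+S]² z)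

      ∣E∣≤P : ∀ z → IsIndex z → ∣ E z ∣ ≤ P z
      ∣E∣≤P z iz = ≤-trans (∣exponent∣≤ z 0≤b 0≤t iz) (*-monoˡ-≤ (0≤[1+S]² z)
        (≤-trans exponentConstant-mono (≤-by (fromℕ-nonNeg 4) refl)))

      4[1+S]²≤P : ∀ z → fromℕ 4 * (1# + fromℕ (size z)) ^ 2 ≤ P z
      4[1+S]²≤P z = *-monoˡ-≤ (0≤[1+S]² z) (≤-by (exponentConstant-nonNeg 0≤b₁ (≤-trans 0≤t t≤t₁)) (+-comm _ _))

      1≤P : ∀ z → 1# ≤ P z
      1≤P z = ≤-trans (1≤[1+S]² z) (≤-trans (≤-by (*-nonNeg (fromℕ-nonNeg 3) (0≤[1+S]² z))
        (solve 1 (λ s → con (+ 4) :* s := s :+ con (+ 3) :* s) refl _)) (4[1+S]²≤P z))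

      0≤P : ∀ z → 0# ≤ P z
      0≤P z = ≤-trans 0≤1 (1≤P z)

      ∣xE∣≤xP : ∀ z → IsIndex z → ∣ x * E z ∣ ≤ x * P z
      ∣xE∣≤xP z iz = ≤-trans (≤-reflexive (trans (∣∣-* x _) (*-congʳ (0≤x⇒∣x∣≈x 0≤x)))) (*-monoʳ-≤ 0≤x (∣E∣≤P z iz))

      -- A partition too long for the splitting N = a + 1 + c has at least N/2 boxes.
      long⇒1≤xP : ∀ z → IsIndex z → ¬ IsShort a c z → 1# ≤ x * P z
      long⇒1≤xP z@(m , μ , ν) (_ , pμ , pν) long = begin
        1#                        ≈⟨ x[N+b]≈1 ⟨
        x * (fromℕ N + b)         ≤⟨ *-monoʳ-≤ 0≤x N+b≤P ⟩
        x * P z                   ∎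
        where
        S = fromℕ (size z)
        ≤2S : ∀ l → N ℕ.≤ l ℕ.+ l → l ℕ.≤ size z → fromℕ N ≤ S + S
        ≤2S l N≤ l≤ = ≤-trans (fromℕ-mono-≤ N≤) (≤-trans (≤-reflexive (fromℕ-+ l l)) (+-mono-≤ (fromℕ-mono-≤ l≤) (fromℕ-mono-≤ l≤)))
        N≤2S : fromℕ N ≤ S + S
        N≤2S with List.length μ ℕ.≤? a | List.length ν ℕ.≤? c
        ... | yes lμ | yes lν = ⊥-elim (long (lμ , lν))
        ... | no lμ≰ | _ = ≤2S (suc a) (ℕ.+-monoʳ-≤ (suc a) c≤1+a)
              (ℕ.≤-trans (ℕ.≰⇒> lμ≰) (ℕ.≤-trans (length≤sum (proj₂ pμ)) (ℕ.≤-trans (ℕ.m≤m+n _ (ℕ.sum ν)) (ℕ.m≤n+m _ (ℤ.∣ m ∣ ℕ.* ℤ.∣ m ∣)))))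
        ... | yes _ | no lν≰ = ≤2S (suc c) (≡.subst (ℕ._≤ suc c ℕ.+ suc c) (ℕ.+-suc a c) (ℕ.+-monoˡ-≤ (suc c) a≤1+c))
              (ℕ.≤-trans (ℕ.≰⇒> lν≰) (ℕ.≤-trans (length≤sum (proj₂ pν)) (ℕ.≤-trans (ℕ.m≤n+m _ (ℕ.sum μ)) (ℕ.m≤n+m _ (ℤ.∣ m ∣ ℕ.* ℤ.∣ m ∣)))))
        N+b≤P : fromℕ N + b ≤ P z
        N+b≤P = ≤-trans (+-mono-≤ N≤2S (≤-trans b≤N N≤2S)) (≤-trans (≤-by
          (*-nonNeg (fromℕ-nonNeg 4) (+-nonNeg 0≤1 (+-nonNeg (fromℕ-nonNeg (size z)) (*-nonNeg (fromℕ-nonNeg (size z)) (fromℕ-nonNeg (size z))))))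
          (solve 1 (λ S → con (+ 4) :* (con (+ 1) :+ S) :^ 2 :=
              S :+ S :+ (S :+ S) :+ con (+ 4) :* (con (+ 1) :+ (S :+ S :* S))) refl S))
          (4[1+S]²≤P z))

      -- The difference is formed under one sum over all triples, so that a single absolute majorant
      -- bounds the remainder.
      D : Index → Carrier
      D z = indicator (IsShort a c) z * (w z * exp (x * E z)) + - (w z * taylor p (x * E z))

      D-cong : ∀ z {i} → indicator (IsShort a c) z ≡ i → D z ≈ w z * (i * exp (x * E z) - taylor p (x * E z))
      D-cong z ≡.refl = solve 4 (λ i w e t → i :* (w :* e) :+ (:- (w :* t)) := w :* (i :* e :- t)) refl _ (w z) _ _

      C₃ : Carrier
      C₃ = fromℕ 2 * taylorConstant p + fromℕ (suc p)

      0≤taylorConstant : 0# ≤ taylorConstant p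
      0≤taylorConstant = +-nonNeg (exp-nonNeg 1#) (fromℕ-nonNeg (suc p))

      w≤e⁻ : ∀ z → w z ≤ e⁻ z
      w≤e⁻ z = boltzmann≤ z 0≤b 0≤t₀ t₀≤t

      C₃-split : ∀ A e → fromℕ 2 * taylorConstant p * A * e + fromℕ (suc p) * A * e ≈ C₃ * A * e
      C₃-split A e = solve 4 (λ c p A e → con (+ 2) :* c :* A :* e :+ p :* A :* e :=
          (con (+ 2) :* c :+ p) :* A :* e) refl (taylorConstant p) (fromℕ (suc p)) A e

      X : Carrier
      X = x ^ suc p

      0≤X : 0# ≤ X
      0≤X = ^-nonNeg (suc p) 0≤x

      0≤XPᵏ : ∀ z → 0# ≤ X * P z ^ k
      0≤XPᵏ z = *-nonNeg 0≤X (^-nonNeg k (0≤P z))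

      ∣D∣-short : ∀ z → IsIndex z → IsShort a c z → ∣ D z ∣ ≤ fromℕ 2 * taylorConstant p * (X * P z ^ k) * e⁻ z
      ∣D∣-short z iz short = begin
        ∣ D z ∣
          ≈⟨ ∣∣-cong (trans (D-cong z (indicator-yes {P = IsShort a c} short)) (*-congˡ (+-congʳ (*-identityˡ _)))) ⟩
        ∣ w z * (exp y - taylor p y) ∣
          ≈⟨ trans (∣∣-* _ _) (*-congʳ (0≤x⇒∣x∣≈x (boltzmann-nonNeg b t z))) ⟩
        w z * ∣ exp y - taylor p y ∣
          ≤⟨ *-monoʳ-≤ (boltzmann-nonNeg b t z) (taylor-remainder p y) ⟩
        w z * (taylorConstant p * ∣ y ∣ ^ suc p * (1# + exp y))
          ≈⟨ solve 4 (λ w T Y e → w :* (T :* Y :* (con (+ 1) :+ e)) :=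
              T :* Y :* (w :+ w :* e)) refl (w z) (taylorConstant p) _ (exp y) ⟩
        taylorConstant p * ∣ y ∣ ^ suc p * (w z + w z * exp y)
          ≤⟨ *-mono-≤ (*-nonNeg 0≤taylorConstant (^-nonNeg (suc p) (∣x∣-nonNeg y))) (*-monoʳ-≤ 0≤taylorConstant ∣y∣^≤)
               (+-nonNeg (boltzmann-nonNeg b t z) (*-nonNeg (boltzmann-nonNeg b t z) (exp-nonNeg y)))
               (+-mono-≤ (w≤e⁻ z) (heatTrace-term≤ a c z 2a≤N 2c≤N 0≤b b≤N 0≤t₀ t₀≤t iz short)) ⟩
        taylorConstant p * (X * P z ^ k) * (e⁻ z + e⁻ z)
          ≈⟨ solve 3 (λ T A e → T :* A :* (e :+ e) :=
              con (+ 2) :* T :* A :* e) refl (taylorConstant p) (X * P z ^ k) (e⁻ z) ⟩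
        fromℕ 2 * taylorConstant p * (X * P z ^ k) * e⁻ z ∎
        where
        y = x * E z
        ∣y∣^≤ : ∣ y ∣ ^ suc p ≤ X * P z ^ k
        ∣y∣^≤ = begin
          ∣ y ∣ ^ suc p          ≤⟨ ^-monoˡ-≤ (suc p) (∣x∣-nonNeg y) (∣xE∣≤xP z iz) ⟩
          (x * P z) ^ suc p      ≈⟨ ^-distrib-* x (P z) (suc p) ⟩
          X * P z ^ suc p        ≤⟨ *-monoʳ-≤ 0≤X (^-monoʳ-≤ (1≤P z) (ℕ.m≤n+m (suc p) p)) ⟩
          X * P z ^ k            ∎

      ∣D∣-long : ∀ z → IsIndex z → ¬ IsShort a c z → ∣ D z ∣ ≤ fromℕ (suc p) * (X * P z ^ k) * e⁻ z
      ∣D∣-long z iz long = begin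
        ∣ D z ∣
          ≈⟨ ∣∣-cong (trans (D-cong z (indicator-no {P = IsShort a c} long))
            (solve 3 (λ w e t → w :* (con (+ 0) :* e :- t) := :- (w :* t)) refl (w z) _ _)) ⟩
        ∣ - (w z * taylor p y) ∣
          ≈⟨ trans (∣-x∣≈∣x∣ _) (trans (∣∣-* _ _) (*-congʳ (0≤x⇒∣x∣≈x (boltzmann-nonNeg b t z)))) ⟩
        w z * ∣ taylor p y ∣
          ≤⟨ *-mono-≤ (boltzmann-nonNeg b t z) (w≤e⁻ z) (∣x∣-nonNeg _) (∣∑∣≤ (suc p) _ (P z ^ p) term) ⟩
        e⁻ z * (fromℕ (suc p) * P z ^ p)
          ≤⟨ *-monoʳ-≤ (exp-nonNeg _) (*-monoʳ-≤ (fromℕ-nonNeg (suc p)) grow) ⟩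
        e⁻ z * (fromℕ (suc p) * (X * P z ^ k))
          ≈⟨ *-comm _ _ ⟩
        fromℕ (suc p) * (X * P z ^ k) * e⁻ z ∎
        where
        y = x * E z
        ∣y∣≤P : ∣ y ∣ ≤ P z
        ∣y∣≤P = ≤-trans (∣xE∣≤xP z iz) (≤-trans (*-monoˡ-≤ (0≤P z) x≤1) (≤-reflexive (*-identityˡ _)))
        term : ∀ (r : Fin (suc p)) → ∣ expSeries y (toℕ r) ∣ ≤ P z ^ p
        term r = ≤-trans (≤-reflexive (∣expSeries∣ y (toℕ r)))
          (≤-trans (*-monoˡ-≤ (<⇒≤ (⁻¹-pos (fromℕ-!-pos (toℕ r)))) (^-monoˡ-≤ (toℕ r) (∣x∣-nonNeg y) ∣y∣≤P))
            (expSeries≤^ p (1≤P z) (Fin.toℕ≤pred[n] r)))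
        grow : P z ^ p ≤ X * P z ^ k
        grow = begin
          P z ^ p                       ≈⟨ *-identityʳ _ ⟨
          P z ^ p * 1#                  ≤⟨ *-monoʳ-≤ (^-nonNeg p (0≤P z)) (1≤x⇒1≤x^n (suc p) (long⇒1≤xP z iz long)) ⟩
          P z ^ p * (x * P z) ^ suc p   ≈⟨ *-congˡ (^-distrib-* x (P z) (suc p)) ⟩
          P z ^ p * (X * P z ^ suc p)   ≈⟨ solve 3 (λ a b c → a :* (b :* c) := b :* (a :* c)) refl _ X _ ⟩
          X * (P z ^ p * P z ^ suc p)   ≈⟨ *-congˡ (^-homo-* (P z) p (suc p)) ⟨
          X * P z ^ k                   ∎

      ∣D∣≤ : ∀ z → IsIndex z → ∣ D z ∣ ≤ X * (C₃ * d ^ k) * weight (decay t₀) (2 ℕ.* k) z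
      ∣D∣≤ z iz = ≤-trans bound (≤-reflexive (trans (*-congʳ (*-congˡ (*-congˡ (trans (^-distrib-* d _ k) (*-congˡ (^-assocʳ (1# + fromℕ (size z)) 2 k))))))
        (solve 5 (λ C X d s e → C :* (X :* (d :* s)) :* e := X :* (C :* d) :* (s :* e)) refl C₃ X (d ^ k) _ (e⁻ z))))
        where
        0≤A₁ : 0# ≤ fromℕ 2 * taylorConstant p * (X * P z ^ k) * e⁻ z
        0≤A₁ = *-nonNeg (*-nonNeg (*-nonNeg (fromℕ-nonNeg 2) 0≤taylorConstant) (0≤XPᵏ z)) (exp-nonNeg _)
        0≤A₂ : 0# ≤ fromℕ (suc p) * (X * P z ^ k) * e⁻ z
        0≤A₂ = *-nonNeg (*-nonNeg (fromℕ-nonNeg (suc p)) (0≤XPᵏ z)) (exp-nonNeg _)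
        cases : Dec (IsShort a c z) → ∣ D z ∣ ≤ C₃ * (X * P z ^ k) * e⁻ z
        cases (yes short) = ≤-trans (∣D∣-short z iz short) (≤-by 0≤A₂ (sym (C₃-split _ _)))
        cases (no  long)  = ≤-trans (∣D∣-long z iz long) (≤-by 0≤A₁ (trans (sym (C₃-split _ _)) (+-comm _ _)))
        bound : ∣ D z ∣ ≤ C₃ * (X * P z ^ k) * e⁻ z
        bound = cases em

      IsShortIndex : Pred Index 0ℓ
      IsShortIndex z = IsIndex z × IsShort a c z

      heatTrace-HasSum : HasSum IsShortIndex (λ z → w z * exp (x * E z)) (heatTrace (1# + b) N t)
      heatTrace-HasSum = HasSum-cong (λ _ _ → refl) (sym (sumOver-HasSum (HasSum-reindex (signature N)
          (λ z (iz , _) → signature-Signature N z iz) (signature-injective a c) (signature-surjective a c)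
          (HasSum-cong (λ z (_ , short) → sym (heatTrace-term a c z 0≤b short)) refl h)))) h
        where
        h = proj₂ (Σ-bounded⇒summable (proj₂ (Σ-slice-bounded {T = IsShortIndex} {f = λ z → w z * exp (x * E z)} id 0 (decay-pos 0<t₀) 0≤1 id (λ _ → proj₁)
          (λ z (iz , short) → begin
            ∣ w z * exp (x * E z) ∣          ≈⟨ 0≤x⇒∣x∣≈x (*-nonNeg (boltzmann-nonNeg b t z) (exp-nonNeg _)) ⟩
            w z * exp (x * E z)              ≤⟨ heatTrace-term≤ a c z 2a≤N 2c≤N 0≤b b≤N 0≤t₀ t₀≤t iz short ⟩
            e⁻ z                             ≈⟨ trans (*-identityˡ _) (*-identityˡ _) ⟨
            1# * weight (decay t₀) 0 z       ∎))))

      truncate-HasSum : HasSum IsIndex (λ z → w z * taylor p (x * E z)) (truncate p (𝒵 b t) x)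
      truncate-HasSum = HasSum-cong (λ z _ → term z) (∑-cong (suc p) (λ r → *-comm (x ^ toℕ r) (𝒵 b t (toℕ r))))
        (HasSum-∑ {n = suc p} (λ r → HasSum-* (x ^ toℕ r) (𝒵-HasSum 0≤b 0<t (toℕ r))))
        where
        term : ∀ z → ∑[ r ≤ p ] (x ^ toℕ r * (w z * expSeries (E z) (toℕ r))) ≈ w z * taylor p (x * E z)
        term z = trans (∑-cong (suc p) (λ r → trans
          (solve 3 (λ a w e → a :* (w :* e) := w :* (a :* e)) refl (x ^ toℕ r) (w z) (expSeries (E z) (toℕ r)))
            (*-congˡ (sym (expSeries-* x (E z) (toℕ r))))))
          (sym (*-distribˡ-sum {suc p} (w z) (λ r → expSeries (x * E z) (toℕ r))))

    remainder≤ : ∣ heatTrace (1# + b) N t - truncate p (𝒵 b t) x ∣ ≤ X * (C₃ * d ^ k) * proj₁ (Σ-weight-bounded (decay-pos 0<t₀) (2 ℕ.* k))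
    remainder≤ = HasSum-∣∣≤ (λ F (uF , iF) → begin
      finiteSum (λ z → ∣ D z ∣) F
        ≤⟨ Σ-mono F (λ z z∈F → ∣D∣≤ z (All.lookup iF z∈F)) ⟩
      finiteSum (λ z → X * (C₃ * d ^ k) * weight (decay t₀) (2 ℕ.* k) z) F      ≈⟨ Σ-* _ (weight (decay t₀) (2 ℕ.* k)) F ⟩
      X * (C₃ * d ^ k) * finiteSum (weight (decay t₀) (2 ℕ.* k)) F
        ≤⟨ *-monoʳ-≤ (*-nonNeg 0≤X (*-nonNeg (+-nonNeg (*-nonNeg (fromℕ-nonNeg 2) 0≤taylorConstant) (fromℕ-nonNeg (suc p))) (^-nonNeg k 0≤d)))
             (proj₂ (Σ-weight-bounded (decay-pos 0<t₀) (2 ℕ.* k)) F (uF , iF)) ⟩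
      X * (C₃ * d ^ k) * proj₁ (Σ-weight-bounded (decay-pos 0<t₀) (2 ℕ.* k))    ∎)
      (HasSum-+ (HasSum-extend {S = IsIndex} (IsShort a c) heatTrace-HasSum) (HasSum-neg truncate-HasSum))

  Remainder : ℕ → ℕ → Carrier → Carrier → Carrier
  Remainder p N t b = ∣ heatTrace (1# + b) N t - truncate p (𝒵 b t) ((fromℕ N + b) ⁻¹) ∣

  remainder-uniform : ∀ {t₀ t₁ b₁} → 0# < t₀ → 0# ≤ b₁ → ∀ p → ∃[ C ] ∃[ N₀ ] (1 ℕ.≤ N₀) × (∀ N → N₀ ℕ.≤ N → ∀ t b →
    t₀ ≤ t → t ≤ t₁ → 0# ≤ b → b ≤ b₁ → Remainder p N t b ≤ C * ((fromℕ N + b) ⁻¹) ^ suc p)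
  remainder-uniform {t₀} {t₁} {b₁} 0<t₀ 0≤b₁ p = C , suc n , ℕ.s≤s ℕ.z≤n , bound
    where
    k = p ℕ.+ suc p
    A W C : Carrier
    A = (fromℕ 2 * taylorConstant p + fromℕ (suc p)) * (exponentConstant b₁ t₁ + fromℕ 4) ^ k
    W = proj₁ (Σ-weight-bounded (decay-pos 0<t₀) (2 ℕ.* k))
    C = A * W
    -- From N > n on, b ≤ b₁ ≤ N holds throughout the region.
    n = proj₁ (archimedean b₁)
    bound : ∀ N → suc n ℕ.≤ N → ∀ t b → t₀ ≤ t → t ≤ t₁ → 0# ≤ b → b ≤ b₁ →
            Remainder p N t b ≤ C * ((fromℕ N + b) ⁻¹) ^ suc p
    bound (suc N) 1+n≤N t b t₀≤t t≤t₁ 0≤b b≤b₁ =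
      -- The row holding m is set aside; the remaining rows are halved, so that a and c differ by at
      -- most one.
      ≡.subst (λ N → Remainder p (suc N) t b ≤ C * ((fromℕ (suc N) + b) ⁻¹) ^ suc p) (ℕ.⌊n/2⌋+⌈n/2⌉≡n N)
        (≤-trans (remainder≤ ⌊ N /2⌋ ⌈ N /2⌉ (ℕ.≤-trans (ℕ.⌊n/2⌋≤⌈n/2⌉ N) (ℕ.n≤1+n _)) (ℕ.⌊n/2⌋-mono (ℕ.n≤1+n (suc N)))
            0<t₀ 0≤b₁ b₁≤N t₀≤t t≤t₁ 0≤b b≤b₁ p)
          (≤-reflexive (solve 3 (λ X A W → X :* A :* W := A :* W :* X) refl _ A W)))
      where
      b₁≤N : b₁ ≤ fromℕ (suc (⌊ N /2⌋ ℕ.+ ⌈ N /2⌉))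
      b₁≤N = ≤-trans (proj₂ (archimedean b₁)) (fromℕ-mono-≤ (ℕ.≤-trans (ℕ.≤-trans (ℕ.n≤1+n n) 1+n≤N)
        (ℕ.≤-reflexive (≡.cong suc (≡.sym (ℕ.⌊n/2⌋+⌈n/2⌉≡n N))))))

  -- From parameter rectangles to compact sets

  ∣y-x∣<⇒y<x+ : ∀ {x y ε} → ∣ y - x ∣ < ε → y < x + ε
  ∣y-x∣<⇒y<x+ {x} {y} {ε} close = ≤-<-trans (≤-reflexive (solve 2 (λ x y → y := x :+ (y :- x)) refl x y))
    (≤-<-trans (+-monoʳ-≤ x (x≤∣x∣ _)) (+-monoʳ-< x close))

  ∣y-x∣<⇒x-<y : ∀ {x y ε} → ∣ y - x ∣ < ε → x - ε < y
  ∣y-x∣<⇒x-<y {x} {y} {ε} close = ≤-<-trans (≤-reflexive (+-comm x (- ε)))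
    (<-≤-trans (+-monoʳ-< (- ε) (∣y-x∣<⇒y<x+ (≤-<-trans (≤-reflexive (∣x-y∣≈∣y-x∣ x y)) close)))
      (≤-reflexive (solve 2 (λ y e → (:- e) :+ (y :+ e) := y) refl y ε)))

  -- The open sets where f < c, over all c, cover K. The sum of the absolute values of the finitely
  -- many chosen c is an upper bound, and is nonnegative even for empty K, as required of b₁.
  compact⇒bounded : ∀ {K} → Compact K → (f : Plane → Carrier) → (∀ c → Open (λ x → f x < c)) → ∃[ B ] 0# ≤ B × (∀ x → K x → f x ≤ B)
  compact⇒bounded {K} compact f open-< =
    let cs , cover = compact {I = Carrier} (λ c x → f x < c) open-< (λ x _ → f x + 1# , f<f+1 x)
        B , 0≤B , cs≤B = maximum cs
    in B , 0≤B , λ x Kx → <B x cs cs≤B (cover x Kx)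
    where
    f<f+1 : ∀ x → f x < f x + 1#
    f<f+1 x = ≤-<-trans (≤-reflexive (sym (+-identityʳ (f x)))) (+-monoʳ-< (f x) 0<1)
    maximum : ∀ cs → ∃[ B ] 0# ≤ B × All (_≤ B) cs
    maximum []       = 0# , ≤-refl , []
    maximum (c ∷ cs) = let B , 0≤B , cs≤B = maximum cs in
      ∣ c ∣ + B , +-nonNeg (∣x∣-nonNeg c) 0≤B ,
      ≤-trans (x≤∣x∣ c) (≤-by 0≤B refl) ∷ All.map (λ c≤B → ≤-trans c≤B (≤-by (∣x∣-nonNeg c) (+-comm _ _))) cs≤B
    <B : ∀ {B} x cs → All (_≤ B) cs → Any (λ c → f x < c) cs → f x ≤ B
    <B x (c ∷ cs) (c≤B ∷ _)  (here f<c) = ≤-trans (<⇒≤ f<c) c≤B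
    <B x (c ∷ cs) (_ ∷ cs≤B) (there f<) = <B x cs cs≤B f<

  -- The cover consists of the half-planes δ < t and is indexed by δ together with its positivity,
  -- so the least δ of a finite subcover is positive; an empty subcover gets the value 1.
  compact⇒boundedBelow : ∀ {K} → Compact K → (∀ t b → K (t , b) → 0# < t) → ∃[ t₀ ] 0# < t₀ × (∀ t b → K (t , b) → t₀ ≤ t)
  compact⇒boundedBelow {K} compact 0<t =
    let is , cover = compact {I = ∃ (0# <_)} (λ (δ , _) (t , _) → δ < t) open-> (λ (t , b) Ktb → (½ * t , *-pos 0<½ (0<t t b Ktb)) , half (0<t t b Ktb))
        t₀ , 0<t₀ , t₀≤ = minimum is
    in t₀ , 0<t₀ , λ t b Ktb → t₀< t is t₀≤ (cover (t , b) Ktb)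
    where
    half : ∀ {t} → 0# < t → ½ * t < t
    half {t} 0<t = ≤-<-trans (≤-reflexive (sym (+-identityʳ _)))
      (<-≤-trans (+-monoʳ-< (½ * t) (*-pos 0<½ 0<t)) (≤-reflexive (½+½ t)))
    open-> : (i : ∃ (0# <_)) → Open (λ (t , _) → proj₁ i < t)
    open-> (δ , _) t b δ<t = t - δ , x<y⇒0<y-x δ<t , λ t′ _ close _ → ≤-<-trans
      (≤-reflexive (solve 2 (λ t d → d := t :- (t :- d)) refl t δ)) (∣y-x∣<⇒x-<y close)
    minimum : ∀ (is : List (∃ (0# <_))) → ∃[ t₀ ] 0# < t₀ × All (λ i → t₀ ≤ proj₁ i) is
    minimum []             = 1# , 0<1 , []
    minimum ((δ , 0<δ) ∷ is) with minimum is
    ... | t₀ , 0<t₀ , t₀≤ with total δ t₀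
    ...   | inj₁ δ≤t₀ = δ , 0<δ , ≤-refl ∷ All.map (≤-trans δ≤t₀) t₀≤
    ...   | inj₂ t₀≤δ = t₀ , 0<t₀ , t₀≤δ ∷ t₀≤
    t₀< : ∀ {t₀} t (is : List (∃ (0# <_))) → All (λ i → t₀ ≤ proj₁ i) is → Any (λ i → proj₁ i < t) is → t₀ ≤ t
    t₀< t (_ ∷ is) (t₀≤δ ∷ _) (here δ<t) = ≤-trans t₀≤δ (<⇒≤ δ<t)
    t₀< t (_ ∷ is) (_ ∷ t₀≤)  (there h)  = t₀< t is t₀≤ h

  pointwise : (t b : Carrier) (p : ℕ) → 0# < t → 0# ≤ b → ∃[ C ] ∃[ N₀ ] (1 ℕ.≤ N₀) × (∀ N → N₀ ℕ.≤ N →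
    Remainder p N t b ≤ C * ((fromℕ N + b) ⁻¹) ^ suc p)
  pointwise t b p 0<t 0≤b =
    let C , N₀ , 1≤N₀ , bound = remainder-uniform 0<t 0≤b p
    in C , N₀ , 1≤N₀ , λ N N₀≤N → bound N N₀≤N t b ≤-refl ≤-refl 0≤b ≤-refl

  locallyUniform : (K : Pred Plane 0ℓ) → Compact K → (∀ t b → K (t , b) → (0# < t) × (0# ≤ b)) → (p : ℕ) →
    ∃[ C ] ∃[ N₀ ] (1 ℕ.≤ N₀) × (∀ N → N₀ ℕ.≤ N → ∀ t b → K (t , b) → (fromℕ N + b) ^ suc p * Remainder p N t b ≤ C)
  locallyUniform K compact region p =
    let t₀ , 0<t₀ , t₀≤ = compact⇒boundedBelow compact (λ t b Ktb → proj₁ (region t b Ktb))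
        t₁ , _ , ≤t₁ = compact⇒bounded compact proj₁ (λ c t b t<c → c - t , x<y⇒0<y-x t<c , λ t′ _ close _ → below close)
        b₁ , 0≤b₁ , ≤b₁ = compact⇒bounded compact proj₂ (λ c t b b<c → c - b , x<y⇒0<y-x b<c , λ _ b′ _ close → below close)
        C , N₀ , 1≤N₀ , bound = remainder-uniform {t₁ = t₁} 0<t₀ 0≤b₁ p
    in C , N₀ , 1≤N₀ , λ N N₀≤N t b Ktb →
         let 0≤b = proj₂ (region t b Ktb)
             0<N = fromℕ-pos N {{ℕ.>-nonZero (ℕ.≤-trans 1≤N₀ N₀≤N)}}
         in rescale (+-pos-nonNeg 0<N 0≤b) (bound N N₀≤N t b (t₀≤ t b Ktb) (≤t₁ (t , b) Ktb) 0≤b (≤b₁ (t , b) Ktb))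
    where
    below : ∀ {x y c} → ∣ y - x ∣ < c - x → y < c
    below {x} {y} {c} close = <-≤-trans (∣y-x∣<⇒y<x+ close) (≤-reflexive (solve 2 (λ x c → x :+ (c :- x) := c) refl x c))
    rescale : ∀ {y r C} → 0# < y → r ≤ C * (y ⁻¹) ^ suc p → y ^ suc p * r ≤ C
    rescale {y} {r} {C} 0<y r≤ = begin
      y ^ suc p * r                      ≤⟨ *-monoʳ-≤ (^-nonNeg (suc p) (<⇒≤ 0<y)) r≤ ⟩
      y ^ suc p * (C * (y ⁻¹) ^ suc p)   ≈⟨ solve 3 (λ a c b → a :* (c :* b) := c :* (a :* b)) refl _ C _ ⟩
      C * (y ^ suc p * (y ⁻¹) ^ suc p)   ≈⟨ *-congˡ (^-distrib-* y (y ⁻¹) (suc p)) ⟨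
      C * (y * y ⁻¹) ^ suc p             ≈⟨ *-congˡ (trans (^-congˡ (suc p) (⁻¹-inverseʳ (<⇒≉0 0<y))) (1^n≈1 (suc p))) ⟩
      C * 1#                             ≈⟨ *-identityʳ C ⟩
      C                                  ∎

theorem1p5 : (em : ExcludedMiddle 0ℓ) (R : CompleteOrderedField) →
    let open Jack em R in
    ((t b : Carrier) (p : ℕ) → 0# < t → 0# ≤ b →
    ∃[ C ] ∃[ N₀ ] (1 ℕ.≤ N₀) × (∀ N → N₀ ℕ.≤ N →
    ∣ heatTrace (1# + b) N t - truncate p (𝒵 b t) ((fromℕ N + b) ⁻¹) ∣
    ≤ C * ((fromℕ N + b) ⁻¹) ^ suc p))
    ×
    ((K : Pred Plane 0ℓ) → Compact K →
    (∀ t b → K (t , b) → (0# < t) × (0# ≤ b)) → (p : ℕ) →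
    ∃[ C ] ∃[ N₀ ] (1 ℕ.≤ N₀) × (∀ N → N₀ ℕ.≤ N → ∀ t b → K (t , b) →
    (fromℕ N + b) ^ suc p
    * ∣ heatTrace (1# + b) N t - truncate p (𝒵 b t) ((fromℕ N + b) ⁻¹) ∣
    ≤ C))
theorem1p5 em R = pointwise , locallyUniform
  where open JackHeatTrace em R
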